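{- For each of the groups $\mathbb{Z}/17\mathbb{Z}\oplus\mathbb{Z}$, $\mathbb{Z}/21\mathbb{Z}\oplus\mathbb{Z}$, $\mathbb{Z}/3\mathbb{Z}\oplus\mathbb{Z}/9\mathbb{Z}\oplus\mathbb{Z}$, $\mathbb{Z}/4\mathbb{Z}\oplus\mathbb{Z}/8\mathbb{Z}\oplus\mathbb{Z}$, and $\mathbb{Z}/5\mathbb{Z}\oplus\mathbb{Z}/5\mathbb{Z}\oplus\mathbb{Z}$, there exist a quartic number field $K$ and an elliptic curve $E$ over $K$ whose Mordell--Weil group $E(K)$ contains a subgroup isomorphic to that group. -}

module Defs where

open import Data.Nat using (ℕ)
open import Data.Integer as ℤ using (ℤ)
open import Data.Integer.Divisibility using () renaming (_∣_ to _∣ℤ_)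
import Data.Rational
open import Data.Rational using (ℚ; 0ℚ; 1ℚ; _+_; _*_; _-_; -_)
open import Data.Product using (Σ; ∃; _×_; _,_)
open import Data.Sum using (_⊎_)
open import Data.Vec using (Vec; []; _∷_; zipWith)
open import Data.Vec.Relation.Unary.All using (All)
open import Relation.Binary.PropositionalEquality using (_≡_)
open import Relation.Nullary using (¬_)

-- Quartic number fields  K = ℚ[x]/(f),  f = x⁴ + c₃x³ + c₂x² + c₁x + c₀
-- monic and irreducible over ℚ.  Every quartic number field is of this
-- form (primitive element theorem).

record Quartic : Set where
  constructor quartic
  field c₀ c₁ c₂ c₃ : ℚ

-- f is reducible over ℚ iff it is a product of two non-constant
-- polynomials; since f is monic, we may take both factors monic, so
-- f = (linear)(cubic) or f = (quadratic)(quadratic).  Coefficients are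
-- compared after expanding the products.
Reducible : Quartic → Set
Reducible (quartic c₀ c₁ c₂ c₃) =
  -- (x + a)(x³ + b x² + c x + d)
  (Σ ℚ λ a → Σ ℚ λ b → Σ ℚ λ c → Σ ℚ λ d →
     (c₃ ≡ a + b) × (c₂ ≡ c + a * b) × (c₁ ≡ d + a * c) × (c₀ ≡ a * d))
  ⊎
  -- (x² + a x + b)(x² + c x + d)
  (Σ ℚ λ a → Σ ℚ λ b → Σ ℚ λ c → Σ ℚ λ d →
     (c₃ ≡ a + c) × (c₂ ≡ b + d + a * c) × (c₁ ≡ a * d + b * c) × (c₀ ≡ b * d))

Irreducible : Quartic → Set
Irreducible f = ¬ Reducible f

-- Elements of K: a₀ + a₁ θ + a₂ θ² + a₃ θ³ where θ is the class of x.
-- Since the basis is fixed and ℚ is normalised, equality in K is _≡_.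
record K (f : Quartic) : Set where
  constructor ⟨_,_,_,_⟩
  field a₀ a₁ a₂ a₃ : ℚ

module Field (f : Quartic) where
  open Quartic f

  0K 1K : K f
  0K = ⟨ 0ℚ , 0ℚ , 0ℚ , 0ℚ ⟩
  1K = ⟨ 1ℚ , 0ℚ , 0ℚ , 0ℚ ⟩

  embed : ℚ → K f
  embed q = ⟨ q , 0ℚ , 0ℚ , 0ℚ ⟩

  nK : ℕ → K f
  nK n = embed (Data.Rational._/_ (ℤ.+ n) 1)

  infixl 6 _+K_ _-K_
  infixl 7 _*K_
  _+K_ _-K_ _*K_ : K f → K f → K f
  ⟨ a , b , c , d ⟩ +K ⟨ a' , b' , c' , d' ⟩ = ⟨ a + a' , b + b' , c + c' , d + d' ⟩
  ⟨ a , b , c , d ⟩ -K ⟨ a' , b' , c' , d' ⟩ = ⟨ a - a' , b - b' , c - c' , d - d' ⟩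
  -- product of polynomials, then reduce using θ⁴ = -(c₃θ³+c₂θ²+c₁θ+c₀)
  ⟨ a , b , c , d ⟩ *K ⟨ a' , b' , c' , d' ⟩ = reduce p₀ p₁ p₂ p₃ p₄ p₅ p₆
    where
    p₀ = a * a'
    p₁ = a * b' + b * a'
    p₂ = a * c' + b * b' + c * a'
    p₃ = a * d' + b * c' + c * b' + d * a'
    p₄ = b * d' + c * c' + d * b'
    p₅ = c * d' + d * c'
    p₆ = d * d'
    reduce : ℚ → ℚ → ℚ → ℚ → ℚ → ℚ → ℚ → K f
    reduce q₀ q₁ q₂ q₃ q₄ q₅ q₆ =
      -- eliminate θ⁶ : θ⁶ = -(c₃θ⁵ + c₂θ⁴ + c₁θ³ + c₀θ²)
      let r₅ = q₅ - q₆ * c₃ ; r₄ = q₄ - q₆ * c₂ ; r₃ = q₃ - q₆ * c₁ ; r₂ = q₂ - q₆ * c₀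
          s₄ = r₄ - r₅ * c₃ ; s₃ = r₃ - r₅ * c₂ ; s₂ = r₂ - r₅ * c₁ ; s₁ = q₁ - r₅ * c₀
      in ⟨ q₀ - s₄ * c₀ , s₁ - s₄ * c₁ , s₂ - s₄ * c₂ , s₃ - s₄ * c₃ ⟩

-- Elliptic curves over K in long Weierstrass form
--   y² + a₁xy + a₃y = x³ + a₂x² + a₄x + a₆,   Δ ≠ 0.

record Weierstrass (f : Quartic) : Set where
  constructor weierstrass
  field a₁ a₂ a₃ a₄ a₆ : K f

module Curve {f : Quartic} (E : Weierstrass f) where
  open Field f
  open Weierstrass E

  b₂ b₄ b₆ b₈ Δ : K f
  b₂ = a₁ *K a₁ +K nK 4 *K a₂
  b₄ = nK 2 *K a₄ +K a₁ *K a₃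
  b₆ = a₃ *K a₃ +K nK 4 *K a₆
  b₈ = a₁ *K a₁ *K a₆ +K nK 4 *K a₂ *K a₆
       -K a₁ *K a₃ *K a₄ +K a₂ *K a₃ *K a₃ -K a₄ *K a₄
  Δ = 0K -K b₂ *K b₂ *K b₈ -K nK 8 *K b₄ *K b₄ *K b₄
      -K nK 27 *K b₆ *K b₆
      +K nK 9 *K b₂ *K b₄ *K b₆

  OnCurve : K f → K f → Set
  OnCurve x y = y *K y +K a₁ *K x *K y +K a₃ *K y
                ≡ x *K x *K x +K a₂ *K x *K x +K a₄ *K x +K a₆

  data Point : Set where
    O      : Point
    affine : (x y : K f) → OnCurve x y → Point

  -- negation: -(x, y) = (x, -y - a₁x - a₃)
  -- Sum P Q R  :  "P + Q = R" for the chord-tangent group law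
  -- (Silverman, AEC III.2.3), phrased with the slope λ given by the
  -- defining equation instead of a division.
  data Sum : Point → Point → Point → Set where
    O-left  : ∀ P → Sum O P P
    O-right : ∀ P → Sum P O P
    inverse : ∀ x₁ y₁ p y₂ q →
              y₂ ≡ 0K -K y₁ -K a₁ *K x₁ -K a₃ →
              Sum (affine x₁ y₁ p) (affine x₁ y₂ q) O
    chord   : ∀ x₁ y₁ p x₂ y₂ q x₃ y₃ r (λ' : K f) →
              ¬ (x₁ ≡ x₂) →
              λ' *K (x₂ -K x₁) ≡ y₂ -K y₁ →
              x₃ ≡ λ' *K λ' +K a₁ *K λ' -K a₂ -K x₁ -K x₂ →
              y₃ ≡ 0K -K (λ' +K a₁) *K x₃ -K (y₁ -K λ' *K x₁) -K a₃ →
              Sum (affine x₁ y₁ p) (affine x₂ y₂ q) (affine x₃ y₃ r)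
    tangent : ∀ x₁ y₁ p q x₃ y₃ r (λ' : K f) →
              ¬ (nK 2 *K y₁ +K a₁ *K x₁ +K a₃ ≡ 0K) →
              λ' *K (nK 2 *K y₁ +K a₁ *K x₁ +K a₃)
                ≡ nK 3 *K x₁ *K x₁
                  +K nK 2 *K a₂ *K x₁ +K a₄ -K a₁ *K y₁ →
              x₃ ≡ λ' *K λ' +K a₁ *K λ' -K a₂ -K x₁ -K x₁ →
              y₃ ≡ 0K -K (λ' +K a₁) *K x₃ -K (y₁ -K λ' *K x₁) -K a₃ →
              Sum (affine x₁ y₁ p) (affine x₁ y₁ q) (affine x₃ y₃ r)

-- Finitely generated abelian groups  ℤ/m₁ ⊕ … ⊕ ℤ/mₖ  (mᵢ = 0 means ℤ)
-- presented as ℤᵏ modulo componentwise congruence.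

Elt : ℕ → Set
Elt k = Vec ℤ k

_⊕_ : ∀ {k} → Elt k → Elt k → Elt k
_⊕_ = zipWith ℤ._+_

Congruent : ∀ {k} → Vec ℕ k → Elt k → Elt k → Set
Congruent [] [] [] = Data.Unit.⊤
  where import Data.Unit
Congruent (m ∷ ms) (g ∷ gs) (h ∷ hs) = (ℤ.+ m ∣ℤ (g ℤ.- h)) × Congruent ms gs hs

-- E(K) contains a subgroup isomorphic to ⊕ᵢ ℤ/mᵢ : there is a map
-- φ : ℤᵏ → E(K) which is additive, and whose fibres are exactly the
-- congruence classes (so it descends to an injective homomorphism from
-- ⊕ ℤ/mᵢ; its image is the required subgroup).
ContainsSubgroup : ∀ {f : Quartic} (E : Weierstrass f) {k} → Vec ℕ k → Set
ContainsSubgroup E {k} ms =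
  Σ (Elt k → Point) λ φ →
    (∀ g h → Sum (φ g) (φ h) (φ (g ⊕ h))) ×
    (∀ g h → φ g ≡ φ h → Congruent ms g h) ×
    (∀ g h → Congruent ms g h → φ g ≡ φ h)
  where open Curve E

Realised : ∀ {k} → Vec ℕ k → Set
Realised ms =
  Σ Quartic λ f → Irreducible f ×
  Σ (Weierstrass f) λ E → ¬ (Curve.Δ E ≡ Field.0K f) × ContainsSubgroup E ms

{-# OPTIONS --safe #-}

-- For each group we exhibit a quartic field, a curve y² = x³ + a₂x² + a₄x + a₆ over it, torsion points
-- whose orders are read off from a few explicit doublings, and one more point P.
--
-- Group law. Let l, m be the slopes of the lines through A, B, −S and S, C, −U. The product of the two
-- lines divided by x − x(S) equals (x − x(A))(x − x(B)) − (l + m)(y − lx − n), the function with a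
-- pole of order 4 at O that vanishes at A, B, C, −U. The same function formed from B, C first differs
-- from it by the equation of a line through A, B, C, so the two agree unless A + B + C = O, and they
-- determine U. This proves associativity.
--
-- Infinite order. If x(P) has denominator exactly 4ʳ with r ≥ 1 at a place over 2, the
-- duplication formula shows that x(2P) has denominator exactly 4ʳ⁺¹ there. Hence the points 2ᵏP are
-- pairwise distinct.
--
-- Fields. A quartic is irreducible, and its quotient a field, once the norm form has no nontrivial
-- zero. Either 3 is inert, or the field is an imaginary quadratic extension of a real quadratic field.
module Submission where

open import Defs
open import Algebra.Bundles using (AbelianGroup; CommutativeRing)
import Algebra.Properties.AbelianGroup
import Algebra.Properties.CommutativeMonoid.Mult
import Algebra.Properties.Monoid.Mult
import Algebra.Properties.Ring
open import Algebra.Structures using (IsAbelianGroup; IsCommutativeRing)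
open import Data.Bool using (Bool; true; _∧_)
open import Data.Empty using (⊥; ⊥-elim)
open import Data.Fin as Fin using (Fin; zero; suc; toℕ; fromℕ<; #_)
import Data.Fin.Properties as Fin
open import Data.Integer as ℤ using (ℤ; +_; -[1+_]; ∣_∣; _%ℕ_; _/ℕ_)
open import Data.Integer.Divisibility using () renaming (_∣_ to _∣ℤ_)
open import Data.Integer.Divisibility.Signed as ℤ∣ using (_∣_; divides)
open import Data.Integer.DivMod using (a≡a%ℕn+[a/ℕn]*n; n%ℕd<d)
import Data.Integer.Properties as ℤ
open import Data.List using (List; []; _∷_)
open import Data.Nat as ℕ using (ℕ; zero; suc; _≤_; _<_; z≤n; s≤s; _^_)
open import Data.Nat.Coprimality using (Coprime; coprime-Bézout)
import Data.Nat.Divisibility as ℕ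
import Data.Nat.DivMod as ℕ
open import Data.Nat.GCD using (module Bézout)
open import Data.Nat.Primality using (Prime; prime?; prime⇒irreducible; prime⇒nonZero; euclidsLemma)
import Data.Nat.Properties as ℕ
open import Data.Product using (Σ; _×_; _,_; proj₁; proj₂)
open import Data.Rational as ℚ using (ℚ; 0ℚ; 1ℚ; ↥_; ↧_; _/_)
open import Data.Rational.Literals using (fromℤ)
import Data.Rational.Properties as ℚ
import Data.Rational.Unnormalised as ℚᵘ
import Data.Rational.Unnormalised.Properties as ℚᵘ
open import Data.Sum using (_⊎_; inj₁; inj₂; [_,_]′)
open import Data.Unit using (⊤; tt)
open import Data.Vec as Vec using (Vec; []; _∷_; lookup; _++_; replicate)
open import Data.Vec.N-ary using (N-ary; _$ⁿ_; curryⁿ; ∀ⁿ)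
open import Data.Vec.Properties using (≡-dec; lookup-map)
open import Relation.Binary.PropositionalEquality as ≡ using (_≡_; refl; sym; trans; cong; cong₂; subst; module ≡-Reasoning)
open import Relation.Nullary using (¬_; Dec; yes; no; does; contradiction; ¬?; _⊎-dec_; map′)
open import Relation.Nullary.Decidable using (True; toWitness; from-yes; from-no)

-- The definitions ask for a `Sum` for every pair of elements in the image of ℤᵏ, not merely for the
-- listed points, so a group law with all its degenerate cases has to be available. Explicit sums
-- are certified by a given slope: the remaining equations involve only products and hold by
-- computation with normalised rationals. For large x one has x(2P) ≈ x(P)/4, which is why
-- denominators are measured in powers of 4 and not of a uniformiser. Two facts about units suffice
-- for the induction: a unit plus 4 times an integral element is a unit, and 4 times an integral
-- element is not. Hence ramified places serve as well as unramified ones, and the ring of integral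
-- elements may be any subring that contains the coefficients together with the numerator and
-- cofactor describing x(P). A relation t + nP = O with t torsion forces n = 0. What remains is a
-- relation between torsion points, and this is tested on multiples of prime order.

-- Integer multiples in an abelian group.

module Multiples {A : Set} {_∙_ : A → A → A} {ε : A} {_⁻¹ : A → A} (G : IsAbelianGroup _≡_ _∙_ ε _⁻¹) where
  open IsAbelianGroup G using (assoc; comm; identityˡ; identityʳ; inverseʳ)
  abelianGroup : AbelianGroup _ _
  abelianGroup = record { isAbelianGroup = G }

  open Algebra.Properties.AbelianGroup abelianGroup using (ε⁻¹≈ε; ⁻¹-involutive; ⁻¹-anti-homo-∙)
  open Algebra.Properties.Monoid.Mult (AbelianGroup.monoid abelianGroup) using (×-homo-+) renaming (_×_ to _×ℕ_)
  open Algebra.Properties.CommutativeMonoid.Mult (AbelianGroup.commutativeMonoid abelianGroup) using (×-distrib-+)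
  open ≡-Reasoning

  infixr 7 _·_

  _·_ : ℤ → A → A
  + n      · x = n ×ℕ x
  -[1+ n ] · x = (suc n ×ℕ x) ⁻¹

  ⁻¹-homo-∙ : ∀ x y → (x ∙ y) ⁻¹ ≡ (x ⁻¹) ∙ (y ⁻¹)
  ⁻¹-homo-∙ x y = trans (⁻¹-anti-homo-∙ x y) (comm _ _)

  interchange : ∀ a b c d → (a ∙ b) ∙ (c ∙ d) ≡ (a ∙ c) ∙ (b ∙ d)
  interchange a b c d = begin
    (a ∙ b) ∙ (c ∙ d) ≡⟨ assoc a b _ ⟩
    a ∙ (b ∙ (c ∙ d)) ≡⟨ cong (a ∙_) (sym (assoc b c d)) ⟩
    a ∙ ((b ∙ c) ∙ d) ≡⟨ cong (λ t → a ∙ (t ∙ d)) (comm b c) ⟩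
    a ∙ ((c ∙ b) ∙ d) ≡⟨ cong (a ∙_) (assoc c b d) ⟩
    a ∙ (c ∙ (b ∙ d)) ≡⟨ sym (assoc a c _) ⟩
    (a ∙ c) ∙ (b ∙ d) ∎

  -- Integer addition of opposite signs is defined through `⊖`, so this carries the mixed-sign cases
  -- of `·-homo-+`.
  ·-⊖ : ∀ m n x → (m ℤ.⊖ n) · x ≡ (+ m · x) ∙ ((+ n · x) ⁻¹)
  ·-⊖ m zero x = sym (trans (cong₂ _∙_ refl ε⁻¹≈ε) (identityʳ _))
  ·-⊖ zero (suc n) x = sym (identityˡ _)
  ·-⊖ (suc m) (suc n) x = begin
    (suc m ℤ.⊖ suc n) · x                  ≡⟨ cong (_· x) (ℤ.[1+m]⊖[1+n]≡m⊖n m n) ⟩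
    (m ℤ.⊖ n) · x                          ≡⟨ ·-⊖ m n x ⟩
    (m ×ℕ x) ∙ ((n ×ℕ x) ⁻¹)               ≡⟨ sym (identityˡ _) ⟩
    ε ∙ ((m ×ℕ x) ∙ ((n ×ℕ x) ⁻¹))         ≡⟨ cong₂ _∙_ (sym (inverseʳ x)) refl ⟩
    (x ∙ (x ⁻¹)) ∙ ((m ×ℕ x) ∙ ((n ×ℕ x) ⁻¹)) ≡⟨ interchange _ _ _ _ ⟩
    (x ∙ (m ×ℕ x)) ∙ ((x ⁻¹) ∙ ((n ×ℕ x) ⁻¹)) ≡⟨ cong₂ _∙_ refl (sym (⁻¹-homo-∙ x (n ×ℕ x))) ⟩
    (x ∙ (m ×ℕ x)) ∙ ((x ∙ (n ×ℕ x)) ⁻¹) ∎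

  ·-homo-+ : ∀ m n x → (m ℤ.+ n) · x ≡ (m · x) ∙ (n · x)
  ·-homo-+ (+ m) (+ n) x = ×-homo-+ x m n
  ·-homo-+ (+ m) -[1+ n ] x = ·-⊖ m (suc n) x
  ·-homo-+ -[1+ m ] (+ n) x = trans (·-⊖ n (suc m) x) (comm _ _)
  ·-homo-+ -[1+ m ] -[1+ n ] x = begin
    (suc (suc (m ℕ.+ n)) ×ℕ x) ⁻¹       ≡⟨ cong (λ k → (k ×ℕ x) ⁻¹) (cong suc (sym (ℕ.+-suc m n))) ⟩
    ((suc m ℕ.+ suc n) ×ℕ x) ⁻¹         ≡⟨ cong _⁻¹ (×-homo-+ x (suc m) (suc n)) ⟩
    ((suc m ×ℕ x) ∙ (suc n ×ℕ x)) ⁻¹    ≡⟨ ⁻¹-homo-∙ _ _ ⟩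
    ((suc m ×ℕ x) ⁻¹) ∙ ((suc n ×ℕ x) ⁻¹) ∎

  ·-homo-neg : ∀ n x → (ℤ.- n) · x ≡ (n · x) ⁻¹
  ·-homo-neg (+ zero) x = sym ε⁻¹≈ε
  ·-homo-neg (+ suc n) x = refl
  ·-homo-neg -[1+ n ] x = sym (⁻¹-involutive _)

  ·-zeroʳ : ∀ n → n · ε ≡ ε
  ·-zeroʳ (+ n) = ×ε n
    where
    ×ε : ∀ n → n ×ℕ ε ≡ ε
    ×ε zero    = refl
    ×ε (suc n) = trans (identityˡ _) (×ε n)
  ·-zeroʳ -[1+ n ] = trans (cong _⁻¹ (·-zeroʳ (+ suc n))) ε⁻¹≈ε

  ·-distrib-∙ : ∀ n x y → n · (x ∙ y) ≡ (n · x) ∙ (n · y)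
  ·-distrib-∙ (+ n) x y = ×-distrib-+ x y n
  ·-distrib-∙ -[1+ n ] x y = trans (cong _⁻¹ (×-distrib-+ x y (suc n))) (⁻¹-homo-∙ _ _)

  ·-assoc : ∀ m n x → (m ℤ.* n) · x ≡ m · (n · x)
  ·-assoc (+ m) n x = ·-assocℕ m
    where
    ·-assocℕ : ∀ m → (+ m ℤ.* n) · x ≡ m ×ℕ (n · x)
    ·-assocℕ zero    = refl
    ·-assocℕ (suc m) = begin
      (+ suc m ℤ.* n) · x          ≡⟨ cong (_· x) (ℤ.suc-* (+ m) n) ⟩
      (n ℤ.+ + m ℤ.* n) · x        ≡⟨ ·-homo-+ n (+ m ℤ.* n) x ⟩
      (n · x) ∙ ((+ m ℤ.* n) · x)  ≡⟨ cong₂ _∙_ refl (·-assocℕ m) ⟩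
      (n · x) ∙ (m ×ℕ (n · x)) ∎
  ·-assoc -[1+ m ] n x = begin
    (-[1+ m ] ℤ.* n) · x         ≡⟨ cong (_· x) (sym (ℤ.neg-distribˡ-* (+ suc m) n)) ⟩
    (ℤ.- (+ suc m ℤ.* n)) · x    ≡⟨ ·-homo-neg (+ suc m ℤ.* n) x ⟩
    ((+ suc m ℤ.* n) · x) ⁻¹     ≡⟨ cong _⁻¹ (·-assoc (+ suc m) n x) ⟩
    (suc m ×ℕ (n · x)) ⁻¹ ∎

-- A reflective solver for commutative rings.

infixl 6 _:+_ _:-_
infixl 7 _:*_

data Expr (n : ℕ) : Set where
  con  : ℤ → Expr n
  var  : Fin n → Expr n
  _:+_ _:-_ _:*_ : Expr n → Expr n → Expr n

-- Polynomials in recursive dense form: a polynomial in n + 1 variables is the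
-- list of its coefficients, which are polynomials in the other n variables.
Poly : ℕ → Set
Poly zero    = ℤ
Poly (suc n) = List (Poly n)

conP : ∀ {n} → ℤ → Poly n
conP {zero}  z = z
conP {suc n} z = conP z ∷ []

varP : ∀ {n} → Fin n → Poly n
varP zero    = conP (+ 0) ∷ conP (+ 1) ∷ []
varP (suc i) = varP i ∷ []

addP : ∀ {n} → Poly n → Poly n → Poly n
addP {zero}  p       q       = p ℤ.+ q
addP {suc n} []      q       = q
addP {suc n} (a ∷ p) []      = a ∷ p
addP {suc n} (a ∷ p) (b ∷ q) = addP a b ∷ addP p q

negP : ∀ {n} → Poly n → Poly n
negP {zero}  p       = ℤ.- p
negP {suc n} []      = []
negP {suc n} (a ∷ p) = negP a ∷ negP p

mulP : ∀ {n} → Poly n → Poly n → Poly n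
scaleP : ∀ {n} → Poly n → Poly (suc n) → Poly (suc n)
mulP {zero}  p       q = p ℤ.* q
mulP {suc n} []      q = []
mulP {suc n} (a ∷ p) q = addP (scaleP a q) (conP (+ 0) ∷ mulP p q)
scaleP a []      = []
scaleP a (b ∷ q) = mulP a b ∷ scaleP a q

-- Dense forms are never trimmed, so the zero polynomial has many representatives and is recognised
-- coefficient by coefficient.
isZero : ∀ {n} → Poly n → Bool
isZero {zero}  p       = does (p ℤ.≟ + 0)
isZero {suc n} []      = true
isZero {suc n} (a ∷ p) = isZero a ∧ isZero p

norm : ∀ {n} → Expr n → Poly n
norm (con z)  = conP z
norm (var i)  = varP i
norm (e :+ d) = addP (norm e) (norm d)
norm (e :- d) = addP (norm e) (negP (norm d))
norm (e :* d) = mulP (norm e) (norm d)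

record Ring≡ : Set₁ where
  infixl 6 _+_ _-_
  infixl 7 _*_
  field
    Carrier : Set
    _+_ _-_ _*_ : Carrier → Carrier → Carrier
    neg : Carrier → Carrier
    0# 1# : Carrier
    isCommutativeRing : IsCommutativeRing _≡_ _+_ _*_ neg 0# 1#
    sub≡ : ∀ x y → x - y ≡ x + neg y

  commutativeRing : CommutativeRing _ _
  commutativeRing = record { isCommutativeRing = isCommutativeRing }

  open IsCommutativeRing isCommutativeRing public hiding (_-_; refl; sym; trans; reflexive; setoid)

module RingSolver (R : Ring≡) where
  open Ring≡ R renaming (Carrier to A)
  open Multiples +-isAbelianGroup renaming (interchange to +-interchange)
  open Algebra.Properties.Ring (CommutativeRing.ring commutativeRing) using (-0#≈0#; -‿distribˡ-*; -‿distribʳ-*)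
  open ≡-Reasoning

  ⟦_⟧ℤ : ℤ → A
  ⟦ + 1 ⟧ℤ = 1#
  ⟦ + 2 ⟧ℤ = 1# + 1#
  ⟦ z ⟧ℤ = z · 1#

  ⟦⟧ℤ≡ : ∀ z → ⟦ z ⟧ℤ ≡ z · 1#
  ⟦⟧ℤ≡ (+ 0) = refl
  ⟦⟧ℤ≡ (+ 1) = sym (+-identityʳ 1#)
  ⟦⟧ℤ≡ (+ 2) = cong (λ t → 1# + t) (sym (+-identityʳ 1#))
  ⟦⟧ℤ≡ (+ suc (suc (suc n))) = refl
  ⟦⟧ℤ≡ -[1+ n ] = refl

  ·1-homo-* : ∀ m n → (m ℤ.* n) · 1# ≡ (m · 1#) * (n · 1#)
  ·1-homo-* m n = trans (·-assoc m n 1#) (lemma m (n · 1#))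
    where
    lemmaℕ : ∀ k x → + k · x ≡ (+ k · 1#) * x
    lemmaℕ zero x = sym (zeroˡ x)
    lemmaℕ (suc k) x = sym (trans (distribʳ x 1# _) (cong₂ _+_ (*-identityˡ x) (sym (lemmaℕ k x))))
    lemma : ∀ k x → k · x ≡ (k · 1#) * x
    lemma (+ k) x = lemmaℕ k x
    lemma -[1+ k ] x = trans (cong neg (lemmaℕ (suc k) x)) (-‿distribˡ-* _ _)

  ⟦_⟧ : ∀ {n} → Expr n → Vec A n → A
  ⟦ con z ⟧ ρ  = ⟦ z ⟧ℤ
  ⟦ var i ⟧ ρ  = lookup ρ i
  ⟦ e :+ d ⟧ ρ = ⟦ e ⟧ ρ + ⟦ d ⟧ ρ
  ⟦ e :- d ⟧ ρ = ⟦ e ⟧ ρ - ⟦ d ⟧ ρ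
  ⟦ e :* d ⟧ ρ = ⟦ e ⟧ ρ * ⟦ d ⟧ ρ

  ⟦_⟧P : ∀ {n} → Poly n → Vec A n → A
  ⟦_⟧P {zero}  z       []      = z · 1#
  ⟦_⟧P {suc n} []      ρ       = 0#
  ⟦_⟧P {suc n} (a ∷ p) (x ∷ ρ) = ⟦ a ⟧P ρ + (x * ⟦ p ⟧P (x ∷ ρ))

  conP-correct : ∀ {n} z (ρ : Vec A n) → ⟦ conP z ⟧P ρ ≡ z · 1#
  conP-correct z []      = refl
  conP-correct z (x ∷ ρ) = trans (cong₂ _+_ (conP-correct z ρ) (zeroʳ x)) (+-identityʳ _)

  varP-correct : ∀ {n} i (ρ : Vec A n) → ⟦ varP i ⟧P ρ ≡ lookup ρ i
  varP-correct zero (x ∷ ρ) = begin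
    ⟦ conP (+ 0) ⟧P ρ + (x * (⟦ conP (+ 1) ⟧P ρ + (x * 0#)))
      ≡⟨ cong₂ _+_ (conP-correct (+ 0) ρ) (cong (x *_) (cong₂ _+_ (conP-correct (+ 1) ρ) (zeroʳ x))) ⟩
    0# + (x * ((1# + 0#) + 0#))  ≡⟨ +-identityˡ _ ⟩
    x * ((1# + 0#) + 0#)         ≡⟨ cong (x *_) (trans (+-identityʳ _) (+-identityʳ _)) ⟩
    x * 1#                       ≡⟨ *-identityʳ x ⟩
    x ∎
  varP-correct (suc i) (x ∷ ρ) = trans (cong₂ _+_ (varP-correct i ρ) (zeroʳ x)) (+-identityʳ _)

  addP-correct : ∀ {n} (p q : Poly n) ρ → ⟦ addP p q ⟧P ρ ≡ ⟦ p ⟧P ρ + ⟦ q ⟧P ρ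
  addP-correct {zero}  p       q       []      = ·-homo-+ p q 1#
  addP-correct {suc n} []      q       ρ       = sym (+-identityˡ _)
  addP-correct {suc n} (a ∷ p) []      ρ       = sym (+-identityʳ _)
  addP-correct {suc n} (a ∷ p) (b ∷ q) (x ∷ ρ) = begin
    ⟦ addP a b ⟧P ρ + (x * ⟦ addP p q ⟧P (x ∷ ρ))
      ≡⟨ cong₂ _+_ (addP-correct a b ρ) (cong (x *_) (addP-correct p q (x ∷ ρ))) ⟩
    (⟦ a ⟧P ρ + ⟦ b ⟧P ρ) + (x * (⟦ p ⟧P (x ∷ ρ) + ⟦ q ⟧P (x ∷ ρ)))
      ≡⟨ cong₂ _+_ refl (distribˡ x _ _) ⟩
    (⟦ a ⟧P ρ + ⟦ b ⟧P ρ) + ((x * ⟦ p ⟧P (x ∷ ρ)) + (x * ⟦ q ⟧P (x ∷ ρ)))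
      ≡⟨ +-interchange _ _ _ _ ⟩
    (⟦ a ⟧P ρ + (x * ⟦ p ⟧P (x ∷ ρ))) + (⟦ b ⟧P ρ + (x * ⟦ q ⟧P (x ∷ ρ))) ∎

  negP-correct : ∀ {n} (p : Poly n) ρ → ⟦ negP p ⟧P ρ ≡ neg (⟦ p ⟧P ρ)
  negP-correct {zero}  p       []      = ·-homo-neg p 1#
  negP-correct {suc n} []      ρ       = sym -0#≈0#
  negP-correct {suc n} (a ∷ p) (x ∷ ρ) = begin
    ⟦ negP a ⟧P ρ + (x * ⟦ negP p ⟧P (x ∷ ρ))
      ≡⟨ cong₂ _+_ (negP-correct a ρ) (trans (cong (x *_) (negP-correct p (x ∷ ρ))) (sym (-‿distribʳ-* x _))) ⟩
    neg (⟦ a ⟧P ρ) + neg (x * ⟦ p ⟧P (x ∷ ρ))  ≡⟨ sym (⁻¹-homo-∙ _ _) ⟩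
    neg (⟦ a ⟧P ρ + (x * ⟦ p ⟧P (x ∷ ρ))) ∎

  mulP-correct : ∀ {n} (p q : Poly n) ρ → ⟦ mulP p q ⟧P ρ ≡ ⟦ p ⟧P ρ * ⟦ q ⟧P ρ
  scaleP-correct : ∀ {n} (a : Poly n) (q : Poly (suc n)) x ρ → ⟦ scaleP a q ⟧P (x ∷ ρ) ≡ ⟦ a ⟧P ρ * ⟦ q ⟧P (x ∷ ρ)
  mulP-correct {zero}  p       q []      = ·1-homo-* p q
  mulP-correct {suc n} []      q ρ       = sym (zeroˡ _)
  mulP-correct {suc n} (a ∷ p) q (x ∷ ρ) = begin
    ⟦ addP (scaleP a q) (conP (+ 0) ∷ mulP p q) ⟧P (x ∷ ρ)
      ≡⟨ addP-correct (scaleP a q) (conP (+ 0) ∷ mulP p q) (x ∷ ρ) ⟩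
    ⟦ scaleP a q ⟧P (x ∷ ρ) + (⟦ conP (+ 0) ⟧P ρ + (x * ⟦ mulP p q ⟧P (x ∷ ρ)))
      ≡⟨ cong₂ _+_ (scaleP-correct a q x ρ) (trans (cong₂ _+_ (conP-correct (+ 0) ρ) (cong (x *_) (mulP-correct p q (x ∷ ρ)))) (+-identityˡ _)) ⟩
    (⟦ a ⟧P ρ * ⟦ q ⟧P (x ∷ ρ)) + (x * (⟦ p ⟧P (x ∷ ρ) * ⟦ q ⟧P (x ∷ ρ)))
      ≡⟨ cong₂ _+_ refl (sym (*-assoc x _ _)) ⟩
    (⟦ a ⟧P ρ * ⟦ q ⟧P (x ∷ ρ)) + ((x * ⟦ p ⟧P (x ∷ ρ)) * ⟦ q ⟧P (x ∷ ρ))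
      ≡⟨ sym (distribʳ _ _ _) ⟩
    (⟦ a ⟧P ρ + (x * ⟦ p ⟧P (x ∷ ρ))) * ⟦ q ⟧P (x ∷ ρ) ∎
  scaleP-correct a []      x ρ = sym (zeroʳ _)
  scaleP-correct a (b ∷ q) x ρ = begin
    ⟦ mulP a b ⟧P ρ + (x * ⟦ scaleP a q ⟧P (x ∷ ρ))
      ≡⟨ cong₂ _+_ (mulP-correct a b ρ) (cong (x *_) (scaleP-correct a q x ρ)) ⟩
    (⟦ a ⟧P ρ * ⟦ b ⟧P ρ) + (x * (⟦ a ⟧P ρ * ⟦ q ⟧P (x ∷ ρ)))
      ≡⟨ cong₂ _+_ refl (trans (sym (*-assoc x _ _)) (trans (cong₂ _*_ (*-comm x _) refl) (*-assoc _ x _))) ⟩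
    (⟦ a ⟧P ρ * ⟦ b ⟧P ρ) + (⟦ a ⟧P ρ * (x * ⟦ q ⟧P (x ∷ ρ)))
      ≡⟨ sym (distribˡ _ _ _) ⟩
    ⟦ a ⟧P ρ * (⟦ b ⟧P ρ + (x * ⟦ q ⟧P (x ∷ ρ))) ∎

  isZero-correct : ∀ {n} (p : Poly n) ρ → isZero p ≡ true → ⟦ p ⟧P ρ ≡ 0#
  isZero-correct {zero}  p       []      z with p ℤ.≟ + 0 | z
  ... | no _ | ()
  ... | yes refl | _ = refl
  isZero-correct {suc n} []      ρ       z = refl
  isZero-correct {suc n} (a ∷ p) (x ∷ ρ) z with isZero a in za | isZero p in zp | z
  ... | true | true | _ = trans (cong₂ _+_ (isZero-correct a ρ za) (trans (cong (x *_) (isZero-correct p (x ∷ ρ) zp)) (zeroʳ x))) (+-identityˡ 0#)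

  norm-correct : ∀ {n} (e : Expr n) ρ → ⟦ norm e ⟧P ρ ≡ ⟦ e ⟧ ρ
  norm-correct (con z)  ρ = trans (conP-correct z ρ) (sym (⟦⟧ℤ≡ z))
  norm-correct (var i)  ρ = varP-correct i ρ
  norm-correct (e :+ d) ρ = trans (addP-correct (norm e) (norm d) ρ) (cong₂ _+_ (norm-correct e ρ) (norm-correct d ρ))
  norm-correct (e :- d) ρ = begin
    ⟦ addP (norm e) (negP (norm d)) ⟧P ρ   ≡⟨ addP-correct (norm e) (negP (norm d)) ρ ⟩
    ⟦ norm e ⟧P ρ + ⟦ negP (norm d) ⟧P ρ   ≡⟨ cong₂ _+_ refl (negP-correct (norm d) ρ) ⟩
    ⟦ norm e ⟧P ρ + neg (⟦ norm d ⟧P ρ)      ≡⟨ cong₂ (λ x y → x + neg y) (norm-correct e ρ) (norm-correct d ρ) ⟩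
    ⟦ e ⟧ ρ + neg (⟦ d ⟧ ρ)                  ≡⟨ sym (sub≡ _ _) ⟩
    ⟦ e ⟧ ρ - ⟦ d ⟧ ρ ∎
  norm-correct (e :* d) ρ = trans (mulP-correct (norm e) (norm d) ρ) (cong₂ _*_ (norm-correct e ρ) (norm-correct d ρ))

  x-y≡0⇒x≡y : ∀ {x y} → x - y ≡ 0# → x ≡ y
  x-y≡0⇒x≡y {x} {y} e = begin
    x                ≡⟨ sym (+-identityʳ x) ⟩
    x + 0#           ≡⟨ cong (λ t → x + t) (sym (-‿inverseˡ y)) ⟩
    x + (neg y + y)  ≡⟨ sym (+-assoc x _ y) ⟩
    (x + neg y) + y  ≡⟨ cong (_+ y) (trans (sym (sub≡ x y)) e) ⟩
    0# + y           ≡⟨ +-identityˡ y ⟩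
    y ∎

  -- The equation is checked by computing that the difference of the two sides has
  -- the zero polynomial as its normal form.
  solve : ∀ n (f : N-ary n (Expr n) (Expr n × Expr n)) →
          let eqn = f $ⁿ Vec.map var (Vec.allFin n); e = proj₁ eqn; d = proj₂ eqn in
          isZero (norm (e :- d)) ≡ true → ∀ⁿ n (curryⁿ {n = n} λ ρ → ⟦ e ⟧ ρ ≡ ⟦ d ⟧ ρ)
  solve n f z = curryAll n λ ρ → x-y≡0⇒x≡y (trans (sym (norm-correct (e :- d) ρ)) (isZero-correct (norm (e :- d)) ρ z))
    where
    e = proj₁ (f $ⁿ Vec.map var (Vec.allFin n))
    d = proj₂ (f $ⁿ Vec.map var (Vec.allFin n))
    curryAll : ∀ n {P : Vec A n → Set} → (∀ ρ → P ρ) → ∀ⁿ n (curryⁿ {n = n} P)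
    curryAll zero    p = p []
    curryAll (suc n) p = λ x → curryAll n (λ ρ → p (x ∷ ρ))

infix 4 _:=_
_:=_ : ∀ {n} → Expr n → Expr n → Expr n × Expr n
_:=_ = _,_

-- Fields and the group law

record Field≡ : Set₁ where
  field
    ring : Ring≡
  open Ring≡ ring public
  field
    _≟_     : (x y : Carrier) → Dec (x ≡ y)
    inverse : ∀ x → ¬ x ≡ 0# → Σ Carrier λ y → y * x ≡ 1#
    2≢0     : ¬ 1# + 1# ≡ 0#

module FieldLemmas (𝔽 : Field≡) where
  open Field≡ 𝔽 renaming (Carrier to A)
  open RingSolver ring public using (solve; x-y≡0⇒x≡y)
  open ≡-Reasoning

  x≡y⇒x-y≡0 : ∀ {x y} → x ≡ y → x - y ≡ 0#
  x≡y⇒x-y≡0 {x} refl = trans (sub≡ x x) (-‿inverseʳ x)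

  cancel : ∀ {c x y} → ¬ c ≡ 0# → c * x ≡ c * y → x ≡ y
  cancel {c} {x} {y} c≢0 e with inverse c c≢0
  ... | d , dc≡1 = begin
    x           ≡⟨ sym (*-identityˡ x) ⟩
    1# * x      ≡⟨ cong (_* x) (sym dc≡1) ⟩
    d * c * x   ≡⟨ *-assoc d c x ⟩
    d * (c * x) ≡⟨ cong (d *_) e ⟩
    d * (c * y) ≡⟨ sym (*-assoc d c y) ⟩
    d * c * y   ≡⟨ cong (_* y) dc≡1 ⟩
    1# * y      ≡⟨ *-identityˡ y ⟩
    y ∎

  noZeroDivisors : ∀ {x y} → x * y ≡ 0# → x ≡ 0# ⊎ y ≡ 0#
  noZeroDivisors {x} {y} e with x ≟ 0#
  ... | yes x≡0 = inj₁ x≡0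
  ... | no x≢0  = inj₂ (cancel x≢0 (trans e (sym (zeroʳ x))))

  *≢0 : ∀ {x y} → ¬ x ≡ 0# → ¬ y ≡ 0# → ¬ x * y ≡ 0#
  *≢0 x≢0 y≢0 e with noZeroDivisors e
  ... | inj₁ x≡0 = x≢0 x≡0
  ... | inj₂ y≡0 = y≢0 y≡0

  -- An equation follows from others when the difference of its sides is a linear
  -- combination of the differences of theirs.
  combine₁ : ∀ {p q c l r} → l ≡ r → p - q ≡ c * (l - r) → p ≡ q
  combine₁ {c = c} h e = x-y≡0⇒x≡y (trans e (trans (cong (c *_) (x≡y⇒x-y≡0 h)) (zeroʳ c)))

  combine₂ : ∀ {p q c l r c' l' r'} → l ≡ r → l' ≡ r' → p - q ≡ c * (l - r) + c' * (l' - r') → p ≡ q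
  combine₂ {c' = c'} h h' e = combine₁ h (trans e (trans (cong₂ _+_ refl (trans (cong (c' *_) (x≡y⇒x-y≡0 h')) (zeroʳ c'))) (+-identityʳ _)))

  combine₃ : ∀ {p q c l r c' l' r' c'' l'' r''} → l ≡ r → l' ≡ r' → l'' ≡ r'' →
             p - q ≡ c * (l - r) + c' * (l' - r') + c'' * (l'' - r'') → p ≡ q
  combine₃ {c'' = c''} h h' h'' e = combine₂ h h' (trans e (trans (cong₂ _+_ refl (trans (cong (c'' *_) (x≡y⇒x-y≡0 h'')) (zeroʳ c''))) (+-identityʳ _)))

  combine₄ : ∀ {p q c l r c' l' r' c'' l'' r'' c‴ l‴ r‴} → l ≡ r → l' ≡ r' → l'' ≡ r'' → l‴ ≡ r‴ →
             p - q ≡ c * (l - r) + c' * (l' - r') + c'' * (l'' - r'') + c‴ * (l‴ - r‴) → p ≡ q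
  combine₄ {c‴ = c‴} h h' h'' h‴ e = combine₃ h h' h'' (trans e (trans (cong₂ _+_ refl (trans (cong (c‴ *_) (x≡y⇒x-y≡0 h‴)) (zeroʳ c‴))) (+-identityʳ _)))

  combine₅ : ∀ {p q c l r c' l' r' c'' l'' r'' c‴ l‴ r‴ c⁗ l⁗ r⁗} → l ≡ r → l' ≡ r' → l'' ≡ r'' → l‴ ≡ r‴ → l⁗ ≡ r⁗ →
             p - q ≡ c * (l - r) + c' * (l' - r') + c'' * (l'' - r'') + c‴ * (l‴ - r‴) + c⁗ * (l⁗ - r⁗) → p ≡ q
  combine₅ {c⁗ = c⁗} h h' h'' h‴ h⁗ e = combine₄ h h' h'' h‴ (trans e (trans (cong₂ _+_ refl (trans (cong (c⁗ *_) (x≡y⇒x-y≡0 h⁗)) (zeroʳ c⁗))) (+-identityʳ _)))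

-- The curve y² = x³ + a₂x² + a₄x + a₆; the polynomial on the right is F and G is its derivative.
module Cubic {A : Set} (_+_ _*_ : A → A → A) (2# 3# a₂ a₄ a₆ : A) where
  F G : A → A
  F x = ((((x * x) * x) + ((a₂ * x) * x)) + (a₄ * x)) + a₆
  G x = (((3# * x) * x) + ((2# * a₂) * x)) + a₄

private
  :0 :1 :2 :3 : ∀ {n} → Expr n
  :0 = con (+ 0)
  :1 = con (+ 1)
  :2 = :1 :+ :1
  :3 = :1 :+ :1 :+ :1

  :F :G : ∀ {n} → Expr n → Expr n → Expr n → Expr n → Expr n
  :F = Cubic.F _:+_ _:*_ :2 :3
  :G = Cubic.G _:+_ _:*_ :2 :3

module EllipticCurve (𝔽 : Field≡) (a₂ a₄ a₆ : Field≡.Carrier 𝔽) where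
  open Field≡ 𝔽 renaming (Carrier to A)
  open FieldLemmas 𝔽

  2# 3# : A
  2# = 1# + 1#
  3# = 1# + 1# + 1#

  open Cubic _+_ _*_ 2# 3# a₂ a₄ a₆ public

  -- The line y = l x + n meets the curve in the three points (xᵢ , yᵢ), counted with multiplicity.
  record Chord (x₁ y₁ x₂ y₂ x₃ y₃ : A) : Set where
    constructor chord
    field
      l n : A
      p₁ : y₁ ≡ l * x₁ + n
      p₂ : y₂ ≡ l * x₂ + n
      p₃ : y₃ ≡ l * x₃ + n
      e₁ : x₁ + x₂ + x₃ ≡ l * l - a₂
      e₂ : x₁ * x₂ + x₁ * x₃ + x₂ * x₃ ≡ a₄ - 2# * (l * n)

  On : A → A → Set
  On x y = y * y ≡ F x

  Chord-swap₁₂ : ∀ {x₁ y₁ x₂ y₂ x₃ y₃} → Chord x₁ y₁ x₂ y₂ x₃ y₃ → Chord x₂ y₂ x₁ y₁ x₃ y₃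
  Chord-swap₁₂ {x₁} {_} {x₂} {_} {x₃} (chord l n p₁ p₂ p₃ e₁ e₂) = chord l n p₂ p₁ p₃
    (trans (solve 3 (λ x y z → y :+ x :+ z := x :+ y :+ z) refl x₁ x₂ x₃) e₁)
    (trans (solve 3 (λ x y z → y :* x :+ y :* z :+ x :* z := x :* y :+ x :* z :+ y :* z) refl x₁ x₂ x₃) e₂)

  Chord-swap₂₃ : ∀ {x₁ y₁ x₂ y₂ x₃ y₃} → Chord x₁ y₁ x₂ y₂ x₃ y₃ → Chord x₁ y₁ x₃ y₃ x₂ y₂
  Chord-swap₂₃ {x₁} {_} {x₂} {_} {x₃} (chord l n p₁ p₂ p₃ e₁ e₂) = chord l n p₁ p₃ p₂
    (trans (solve 3 (λ x y z → x :+ z :+ y := x :+ y :+ z) refl x₁ x₂ x₃) e₁)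
    (trans (solve 3 (λ x y z → x :* z :+ x :* y :+ z :* y := x :* y :+ x :* z :+ y :* z) refl x₁ x₂ x₃) e₂)

  Chord-neg : ∀ {x₁ y₁ x₂ y₂ x₃ y₃} → Chord x₁ y₁ x₂ y₂ x₃ y₃ → Chord x₁ (0# - y₁) x₂ (0# - y₂) x₃ (0# - y₃)
  Chord-neg {x₁} {_} {x₂} {_} {x₃} (chord l n refl refl refl e₁ e₂) = chord (0# - l) (0# - n) (lemma x₁) (lemma x₂) (lemma x₃)
    (trans e₁ (solve 2 (λ l a → l :* l :- a := (:0 :- l) :* (:0 :- l) :- a) refl l a₂))
    (trans e₂ (solve 3 (λ l n a → a :- :2 :* (l :* n) := a :- :2 :* ((:0 :- l) :* (:0 :- n))) refl l n a₄))
    where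
    lemma : ∀ x → 0# - (l * x + n) ≡ (0# - l) * x + (0# - n)
    lemma = solve 3 (λ l n x → :0 :- (l :* x :+ n) := (:0 :- l) :* x :+ (:0 :- n)) refl l n

  -- By `e₁` and `e₂` the polynomials F(x) - (lx + n)² and (x - x₁)(x - x₂)(x - x₃) differ by a
  -- constant. So the first takes equal values at x₁ and x₃.
  Chord-On₃ : ∀ {x₁ y₁ x₂ y₂ x₃ y₃} → Chord x₁ y₁ x₂ y₂ x₃ y₃ → On x₁ y₁ → On x₃ y₃
  Chord-On₃ {x₁} {_} {x₂} {_} {x₃} (chord l n refl p₂ refl e₁ e₂) o = combine₃ o e₁ e₂
    (solve 8 (λ a₂ a₄ a₆ l n x₁ x₂ x₃ → 
       (l :* x₃ :+ n) :* (l :* x₃ :+ n) :- :F a₂ a₄ a₆ x₃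
       := :1 :* ((l :* x₁ :+ n) :* (l :* x₁ :+ n) :- :F a₂ a₄ a₆ x₁)
       :+ (x₁ :* x₁ :- x₃ :* x₃) :* (x₁ :+ x₂ :+ x₃ :- (l :* l :- a₂))
       :+ (x₃ :- x₁) :* (x₁ :* x₂ :+ x₁ :* x₃ :+ x₂ :* x₃ :- (a₄ :- :2 :* (l :* n)))) refl a₂ a₄ a₆ l n x₁ x₂ x₃)

  -- Differentiate F(x) - (lx + n)² = (x - x₁)(x - x₂)(x - x₃) + constant at x₁.
  Chord-derivative : ∀ {x₁ y₁ x₂ y₂ x₃ y₃} (C : Chord x₁ y₁ x₂ y₂ x₃ y₃) →
                     G x₁ - Chord.l C * (2# * y₁) ≡ (x₁ - x₂) * (x₁ - x₃)
  Chord-derivative {x₁} {_} {x₂} {_} {x₃} (chord l n refl p₂ p₃ e₁ e₂) = combine₂ e₁ e₂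
    (solve 8 (λ a₂ a₄ a₆ l n x₁ x₂ x₃ → 
       :G a₂ a₄ a₆ x₁ :- l :* (:2 :* (l :* x₁ :+ n)) :- (x₁ :- x₂) :* (x₁ :- x₃)
       := :2 :* x₁ :* (x₁ :+ x₂ :+ x₃ :- (l :* l :- a₂))
       :+ (:0 :- :1) :* (x₁ :* x₂ :+ x₁ :* x₃ :+ x₂ :* x₃ :- (a₄ :- :2 :* (l :* n)))) refl a₂ a₄ a₆ l n x₁ x₂ x₃)

  Chord-tangent : ∀ {x y x₃ y₃} (C : Chord x y x y x₃ y₃) → Chord.l C * (2# * y) ≡ G x
  Chord-tangent {x} {y} {x₃} C = combine₁ (Chord-derivative C)
    (solve 4 (λ g ly x x₃ → ly :- g := (:0 :- :1) :* (g :- ly :- (x :- x) :* (x :- x₃))) refl (G x) (Chord.l C * (2# * y)) x x₃)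

  -- Subtracting the two curve equations gives `e₂` multiplied by x₂ - x₁, which can be cancelled.
  secant : ∀ {x₁ y₁ x₂ y₂} l → ¬ x₁ ≡ x₂ → On x₁ y₁ → On x₂ y₂ → l * (x₂ - x₁) ≡ y₂ - y₁ →
           let x₃ = l * l - a₂ - x₁ - x₂; n = y₁ - l * x₁ in Chord x₁ y₁ x₂ y₂ x₃ (l * x₃ + n)
  secant {x₁} {y₁} {x₂} {y₂} l x₁≢x₂ o₁ o₂ s = chord l (y₁ - l * x₁)
    (solve 3 (λ x y l → y := l :* x :+ (y :- l :* x)) refl x₁ y₁ l)
    (combine₁ s (solve 5 (λ x₁ y₁ x₂ y₂ l → y₂ :- (l :* x₂ :+ (y₁ :- l :* x₁)) := (:0 :- :1) :* (l :* (x₂ :- x₁) :- (y₂ :- y₁))) refl x₁ y₁ x₂ y₂ l))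
    refl
    (solve 4 (λ x₁ x₂ l a → x₁ :+ x₂ :+ (l :* l :- a :- x₁ :- x₂) := l :* l :- a) refl x₁ x₂ l a₂)
    (cancel (λ e → x₁≢x₂ (sym (x-y≡0⇒x≡y e)))
      (combine₃ o₁ o₂ s (solve 8 (λ a₂ a₄ a₆ l x₁ y₁ x₂ y₂ → let x₃ = l :* l :- a₂ :- x₁ :- x₂; n = y₁ :- l :* x₁ in
         (x₂ :- x₁) :* (x₁ :* x₂ :+ x₁ :* x₃ :+ x₂ :* x₃) :- (x₂ :- x₁) :* (a₄ :- :2 :* (l :* n))
         := (:0 :- :1) :* (y₁ :* y₁ :- :F a₂ a₄ a₆ x₁) :+ :1 :* (y₂ :* y₂ :- :F a₂ a₄ a₆ x₂)
         :+ (l :* x₂ :+ n :+ y₂) :* (l :* (x₂ :- x₁) :- (y₂ :- y₁))) refl a₂ a₄ a₆ l x₁ y₁ x₂ y₂)))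

  tangentLine : ∀ {x y} l → l * (2# * y) ≡ G x →
                let x₃ = l * l - a₂ - x - x; n = y - l * x in Chord x y x y x₃ (l * x₃ + n)
  tangentLine {x} {y} l s = chord l (y - l * x) p p refl
    (solve 3 (λ x l a → x :+ x :+ (l :* l :- a :- x :- x) := l :* l :- a) refl x l a₂)
    (combine₁ s (solve 6 (λ a₂ a₄ a₆ l x y → let x₃ = l :* l :- a₂ :- x :- x in
       x :* x :+ x :* x₃ :+ x :* x₃ :- (a₄ :- :2 :* (l :* (y :- l :* x))) := :1 :* (l :* (:2 :* y) :- :G a₂ a₄ a₆ x)) refl a₂ a₄ a₆ l x y))
    where
    p : y ≡ l * x + (y - l * x)
    p = solve 3 (λ x y l → y := l :* x :+ (y :- l :* x)) refl x y l

  Opposite : A → A → A → A → Set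
  Opposite x₁ y₁ x₂ y₂ = x₁ ≡ x₂ × y₂ ≡ 0# - y₁

  opposite? : ∀ x₁ y₁ x₂ y₂ → Dec (Opposite x₁ y₁ x₂ y₂)
  opposite? x₁ y₁ x₂ y₂ with x₁ ≟ x₂ | y₂ ≟ (0# - y₁)
  ... | yes p | yes q = yes (p , q)
  ... | no ¬p | _     = no λ o → ¬p (proj₁ o)
  ... | _     | no ¬q = no λ o → ¬q (proj₂ o)

  same-x : ∀ {x y y'} → On x y → On x y' → y' ≡ y ⊎ y' ≡ 0# - y
  same-x {x} {y} {y'} o o' with noZeroDivisors {y' - y} {y' - (0# - y)}
    (trans (solve 2 (λ y y' → (y' :- y) :* (y' :- (:0 :- y)) := y' :* y' :- y :* y) refl y y') (x≡y⇒x-y≡0 (trans o' (sym o))))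
  ... | inj₁ e = inj₁ (x-y≡0⇒x≡y e)
  ... | inj₂ e = inj₂ (x-y≡0⇒x≡y e)

  2y≢0 : ∀ {x y} → ¬ Opposite x y x y → ¬ 2# * y ≡ 0#
  2y≢0 {x} {y} ¬o e = ¬o (refl , combine₁ e (solve 1 (λ y → y :- (:0 :- y) := :1 :* (:2 :* y :- :0)) refl y))

  slope-unique : ∀ {x₁ y₁ x₂ y₂ x₃ y₃ x₃' y₃'} (C : Chord x₁ y₁ x₂ y₂ x₃ y₃) (C' : Chord x₁ y₁ x₂ y₂ x₃' y₃') →
                 ¬ Opposite x₁ y₁ x₂ y₂ → Chord.l C ≡ Chord.l C'
  slope-unique {x₁} {y₁} {x₂} {y₂} C C' ¬o with x₁ ≟ x₂
  ... | no x₁≢x₂ = cancel (λ e → x₁≢x₂ (sym (x-y≡0⇒x≡y e))) (trans (rise C) (sym (rise C')))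
    where
    rise : ∀ {x y} (C : Chord x₁ y₁ x₂ y₂ x y) → (x₂ - x₁) * Chord.l C ≡ y₂ - y₁
    rise (chord l n refl refl _ _ _) = solve 4 (λ x₁ x₂ l n → (x₂ :- x₁) :* l := l :* x₂ :+ n :- (l :* x₁ :+ n)) refl x₁ x₂ l n
  -- Two points of one line with equal abscissae coincide. The line is then a tangent, and 2y is
  -- invertible since the point is not its own opposite.
  ... | yes refl with trans (Chord.p₁ C) (sym (Chord.p₂ C))
  ...   | refl = cancel (2y≢0 ¬o) (trans (*-comm _ _) (trans (Chord-tangent C) (trans (sym (Chord-tangent C')) (*-comm _ _))))

  Chord-unique : ∀ {x₁ y₁ x₂ y₂ x₃ y₃ x₃' y₃'} → Chord x₁ y₁ x₂ y₂ x₃ y₃ → Chord x₁ y₁ x₂ y₂ x₃' y₃' →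
                 ¬ Opposite x₁ y₁ x₂ y₂ → x₃ ≡ x₃' × y₃ ≡ y₃'
  Chord-unique {x₁} {y₁} {x₂} {y₂} {x₃} {_} {x₃'} C@(chord l n p₁ p₂ refl e₁ e₂) C'@(chord l' n' p₁' p₂' refl e₁' e₂') ¬o
    with slope-unique C C' ¬o
  ... | refl = x₃≡ , cong₂ _+_ (cong (l *_) x₃≡) n≡
    where
    x₃≡ : x₃ ≡ x₃'
    x₃≡ = combine₂ e₁ e₁' (solve 6 (λ x₁ x₂ x₃ x₃' l a → x₃ :- x₃' := :1 :* (x₁ :+ x₂ :+ x₃ :- (l :* l :- a)) :+ (:0 :- :1) :* (x₁ :+ x₂ :+ x₃' :- (l :* l :- a))) refl x₁ x₂ x₃ x₃' l a₂)
    n≡ : n ≡ n'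
    n≡ = combine₂ p₁ p₁' (solve 5 (λ x₁ y₁ l n n' → n :- n' := (:0 :- :1) :* (y₁ :- (l :* x₁ :+ n)) :+ :1 :* (y₁ :- (l :* x₁ :+ n'))) refl x₁ y₁ l n n')

  -- If σ is the sum of the slopes of the lines through A, B, −S and S, C, −U, then
  -- x² + αx + γ − σy is the product of the two lines divided by x − x(S); it vanishes at A, B, C, −U.
  module TwoChords {xA yA xB yB xC yC xS yS xU yU}
    (C₁ : Chord xA yA xB yB xS yS) (C₂ : Chord xS (0# - yS) xC yC xU yU) where
    open Chord C₁
    open Chord C₂ renaming (l to m; n to k; p₁ to q₁; p₂ to q₂; p₃ to q₃; e₁ to f₁; e₂ to f₂)

    σ α γ : A
    σ = l + m
    α = σ * l - (xA + xB)
    γ = xA * xB + σ * n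

    -- Adding the line equations at S and -S eliminates yS. This is what makes the product of the
    -- lines divisible by x - xS.
    σxS : σ * xS + (k + n) ≡ 0#
    σxS = combine₂ p₃ q₁ (solve 6 (λ xS yS l n m k →
      (l :+ m) :* xS :+ (k :+ n) :- :0 := (:0 :- :1) :* (yS :- (l :* xS :+ n)) :+ (:0 :- :1) :* (:0 :- yS :- (m :* xS :+ k))) refl xS yS l n m k)

    -- The coefficients are defined from the first chord, through A and B; reading them from the
    -- second chord gives the vanishing at C and -U.
    α-alt : α ≡ σ * m - (xC + xU)
    α-alt = combine₂ e₁ f₁ (solve 8 (λ a₂ l m xA xB xC xS xU →
      (l :+ m) :* l :- (xA :+ xB) :- ((l :+ m) :* m :- (xC :+ xU))
      := (:0 :- :1) :* (xA :+ xB :+ xS :- (l :* l :- a₂)) :+ :1 :* (xS :+ xC :+ xU :- (m :* m :- a₂))) refl a₂ l m xA xB xC xS xU)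

    γ-alt : γ ≡ xC * xU + σ * k
    γ-alt = combine₅ e₁ f₁ e₂ f₂ σxS (solve 11 (λ a₂ a₄ l m n k xA xB xC xS xU →
      xA :* xB :+ (l :+ m) :* n :- (xC :* xU :+ (l :+ m) :* k)
      := (:0 :- xS) :* (xA :+ xB :+ xS :- (l :* l :- a₂)) :+ xS :* (xS :+ xC :+ xU :- (m :* m :- a₂))
      :+ :1 :* (xA :* xB :+ xA :* xS :+ xB :* xS :- (a₄ :- :2 :* (l :* n)))
      :+ (:0 :- :1) :* (xS :* xC :+ xS :* xU :+ xC :* xU :- (a₄ :- :2 :* (m :* k)))
      :+ (m :- l) :* ((l :+ m) :* xS :+ (k :+ n) :- :0)) refl a₂ a₄ l m n k xA xB xC xS xU)

    private
      vanishing : ∀ {x y x' l n} → y ≡ l * x + n → α ≡ σ * l - (x + x') → γ ≡ x * x' + σ * n → x * x + α * x + γ ≡ σ * y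
      vanishing {x} {y} {x'} {l} {n} p a c = combine₃ p a c (solve 8 (λ x y x' l n σ α γ →
        x :* x :+ α :* x :+ γ :- σ :* y
        := (:0 :- σ) :* (y :- (l :* x :+ n)) :+ x :* (α :- (σ :* l :- (x :+ x'))) :+ :1 :* (γ :- (x :* x' :+ σ :* n))) refl x y x' l n σ α γ)

    vanish-A : xA * xA + α * xA + γ ≡ σ * yA
    vanish-A = vanishing p₁ refl refl

    vanish-B : xB * xB + α * xB + γ ≡ σ * yB
    vanish-B = vanishing p₂ (cong (σ * l -_) (+-comm xA xB)) (cong (_+ σ * n) (*-comm xA xB))

    vanish-C : xC * xC + α * xC + γ ≡ σ * yC
    vanish-C = vanishing q₂ α-alt γ-alt

    vanish-U : xU * xU + α * xU + γ ≡ σ * yU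
    vanish-U = vanishing q₃ (trans α-alt (cong (σ * m -_) (+-comm xC xU))) (trans γ-alt (cong (_+ σ * k) (*-comm xC xU)))

    -- The sum of the two expressions for α. It recovers xU from σ and α.
    trace : 2# * α ≡ σ * σ - (xA + xB + xC + xU)
    trace = combine₁ α-alt (solve 6 (λ l m xA xB xC xU →
      :2 :* ((l :+ m) :* l :- (xA :+ xB)) :- ((l :+ m) :* (l :+ m) :- (xA :+ xB :+ xC :+ xU))
      := :1 :* ((l :+ m) :* l :- (xA :+ xB) :- ((l :+ m) :* m :- (xC :+ xU)))) refl l m xA xB xC xU)

  -- `C₁`, `C₂` build (A + B) + C, and `C₃`, `C₄` build (B + C) + A. In `Q` the letters rotate:
  -- `Q.vanish-C`, `Q.vanish-A`, `Q.vanish-B` are the conditions at A, B, C.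
  module Associativity {xA yA xB yB xC yC xS yS xU yU xT yT xV yV}
    (C₁ : Chord xA yA xB yB xS yS) (C₂ : Chord xS (0# - yS) xC yC xU yU)
    (C₃ : Chord xB yB xC yC xT yT) (C₄ : Chord xT (0# - yT) xA yA xV yV)
    (xA≢xC : ¬ xA ≡ xC) (xB≢xC : ¬ xB ≡ xC) (¬AB : ¬ Opposite xA yA xB yB) where
    private
      module P = TwoChords C₁ C₂
      module Q = TwoChords C₃ C₄
    open Chord C₁
    open P using (σ; α; γ)
    open Q using () renaming (σ to σ'; α to α'; γ to γ')

    -- Restricted to the line y = lx + n, the second function is a monic quadratic in x vanishing at
    -- xA and xB; α' is read off from the sum of its roots.
    α'≡ : α' ≡ σ' * l - (xA + xB)
    α'≡ with xA ≟ xB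
    ... | no xA≢xB = cancel (λ e → xA≢xB (sym (x-y≡0⇒x≡y e))) (combine₄ Q.vanish-C Q.vanish-A p₁ p₂
          (solve 9 (λ xA yA xB yB l n σ' α' γ' →
            (xB :- xA) :* α' :- (xB :- xA) :* (σ' :* l :- (xA :+ xB))
            := (:0 :- :1) :* (xA :* xA :+ α' :* xA :+ γ' :- σ' :* yA) :+ :1 :* (xB :* xB :+ α' :* xB :+ γ' :- σ' :* yB)
            :+ (:0 :- σ') :* (yA :- (l :* xA :+ n)) :+ σ' :* (yB :- (l :* xB :+ n))) refl xA yA xB yB l n σ' α' γ'))
    ... | yes refl with trans p₁ (sym p₂)
    -- For A = B the zero has to be counted twice. The multiplicity comes from comparing the tangent
    -- slope of `C₁` with the slope of `C₃` at the same point by `Chord-derivative`.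
    ...   | refl = cancel (2y≢0 ¬AB) (combine₅ (Chord-tangent C₁) (Chord-derivative C₃) Q.σxS (Chord.p₁ C₃) (Chord.p₂ C₄)
          (solve 11 (λ xA yA xC xT l l' n' m' k' g σ' → let σ' = l' :+ m' in
            :2 :* yA :* (σ' :* l' :- (xA :+ xC)) :- :2 :* yA :* (σ' :* l :- (xA :+ xA))
            := (:0 :- σ') :* (l :* (:2 :* yA) :- g)
            :+ (:0 :- σ') :* (g :- l' :* (:2 :* yA) :- (xA :- xC) :* (xA :- xT))
            :+ (xC :- xA) :* (:0 :- :1) :* (σ' :* xT :+ (k' :+ n') :- :0)
            :+ (xA :- xC) :* (yA :- (l' :* xA :+ n'))
            :+ (xA :- xC) :* (yA :- (m' :* xA :+ k'))) refl xA yA xC xT l (Chord.l C₃) (Chord.n C₃) (Chord.l C₄) (Chord.n C₄) (G xA) σ'))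

    γ'≡ : γ' ≡ xA * xB + σ' * n
    γ'≡ = combine₃ Q.vanish-C α'≡ p₁ (solve 8 (λ xA yA xB l n σ' α' γ' →
      γ' :- (xA :* xB :+ σ' :* n)
      := :1 :* (xA :* xA :+ α' :* xA :+ γ' :- σ' :* yA) :+ (:0 :- xA) :* (α' :- (σ' :* l :- (xA :+ xB)))
      :+ σ' :* (yA :- (l :* xA :+ n))) refl xA yA xB l n σ' α' γ')

    private
      D : A
      D = yC - (l * xC + n)

      d≢0 : ¬ (xC - xA) * (xC - xB) ≡ 0#
      d≢0 = *≢0 (λ e → xA≢xC (sym (x-y≡0⇒x≡y e))) (λ e → xB≢xC (sym (x-y≡0⇒x≡y e)))

      -- Evaluation at C. The right side is nonzero because xC differs from xA and xB, so C lies off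
      -- the line AB, σ is nonzero, and σ is determined by `D`.
      at-C : ∀ {σ α γ} → α ≡ σ * l - (xA + xB) → γ ≡ xA * xB + σ * n → xC * xC + α * xC + γ ≡ σ * yC →
             D * σ ≡ (xC - xA) * (xC - xB)
      at-C {σ} {α} {γ} a c v = combine₃ a c v (solve 9 (λ xA xB xC yC l n σ α γ →
        (yC :- (l :* xC :+ n)) :* σ :- (xC :- xA) :* (xC :- xB)
        := xC :* (α :- (σ :* l :- (xA :+ xB))) :+ :1 :* (γ :- (xA :* xB :+ σ :* n))
        :+ (:0 :- :1) :* (xC :* xC :+ α :* xC :+ γ :- σ :* yC)) refl xA xB xC yC l n σ α γ)

      Dσ : D * σ ≡ (xC - xA) * (xC - xB)
      Dσ = at-C refl refl P.vanish-C

    σ≡ : σ ≡ σ'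
    σ≡ = cancel (λ D≡0 → d≢0 (trans (sym Dσ) (trans (cong (_* σ) D≡0) (zeroˡ σ)))) (trans Dσ (sym (at-C α'≡ γ'≡ Q.vanish-B)))

    α≡ : α ≡ α'
    α≡ = trans (cong (λ s → s * l - (xA + xB)) σ≡) (sym α'≡)

    γ≡ : γ ≡ γ'
    γ≡ = trans (cong (λ s → xA * xB + s * n) σ≡) (sym γ'≡)

    xU≡xV : xU ≡ xV
    xU≡xV = combine₄ P.trace Q.trace σ≡ α≡ (solve 9 (λ xA xB xC xU xV σ σ' α α' →
      xU :- xV
      := :1 :* (:2 :* α :- (σ :* σ :- (xA :+ xB :+ xC :+ xU))) :+ (:0 :- :1) :* (:2 :* α' :- (σ' :* σ' :- (xB :+ xC :+ xA :+ xV)))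
      :+ (σ :+ σ') :* (σ :- σ') :+ (:0 :- :2) :* (α :- α')) refl xA xB xC xU xV σ σ' α α')

    yU≡yV : yU ≡ yV
    yU≡yV = cancel (λ σ≡0 → d≢0 (trans (sym Dσ) (trans (cong (D *_) σ≡0) (zeroʳ D)))) (begin
      σ * yU                ≡⟨ sym P.vanish-U ⟩
      xU * xU + α * xU + γ  ≡⟨ cong₂ _+_ (cong₂ (λ x a → x * x + a * x) xU≡xV α≡) γ≡ ⟩
      xV * xV + α' * xV + γ' ≡⟨ Q.vanish-U ⟩
      σ' * yV               ≡⟨ cong (_* yV) (sym σ≡) ⟩
      σ * yV ∎)
      where open ≡-Reasoning

  data Point : Set where
    O      : Point
    affine : ∀ x y → On x y → Point

  affine-≡ : ∀ {x x' y y' o o'} → x ≡ x' → y ≡ y' → affine x y o ≡ affine x' y' o'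
  affine-≡ {o = o} {o'} refl refl = cong (affine _ _) (uip o o')
    where
    uip : ∀ {a b : A} (p q : a ≡ b) → p ≡ q
    uip refl refl = refl

  On-neg : ∀ {x y} → On x y → On x (0# - y)
  On-neg {x} {y} o = trans (solve 1 (λ y → (:0 :- y) :* (:0 :- y) := y :* y) refl y) o

  -- A relation rather than a function, so that associativity can be proved by matching on how each
  -- sum arises; `add-total` and `Add-functional` make it the graph of an operation.
  data Add : Point → Point → Point → Set where
    addOˡ : ∀ {P} → Add O P P
    addOʳ : ∀ {P} → Add P O P
    addOpposite : ∀ {x y o y' o'} → y' ≡ 0# - y → Add (affine x y o) (affine x y' o') O
    addChord : ∀ {x₁ y₁ o₁ x₂ y₂ o₂ x₃ y₃ o₃} → ¬ Opposite x₁ y₁ x₂ y₂ → Chord x₁ y₁ x₂ y₂ x₃ y₃ →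
               Add (affine x₁ y₁ o₁) (affine x₂ y₂ o₂) (affine x₃ (0# - y₃) o₃)

  negate : Point → Point
  negate O              = O
  negate (affine x y o) = affine x (0# - y) (On-neg o)

  abstract
    -- Opaque, so sums are not evaluated by normalisation. Their values come from explicit chords
    -- through `Add⇒≡`.
    add-total : ∀ P Q → Σ Point (Add P Q)
    add-total O Q = Q , addOˡ
    add-total P@(affine _ _ _) O = P , addOʳ
    add-total (affine x₁ y₁ o₁) (affine x₂ y₂ o₂) with opposite? x₁ y₁ x₂ y₂
    ... | yes (refl , e) = O , addOpposite e
    ... | no ¬o with x₁ ≟ x₂
    ...   | no x₁≢x₂ = let i , i≡ = inverse (x₂ - x₁) (λ e → x₁≢x₂ (sym (x-y≡0⇒x≡y e)))
                           C = secant ((y₂ - y₁) * i) x₁≢x₂ o₁ o₂ (trans (*-assoc _ i _) (trans (cong ((y₂ - y₁) *_) i≡) (*-identityʳ _)))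
                       in _ , addChord {o₃ = On-neg (Chord-On₃ C o₁)} ¬o C
    ...   | yes refl with same-x o₁ o₂
    ...     | inj₂ e    = contradiction (refl , e) ¬o
    ...     | inj₁ refl = let i , i≡ = inverse (2# * y₁) (2y≢0 ¬o)
                              C = tangentLine (G x₁ * i) (trans (*-assoc _ i _) (trans (cong (G x₁ *_) i≡) (*-identityʳ _)))
                          in _ , addChord {o₃ = On-neg (Chord-On₃ C o₁)} ¬o C

  infixl 6 _⊹_
  _⊹_ : Point → Point → Point
  P ⊹ Q = proj₁ (add-total P Q)

  ⊹-graph : ∀ P Q → Add P Q (P ⊹ Q)
  ⊹-graph P Q = proj₂ (add-total P Q)

  Add-functional : ∀ {P Q R R'} → Add P Q R → Add P Q R' → R ≡ R'
  Add-functional addOˡ addOˡ = refl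
  Add-functional addOˡ addOʳ = refl
  Add-functional addOʳ addOˡ = refl
  Add-functional addOʳ addOʳ = refl
  Add-functional (addOpposite e) (addOpposite e') = refl
  Add-functional (addOpposite e) (addChord ¬o _) = contradiction (refl , e) ¬o
  Add-functional (addChord ¬o _) (addOpposite e) = contradiction (refl , e) ¬o
  Add-functional (addChord ¬o C) (addChord _ C') with Chord-unique C C' ¬o
  ... | x≡ , y≡ = affine-≡ x≡ (cong (0# -_) y≡)

  Add⇒≡ : ∀ {P Q R} → Add P Q R → P ⊹ Q ≡ R
  Add⇒≡ {P} {Q} a = Add-functional (⊹-graph P Q) a

  0-0-y : ∀ y → 0# - (0# - y) ≡ y
  0-0-y = solve 1 (λ y → :0 :- (:0 :- y) := y) refl

  flip-opposite : ∀ {y y'} → y' ≡ 0# - y → y ≡ 0# - y'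
  flip-opposite {y} refl = sym (0-0-y y)

  Add-comm : ∀ {P Q R} → Add P Q R → Add Q P R
  Add-comm addOˡ = addOʳ
  Add-comm addOʳ = addOˡ
  Add-comm (addOpposite e) = addOpposite (flip-opposite e)
  Add-comm (addChord ¬o C) = addChord (λ { (e , e') → ¬o (sym e , flip-opposite e') }) (Chord-swap₁₂ C)

  ⊹-comm : ∀ P Q → P ⊹ Q ≡ Q ⊹ P
  ⊹-comm P Q = Add⇒≡ (Add-comm (⊹-graph Q P))

  Add-inverse : ∀ P → Add P (negate P) O
  Add-inverse O              = addOˡ
  Add-inverse (affine x y o) = addOpposite refl

  negate-involutive : ∀ P → negate (negate P) ≡ P
  negate-involutive O              = refl
  negate-involutive (affine x y o) = affine-≡ refl (0-0-y y)

  module Group (nonsingular : ∀ x → F x ≡ 0# → ¬ G x ≡ 0#) where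

    -- The mirror image of the line through P, Q, -R passes through -P, R, -Q.
    Add-cancel : ∀ {P Q R} → Add P Q R → Add (negate P) R Q
    Add-cancel addOˡ = addOˡ
    Add-cancel {P} addOʳ = Add-comm (Add-inverse P)
    Add-cancel (addOpposite {x} {y} {o} {y'} {o'} e) = subst (Add _ O) (affine-≡ refl (sym e)) addOʳ
    Add-cancel (addChord {x₁} {y₁} {o₁} {x₂} {y₂} {o₂} {x₃} {y₃} {o₃} ¬o C) =
      subst (Add _ _) (affine-≡ {o = trans (cong₂ _*_ (0-0-y y₂) (0-0-y y₂)) o₂} refl (0-0-y y₂)) (addChord ¬o' (Chord-swap₂₃ (Chord-neg C)))
      where
      ¬o' : ¬ Opposite x₁ (0# - y₁) x₃ (0# - y₃)
      -- If R = P here, the line meets the curve doubly at P and y₁ = 0. The tangent relation then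
      -- gives G x₁ = 0 along with F x₁ = 0, a singular point.
      ¬o' (refl , e) = nonsingular x₁ (trans (sym o₁) (trans (cong (λ y → y * y) y₁≡0) (zeroˡ 0#))) (trans (sym (Chord-tangent C')) (trans (cong (λ y → Chord.l C' * (2# * y)) y₁≡0) (trans (cong (Chord.l C' *_) (zeroʳ 2#)) (zeroʳ _))))
        where
        y₃≡y₁ : y₃ ≡ y₁
        y₃≡y₁ = trans (Chord.p₃ C) (sym (Chord.p₁ C))
        C' : Chord x₁ y₁ x₁ y₁ x₂ y₂
        C' = subst (λ y → Chord x₁ y₁ x₁ y x₂ y₂) y₃≡y₁ (Chord-swap₂₃ C)
        y₁≡0 : y₁ ≡ 0#
        y₁≡0 = cancel 2≢0 (combine₂ e y₃≡y₁ (solve 2 (λ y₁ y₃ → :2 :* y₁ :- :2 :* :0 := (:0 :- :1) :* (:0 :- y₃ :- (:0 :- (:0 :- y₁))) :+ (:0 :- :1) :* (y₃ :- y₁)) refl y₁ y₃))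

    cancelˡ : ∀ P Q → negate P ⊹ (P ⊹ Q) ≡ Q
    cancelˡ P Q = Add⇒≡ (Add-cancel (⊹-graph P Q))

    cancelˡ′ : ∀ P Q → P ⊹ (negate P ⊹ Q) ≡ Q
    cancelˡ′ P Q = trans (cong (_⊹ (negate P ⊹ Q)) (sym (negate-involutive P))) (cancelˡ (negate P) Q)

    ⊹-identityˡ : ∀ P → O ⊹ P ≡ P
    ⊹-identityˡ P = Add⇒≡ addOˡ

    ⊹-identityʳ : ∀ P → P ⊹ O ≡ P
    ⊹-identityʳ P = Add⇒≡ addOʳ

    Assoc : Point → Point → Point → Set
    Assoc P Q R = (P ⊹ Q) ⊹ R ≡ P ⊹ (Q ⊹ R)

    Assoc-reverse : ∀ P Q R → Assoc P Q R → Assoc R Q P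
    Assoc-reverse P Q R e = begin
      (R ⊹ Q) ⊹ P ≡⟨ ⊹-comm _ P ⟩
      P ⊹ (R ⊹ Q) ≡⟨ cong (P ⊹_) (⊹-comm R Q) ⟩
      P ⊹ (Q ⊹ R) ≡⟨ sym e ⟩
      (P ⊹ Q) ⊹ R ≡⟨ ⊹-comm _ R ⟩
      R ⊹ (P ⊹ Q) ≡⟨ cong (R ⊹_) (⊹-comm P Q) ⟩
      R ⊹ (Q ⊹ P) ∎
      where open ≡-Reasoning

    Assoc-same : ∀ P Q → Assoc P Q P
    Assoc-same P Q = trans (⊹-comm _ P) (cong (P ⊹_) (⊹-comm P Q))

    Assoc-opposite₁₂ : ∀ P Q R → P ⊹ Q ≡ O → Q ≡ negate P → Assoc P Q R
    Assoc-opposite₁₂ P Q R e refl = trans (cong (_⊹ R) e) (trans (⊹-identityˡ R) (sym (cancelˡ′ P R)))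

    Assoc-opposite₁₃ : ∀ P Q → Assoc P Q (negate P)
    Assoc-opposite₁₃ P Q = begin
      (P ⊹ Q) ⊹ negate P  ≡⟨ ⊹-comm _ _ ⟩
      negate P ⊹ (P ⊹ Q)  ≡⟨ cancelˡ P Q ⟩
      Q                   ≡⟨ sym (cancelˡ′ P Q) ⟩
      P ⊹ (negate P ⊹ Q)  ≡⟨ cong (P ⊹_) (⊹-comm _ Q) ⟩
      P ⊹ (Q ⊹ negate P)  ∎
      where open ≡-Reasoning

    -- When all four sums are chords this is `Associativity`; the other clauses treat the sums that
    -- meet O.
    generic : ∀ {xA yA oA xB yB oB xC yC oC S T U V} → ¬ xA ≡ xC → ¬ xB ≡ xC →
              let P = affine xA yA oA; Q = affine xB yB oB; R = affine xC yC oC in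
              Add P Q S → Add S R U → Add Q R T → Add T P V → U ≡ V
    generic {yA = yA} {oC = oC} {T = T} xA≢xC xB≢xC (addOpposite refl) addOˡ t@(addChord _ _) a =
      Add-functional (subst (λ P → Add P T (affine _ _ oC)) (affine-≡ refl (0-0-y yA)) (Add-cancel t)) (Add-comm a)
    generic xA≢xC xB≢xC _ _ (addOpposite _) _ = contradiction refl xB≢xC
    -- C is the third point of the line AB. By uniqueness the line BC has third point A, so Q + R =
    -- -P and both totals are O.
    generic {xA} {yA} {oA} xA≢xC xB≢xC (addChord ¬AB C₁) (addOpposite e) (addChord {o₃ = oT} ¬BC C₃) a
      with trans e (0-0-y _)
    ... | refl with Chord-unique C₃ (Chord-swap₂₃ (Chord-swap₁₂ C₁)) ¬BC
    ...   | refl , refl = Add-functional (addOpposite (sym (0-0-y _))) a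
    -- A is the third point of the line BC, whence S = -C, contrary to S + R being a chord.
    generic xA≢xC xB≢xC (addChord ¬AB C₁) (addChord ¬SC C₂) (addChord ¬BC C₃) (addOpposite e)
      with trans e (0-0-y _)
    ... | refl with Chord-unique C₁ (Chord-swap₁₂ (Chord-swap₂₃ C₃)) ¬AB
    ...   | refl , refl = contradiction (refl , sym (0-0-y _)) ¬SC
    generic xA≢xC xB≢xC (addChord ¬AB C₁) (addChord ¬SC C₂) (addChord ¬BC C₃) (addChord ¬TA C₄) = affine-≡ xU≡xV (cong (0# -_) yU≡yV)
      where open Associativity C₁ C₂ C₃ C₄ xA≢xC xB≢xC ¬AB

    Assoc-generic : ∀ {xA yA oA xB yB oB xC yC oC} → ¬ xA ≡ xC → ¬ xB ≡ xC →
                    Assoc (affine xA yA oA) (affine xB yB oB) (affine xC yC oC)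
    Assoc-generic xA≢xC xB≢xC = trans (generic xA≢xC xB≢xC (⊹-graph _ _) (⊹-graph _ _) (⊹-graph _ _) (⊹-graph _ _)) (⊹-comm _ _)

    -- Coinciding abscissae leave few cases. If xA = xC then R = ±P, settled by commutativity and
    -- cancellation. If xB = xC then R = ±Q; reading the sum backwards turns R = Q into the generic
    -- case and R = -Q into cancellation.
    ⊹-assoc : ∀ P Q R → Assoc P Q R
    ⊹-assoc O Q R = trans (cong (_⊹ R) (⊹-identityˡ Q)) (sym (⊹-identityˡ _))
    ⊹-assoc P O R = trans (cong (_⊹ R) (⊹-identityʳ P)) (cong (P ⊹_) (sym (⊹-identityˡ R)))
    ⊹-assoc P Q O = trans (⊹-identityʳ _) (cong (P ⊹_) (sym (⊹-identityʳ Q)))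
    ⊹-assoc P@(affine xA yA oA) Q@(affine xB yB oB) R@(affine xC yC oC) with xA ≟ xC
    ... | yes refl with same-x oA oC
    ...   | inj₁ refl = subst (Assoc P Q) (affine-≡ refl refl) (Assoc-same P Q)
    ...   | inj₂ refl = subst (Assoc P Q) (affine-≡ refl refl) (Assoc-opposite₁₃ P Q)
    ⊹-assoc P@(affine xA yA oA) Q@(affine xB yB oB) R@(affine xC yC oC) | no xA≢xC with xB ≟ xC
    ... | no xB≢xC = Assoc-generic xA≢xC xB≢xC
    ... | yes refl with same-x oB oC
    ...   | inj₁ refl = Assoc-reverse R Q P (Assoc-generic (λ e → xA≢xC (sym e)) (λ e → xA≢xC (sym e)))
    ...   | inj₂ refl = Assoc-reverse R Q P (Assoc-opposite₁₂ R Q P (Add⇒≡ (addOpposite (sym (0-0-y yB)))) (affine-≡ refl (sym (0-0-y yB))))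

    isAbelianGroup : IsAbelianGroup _≡_ _⊹_ O negate
    isAbelianGroup = record
      { isGroup = record
        { isMonoid = record
          { isSemigroup = record
            { isMagma = record { isEquivalence = ≡.isEquivalence ; ∙-cong = cong₂ _⊹_ }
            ; assoc = ⊹-assoc }
          ; identity = ⊹-identityˡ , ⊹-identityʳ }
        ; inverse = (λ P → Add⇒≡ (Add-comm (Add-inverse P))) , (λ P → Add⇒≡ (Add-inverse P))
        ; ⁻¹-cong = cong negate }
      ; comm = ⊹-comm }

-- Quartic fields

record Quad (A : Set) : Set where
  constructor quad
  field q₀ q₁ q₂ q₃ : A
open Quad

-- Multiplication modulo a monic quartic, written for bare operations so that it applies to
-- elements of a ring and to solver expressions alike.
module ModQuartic {A : Set} (_+_ _-_ _*_ : A → A → A) (c₀ c₁ c₂ c₃ : A) where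
  infixl 7 _⊛_
  infixl 6 _⊞_
  _⊞_ : Quad A → Quad A → Quad A
  quad a b c d ⊞ quad a' b' c' d' = quad (a + a') (b + b') (c + c') (d + d')

  _⊛_ : Quad A → Quad A → Quad A
  quad a b c d ⊛ quad a' b' c' d' = quad (p₀ - (s₄ * c₀)) (s₁ - (s₄ * c₁)) (s₂ - (s₄ * c₂)) (s₃ - (s₄ * c₃))
    where
    p₀ = a * a'
    p₁ = (a * b') + (b * a')
    p₂ = ((a * c') + (b * b')) + (c * a')
    p₃ = (((a * d') + (b * c')) + (c * b')) + (d * a')
    p₄ = ((b * d') + (c * c')) + (d * b')
    p₅ = (c * d') + (d * c')
    p₆ = d * d'
    r₅ = p₅ - (p₆ * c₃)
    r₄ = p₄ - (p₆ * c₂)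
    r₃ = p₃ - (p₆ * c₁)
    r₂ = p₂ - (p₆ * c₀)
    s₄ = r₄ - (r₅ * c₃)
    s₃ = r₃ - (r₅ * c₂)
    s₂ = r₂ - (r₅ * c₁)
    s₁ = p₁ - (r₅ * c₀)

-- The norm of a = a₀ + a₁θ + a₂θ² + a₃θ³ is the determinant of the matrix with rows
-- a, θa, θ²a, θ³a, and its cofactors along the first column give the cofactor of a.
module QuarticNorm {A : Set} (_+_ _-_ _*_ : A → A → A) (0# c₀ c₁ c₂ c₃ : A) where
  θ· : Quad A → Quad A
  θ· (quad a b c d) = quad (0# - (d * c₀)) (a - (d * c₁)) (b - (d * c₂)) (c - (d * c₃))

  minor : Quad A → Quad A → Quad A → A
  minor (quad _ a b c) (quad _ a' b' c') (quad _ a'' b'' c'') =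
    ((a * ((b' * c'') - (c' * b''))) - (b * ((a' * c'') - (c' * a'')))) + (c * ((a' * b'') - (b' * a'')))

  cofactor : Quad A → Quad A
  cofactor r = quad (minor s t u) (minor t r u) (minor r s u) (minor s r t)
    where
    s = θ· r
    t = θ· s
    u = θ· t

  normQ : Quad A → A
  normQ r = (((q₀ b * q₀ r) + (q₁ b * q₀ (θ· r))) + (q₂ b * q₀ (θ· (θ· r)))) + (q₃ b * q₀ (θ· (θ· (θ· r))))
    where b = cofactor r

-- Each law is a family of polynomial identities, one per coordinate, so it is proved over any
-- commutative ring and used over both ℚ and ℤ.
module ModQuarticLaws (R : Ring≡) where
  open Ring≡ R renaming (Carrier to A)
  open RingSolver R
  2# : A
  2# = 1# + 1#

  module M c₀ c₁ c₂ c₃ = ModQuartic _+_ _-_ _*_ c₀ c₁ c₂ c₃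
  module E {n} (c₀ c₁ c₂ c₃ : Expr n) = ModQuartic _:+_ _:-_ _:*_ c₀ c₁ c₂ c₃

  assoc₀ : ∀ c₀ c₁ c₂ c₃ a b c d a' b' c' d' a'' b'' c'' d'' → let open M c₀ c₁ c₂ c₃ in
    q₀ ((quad a b c d ⊛ quad a' b' c' d') ⊛ quad a'' b'' c'' d'') ≡ q₀ (quad a b c d ⊛ (quad a' b' c' d' ⊛ quad a'' b'' c'' d''))
  assoc₀ = solve 16 (λ c₀ c₁ c₂ c₃ a b c d a' b' c' d' a'' b'' c'' d'' → let open E c₀ c₁ c₂ c₃ in
    q₀ ((quad a b c d ⊛ quad a' b' c' d') ⊛ quad a'' b'' c'' d'') := q₀ (quad a b c d ⊛ (quad a' b' c' d' ⊛ quad a'' b'' c'' d''))) refl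

  assoc₁ : ∀ c₀ c₁ c₂ c₃ a b c d a' b' c' d' a'' b'' c'' d'' → let open M c₀ c₁ c₂ c₃ in
    q₁ ((quad a b c d ⊛ quad a' b' c' d') ⊛ quad a'' b'' c'' d'') ≡ q₁ (quad a b c d ⊛ (quad a' b' c' d' ⊛ quad a'' b'' c'' d''))
  assoc₁ = solve 16 (λ c₀ c₁ c₂ c₃ a b c d a' b' c' d' a'' b'' c'' d'' → let open E c₀ c₁ c₂ c₃ in
    q₁ ((quad a b c d ⊛ quad a' b' c' d') ⊛ quad a'' b'' c'' d'') := q₁ (quad a b c d ⊛ (quad a' b' c' d' ⊛ quad a'' b'' c'' d''))) refl

  assoc₂ : ∀ c₀ c₁ c₂ c₃ a b c d a' b' c' d' a'' b'' c'' d'' → let open M c₀ c₁ c₂ c₃ in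
    q₂ ((quad a b c d ⊛ quad a' b' c' d') ⊛ quad a'' b'' c'' d'') ≡ q₂ (quad a b c d ⊛ (quad a' b' c' d' ⊛ quad a'' b'' c'' d''))
  assoc₂ = solve 16 (λ c₀ c₁ c₂ c₃ a b c d a' b' c' d' a'' b'' c'' d'' → let open E c₀ c₁ c₂ c₃ in
    q₂ ((quad a b c d ⊛ quad a' b' c' d') ⊛ quad a'' b'' c'' d'') := q₂ (quad a b c d ⊛ (quad a' b' c' d' ⊛ quad a'' b'' c'' d''))) refl

  assoc₃ : ∀ c₀ c₁ c₂ c₃ a b c d a' b' c' d' a'' b'' c'' d'' → let open M c₀ c₁ c₂ c₃ in
    q₃ ((quad a b c d ⊛ quad a' b' c' d') ⊛ quad a'' b'' c'' d'') ≡ q₃ (quad a b c d ⊛ (quad a' b' c' d' ⊛ quad a'' b'' c'' d''))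
  assoc₃ = solve 16 (λ c₀ c₁ c₂ c₃ a b c d a' b' c' d' a'' b'' c'' d'' → let open E c₀ c₁ c₂ c₃ in
    q₃ ((quad a b c d ⊛ quad a' b' c' d') ⊛ quad a'' b'' c'' d'') := q₃ (quad a b c d ⊛ (quad a' b' c' d' ⊛ quad a'' b'' c'' d''))) refl

  comm₀ : ∀ c₀ c₁ c₂ c₃ a b c d a' b' c' d' → let open M c₀ c₁ c₂ c₃ in
    q₀ (quad a b c d ⊛ quad a' b' c' d') ≡ q₀ (quad a' b' c' d' ⊛ quad a b c d)
  comm₀ = solve 12 (λ c₀ c₁ c₂ c₃ a b c d a' b' c' d' → let open E c₀ c₁ c₂ c₃ in
    q₀ (quad a b c d ⊛ quad a' b' c' d') := q₀ (quad a' b' c' d' ⊛ quad a b c d)) refl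

  comm₁ : ∀ c₀ c₁ c₂ c₃ a b c d a' b' c' d' → let open M c₀ c₁ c₂ c₃ in
    q₁ (quad a b c d ⊛ quad a' b' c' d') ≡ q₁ (quad a' b' c' d' ⊛ quad a b c d)
  comm₁ = solve 12 (λ c₀ c₁ c₂ c₃ a b c d a' b' c' d' → let open E c₀ c₁ c₂ c₃ in
    q₁ (quad a b c d ⊛ quad a' b' c' d') := q₁ (quad a' b' c' d' ⊛ quad a b c d)) refl

  comm₂ : ∀ c₀ c₁ c₂ c₃ a b c d a' b' c' d' → let open M c₀ c₁ c₂ c₃ in
    q₂ (quad a b c d ⊛ quad a' b' c' d') ≡ q₂ (quad a' b' c' d' ⊛ quad a b c d)
  comm₂ = solve 12 (λ c₀ c₁ c₂ c₃ a b c d a' b' c' d' → let open E c₀ c₁ c₂ c₃ in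
    q₂ (quad a b c d ⊛ quad a' b' c' d') := q₂ (quad a' b' c' d' ⊛ quad a b c d)) refl

  comm₃ : ∀ c₀ c₁ c₂ c₃ a b c d a' b' c' d' → let open M c₀ c₁ c₂ c₃ in
    q₃ (quad a b c d ⊛ quad a' b' c' d') ≡ q₃ (quad a' b' c' d' ⊛ quad a b c d)
  comm₃ = solve 12 (λ c₀ c₁ c₂ c₃ a b c d a' b' c' d' → let open E c₀ c₁ c₂ c₃ in
    q₃ (quad a b c d ⊛ quad a' b' c' d') := q₃ (quad a' b' c' d' ⊛ quad a b c d)) refl

  identity₀ : ∀ c₀ c₁ c₂ c₃ a b c d → let open M c₀ c₁ c₂ c₃ in
    q₀ (quad 1# 0# 0# 0# ⊛ quad a b c d) ≡ q₀ (quad a b c d)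
  identity₀ = solve 8 (λ c₀ c₁ c₂ c₃ a b c d → let open E c₀ c₁ c₂ c₃ in
    q₀ (quad :1 :0 :0 :0 ⊛ quad a b c d) := q₀ (quad a b c d)) refl

  identity₁ : ∀ c₀ c₁ c₂ c₃ a b c d → let open M c₀ c₁ c₂ c₃ in
    q₁ (quad 1# 0# 0# 0# ⊛ quad a b c d) ≡ q₁ (quad a b c d)
  identity₁ = solve 8 (λ c₀ c₁ c₂ c₃ a b c d → let open E c₀ c₁ c₂ c₃ in
    q₁ (quad :1 :0 :0 :0 ⊛ quad a b c d) := q₁ (quad a b c d)) refl

  identity₂ : ∀ c₀ c₁ c₂ c₃ a b c d → let open M c₀ c₁ c₂ c₃ in
    q₂ (quad 1# 0# 0# 0# ⊛ quad a b c d) ≡ q₂ (quad a b c d)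
  identity₂ = solve 8 (λ c₀ c₁ c₂ c₃ a b c d → let open E c₀ c₁ c₂ c₃ in
    q₂ (quad :1 :0 :0 :0 ⊛ quad a b c d) := q₂ (quad a b c d)) refl

  identity₃ : ∀ c₀ c₁ c₂ c₃ a b c d → let open M c₀ c₁ c₂ c₃ in
    q₃ (quad 1# 0# 0# 0# ⊛ quad a b c d) ≡ q₃ (quad a b c d)
  identity₃ = solve 8 (λ c₀ c₁ c₂ c₃ a b c d → let open E c₀ c₁ c₂ c₃ in
    q₃ (quad :1 :0 :0 :0 ⊛ quad a b c d) := q₃ (quad a b c d)) refl

  distrib₀ : ∀ c₀ c₁ c₂ c₃ a b c d a' b' c' d' a'' b'' c'' d'' → let open M c₀ c₁ c₂ c₃ in
    q₀ (quad a b c d ⊛ (quad a' b' c' d' ⊞ quad a'' b'' c'' d'')) ≡ q₀ ((quad a b c d ⊛ quad a' b' c' d') ⊞ (quad a b c d ⊛ quad a'' b'' c'' d''))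
  distrib₀ = solve 16 (λ c₀ c₁ c₂ c₃ a b c d a' b' c' d' a'' b'' c'' d'' → let open E c₀ c₁ c₂ c₃ in
    q₀ (quad a b c d ⊛ (quad a' b' c' d' ⊞ quad a'' b'' c'' d'')) := q₀ ((quad a b c d ⊛ quad a' b' c' d') ⊞ (quad a b c d ⊛ quad a'' b'' c'' d''))) refl

  distrib₁ : ∀ c₀ c₁ c₂ c₃ a b c d a' b' c' d' a'' b'' c'' d'' → let open M c₀ c₁ c₂ c₃ in
    q₁ (quad a b c d ⊛ (quad a' b' c' d' ⊞ quad a'' b'' c'' d'')) ≡ q₁ ((quad a b c d ⊛ quad a' b' c' d') ⊞ (quad a b c d ⊛ quad a'' b'' c'' d''))
  distrib₁ = solve 16 (λ c₀ c₁ c₂ c₃ a b c d a' b' c' d' a'' b'' c'' d'' → let open E c₀ c₁ c₂ c₃ in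
    q₁ (quad a b c d ⊛ (quad a' b' c' d' ⊞ quad a'' b'' c'' d'')) := q₁ ((quad a b c d ⊛ quad a' b' c' d') ⊞ (quad a b c d ⊛ quad a'' b'' c'' d''))) refl

  distrib₂ : ∀ c₀ c₁ c₂ c₃ a b c d a' b' c' d' a'' b'' c'' d'' → let open M c₀ c₁ c₂ c₃ in
    q₂ (quad a b c d ⊛ (quad a' b' c' d' ⊞ quad a'' b'' c'' d'')) ≡ q₂ ((quad a b c d ⊛ quad a' b' c' d') ⊞ (quad a b c d ⊛ quad a'' b'' c'' d''))
  distrib₂ = solve 16 (λ c₀ c₁ c₂ c₃ a b c d a' b' c' d' a'' b'' c'' d'' → let open E c₀ c₁ c₂ c₃ in
    q₂ (quad a b c d ⊛ (quad a' b' c' d' ⊞ quad a'' b'' c'' d'')) := q₂ ((quad a b c d ⊛ quad a' b' c' d') ⊞ (quad a b c d ⊛ quad a'' b'' c'' d''))) refl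

  distrib₃ : ∀ c₀ c₁ c₂ c₃ a b c d a' b' c' d' a'' b'' c'' d'' → let open M c₀ c₁ c₂ c₃ in
    q₃ (quad a b c d ⊛ (quad a' b' c' d' ⊞ quad a'' b'' c'' d'')) ≡ q₃ ((quad a b c d ⊛ quad a' b' c' d') ⊞ (quad a b c d ⊛ quad a'' b'' c'' d''))
  distrib₃ = solve 16 (λ c₀ c₁ c₂ c₃ a b c d a' b' c' d' a'' b'' c'' d'' → let open E c₀ c₁ c₂ c₃ in
    q₃ (quad a b c d ⊛ (quad a' b' c' d' ⊞ quad a'' b'' c'' d'')) := q₃ ((quad a b c d ⊛ quad a' b' c' d') ⊞ (quad a b c d ⊛ quad a'' b'' c'' d''))) refl

  module N c₀ c₁ c₂ c₃ = QuarticNorm _+_ _-_ _*_ 0# c₀ c₁ c₂ c₃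
  module NE {n} (c₀ c₁ c₂ c₃ : Expr n) = QuarticNorm _:+_ _:-_ _:*_ :0 c₀ c₁ c₂ c₃

  cofactor₀ : ∀ c₀ c₁ c₂ c₃ a b c d → let open M c₀ c₁ c₂ c₃ in
    q₀ (N.cofactor c₀ c₁ c₂ c₃ (quad a b c d) ⊛ quad a b c d) ≡ N.normQ c₀ c₁ c₂ c₃ (quad a b c d)
  cofactor₀ = solve 8 (λ c₀ c₁ c₂ c₃ a b c d → let open E c₀ c₁ c₂ c₃ in
    q₀ (NE.cofactor c₀ c₁ c₂ c₃ (quad a b c d) ⊛ quad a b c d) := NE.normQ c₀ c₁ c₂ c₃ (quad a b c d)) refl

  embed₀ : ∀ c₀ c₁ c₂ c₃ q r → let open M c₀ c₁ c₂ c₃ in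
    q₀ (quad q 0# 0# 0# ⊛ quad r 0# 0# 0#) ≡ (q * r)
  embed₀ = solve 6 (λ c₀ c₁ c₂ c₃ q r → let open E c₀ c₁ c₂ c₃; z = :0 in
    q₀ (quad q z z z ⊛ quad r z z z) := (q :* r)) refl

  cofactor₁ : ∀ c₀ c₁ c₂ c₃ a b c d → let open M c₀ c₁ c₂ c₃ in
    q₁ (N.cofactor c₀ c₁ c₂ c₃ (quad a b c d) ⊛ quad a b c d) ≡ 0#
  cofactor₁ = solve 8 (λ c₀ c₁ c₂ c₃ a b c d → let open E c₀ c₁ c₂ c₃ in
    q₁ (NE.cofactor c₀ c₁ c₂ c₃ (quad a b c d) ⊛ quad a b c d) := :0) refl

  embed₁ : ∀ c₀ c₁ c₂ c₃ q r → let open M c₀ c₁ c₂ c₃ in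
    q₁ (quad q 0# 0# 0# ⊛ quad r 0# 0# 0#) ≡ 0#
  embed₁ = solve 6 (λ c₀ c₁ c₂ c₃ q r → let open E c₀ c₁ c₂ c₃; z = :0 in
    q₁ (quad q z z z ⊛ quad r z z z) := :0) refl

  cofactor₂ : ∀ c₀ c₁ c₂ c₃ a b c d → let open M c₀ c₁ c₂ c₃ in
    q₂ (N.cofactor c₀ c₁ c₂ c₃ (quad a b c d) ⊛ quad a b c d) ≡ 0#
  cofactor₂ = solve 8 (λ c₀ c₁ c₂ c₃ a b c d → let open E c₀ c₁ c₂ c₃ in
    q₂ (NE.cofactor c₀ c₁ c₂ c₃ (quad a b c d) ⊛ quad a b c d) := :0) refl

  embed₂ : ∀ c₀ c₁ c₂ c₃ q r → let open M c₀ c₁ c₂ c₃ in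
    q₂ (quad q 0# 0# 0# ⊛ quad r 0# 0# 0#) ≡ 0#
  embed₂ = solve 6 (λ c₀ c₁ c₂ c₃ q r → let open E c₀ c₁ c₂ c₃; z = :0 in
    q₂ (quad q z z z ⊛ quad r z z z) := :0) refl

  cofactor₃ : ∀ c₀ c₁ c₂ c₃ a b c d → let open M c₀ c₁ c₂ c₃ in
    q₃ (N.cofactor c₀ c₁ c₂ c₃ (quad a b c d) ⊛ quad a b c d) ≡ 0#
  cofactor₃ = solve 8 (λ c₀ c₁ c₂ c₃ a b c d → let open E c₀ c₁ c₂ c₃ in
    q₃ (NE.cofactor c₀ c₁ c₂ c₃ (quad a b c d) ⊛ quad a b c d) := :0) refl

  embed₃ : ∀ c₀ c₁ c₂ c₃ q r → let open M c₀ c₁ c₂ c₃ in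
    q₃ (quad q 0# 0# 0# ⊛ quad r 0# 0# 0#) ≡ 0#
  embed₃ = solve 6 (λ c₀ c₁ c₂ c₃ q r → let open E c₀ c₁ c₂ c₃; z = :0 in
    q₃ (quad q z z z ⊛ quad r z z z) := :0) refl

  normQ-scale : ∀ c₀ c₁ c₂ c₃ t a b c d → N.normQ c₀ c₁ c₂ c₃ (quad (a * t) (b * t) (c * t) (d * t)) ≡ t * t * t * t * N.normQ c₀ c₁ c₂ c₃ (quad a b c d)
  normQ-scale = solve 9 (λ c₀ c₁ c₂ c₃ t a b c d → NE.normQ c₀ c₁ c₂ c₃ (quad (a :* t) (b :* t) (c :* t) (d :* t)) := t :* t :* t :* t :* NE.normQ c₀ c₁ c₂ c₃ (quad a b c d)) refl

  -- The norm is taken in two stages through ℚ(θ²): p + qθ² is the relative norm (a + cθ²)² - θ²(b +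
  -- dθ²)², and the left side is four times the norm of p + qθ² with the square completed.
  normQ-biquadratic : ∀ c₀ c₂ a b c d →
    let p = a * a - c₀ * c * c + c₀ * (2# * b * d - c₂ * d * d)
        q = 2# * a * c - c₂ * c * c - (b * b - c₀ * d * d) + c₂ * (2# * b * d - c₂ * d * d)
        x = 2# * p - c₂ * q
    in x * x - (c₂ * c₂ - 2# * 2# * c₀) * (q * q) ≡ 2# * 2# * N.normQ c₀ 0# c₂ 0# (quad a b c d)
  normQ-biquadratic = solve 6 (λ c₀ c₂ a b c d →
    let 2# = con (+ 2)
        p = a :* a :- c₀ :* c :* c :+ c₀ :* (2# :* b :* d :- c₂ :* d :* d)
        q = 2# :* a :* c :- c₂ :* c :* c :- (b :* b :- c₀ :* d :* d) :+ c₂ :* (2# :* b :* d :- c₂ :* d :* d)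
        x = 2# :* p :- c₂ :* q
    in x :* x :- (c₂ :* c₂ :- 2# :* 2# :* c₀) :* (q :* q) := 2# :* 2# :* NE.normQ c₀ :0 c₂ :0 (quad a b c d)) refl

ℚ-ring : Ring≡
ℚ-ring = record { isCommutativeRing = ℚ.+-*-isCommutativeRing ; _-_ = ℚ._-_ ; sub≡ = λ _ _ → refl }

module ℚLaws = ModQuarticLaws ℚ-ring

cong₄ : ∀ {A B : Set} (f : A → A → A → A → B) {a a' b b' c c' d d'} →
        a ≡ a' → b ≡ b' → c ≡ c' → d ≡ d' → f a b c d ≡ f a' b' c' d'
cong₄ f refl refl refl refl = refl

module KRing (f : Quartic) where
  open Quartic f
  open Field f public

  negK : K f → K f
  negK ⟨ a , b , c , d ⟩ = ⟨ ℚ.- a , ℚ.- b , ℚ.- c , ℚ.- d ⟩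

  *K-assoc : ∀ x y z → (x *K y) *K z ≡ x *K (y *K z)
  *K-assoc ⟨ a , b , c , d ⟩ ⟨ a' , b' , c' , d' ⟩ ⟨ a'' , b'' , c'' , d'' ⟩ = cong₄ ⟨_,_,_,_⟩
    (ℚLaws.assoc₀ c₀ c₁ c₂ c₃ a b c d a' b' c' d' a'' b'' c'' d'')
    (ℚLaws.assoc₁ c₀ c₁ c₂ c₃ a b c d a' b' c' d' a'' b'' c'' d'')
    (ℚLaws.assoc₂ c₀ c₁ c₂ c₃ a b c d a' b' c' d' a'' b'' c'' d'')
    (ℚLaws.assoc₃ c₀ c₁ c₂ c₃ a b c d a' b' c' d' a'' b'' c'' d'')

  *K-comm : ∀ x y → x *K y ≡ y *K x
  *K-comm ⟨ a , b , c , d ⟩ ⟨ a' , b' , c' , d' ⟩ = cong₄ ⟨_,_,_,_⟩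
    (ℚLaws.comm₀ c₀ c₁ c₂ c₃ a b c d a' b' c' d') (ℚLaws.comm₁ c₀ c₁ c₂ c₃ a b c d a' b' c' d')
    (ℚLaws.comm₂ c₀ c₁ c₂ c₃ a b c d a' b' c' d') (ℚLaws.comm₃ c₀ c₁ c₂ c₃ a b c d a' b' c' d')

  *K-identityˡ : ∀ x → 1K *K x ≡ x
  *K-identityˡ ⟨ a , b , c , d ⟩ = cong₄ ⟨_,_,_,_⟩
    (ℚLaws.identity₀ c₀ c₁ c₂ c₃ a b c d) (ℚLaws.identity₁ c₀ c₁ c₂ c₃ a b c d)
    (ℚLaws.identity₂ c₀ c₁ c₂ c₃ a b c d) (ℚLaws.identity₃ c₀ c₁ c₂ c₃ a b c d)

  *K-distribˡ : ∀ x y z → x *K (y +K z) ≡ x *K y +K x *K z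
  *K-distribˡ ⟨ a , b , c , d ⟩ ⟨ a' , b' , c' , d' ⟩ ⟨ a'' , b'' , c'' , d'' ⟩ = cong₄ ⟨_,_,_,_⟩
    (ℚLaws.distrib₀ c₀ c₁ c₂ c₃ a b c d a' b' c' d' a'' b'' c'' d'')
    (ℚLaws.distrib₁ c₀ c₁ c₂ c₃ a b c d a' b' c' d' a'' b'' c'' d'')
    (ℚLaws.distrib₂ c₀ c₁ c₂ c₃ a b c d a' b' c' d' a'' b'' c'' d'')
    (ℚLaws.distrib₃ c₀ c₁ c₂ c₃ a b c d a' b' c' d' a'' b'' c'' d'')

  +K-comm : ∀ x y → x +K y ≡ y +K x
  +K-comm ⟨ a , b , c , d ⟩ ⟨ a' , b' , c' , d' ⟩ =
    cong₄ ⟨_,_,_,_⟩ (ℚ.+-comm a a') (ℚ.+-comm b b') (ℚ.+-comm c c') (ℚ.+-comm d d')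

  +K-identityˡ : ∀ x → 0K +K x ≡ x
  +K-identityˡ ⟨ a , b , c , d ⟩ =
    cong₄ ⟨_,_,_,_⟩ (ℚ.+-identityˡ a) (ℚ.+-identityˡ b) (ℚ.+-identityˡ c) (ℚ.+-identityˡ d)

  +K-inverseˡ : ∀ x → negK x +K x ≡ 0K
  +K-inverseˡ ⟨ a , b , c , d ⟩ =
    cong₄ ⟨_,_,_,_⟩ (ℚ.+-inverseˡ a) (ℚ.+-inverseˡ b) (ℚ.+-inverseˡ c) (ℚ.+-inverseˡ d)

  K-isCommutativeRing : IsCommutativeRing _≡_ _+K_ _*K_ negK 0K 1K
  K-isCommutativeRing = record
    { isRing = record
      { +-isAbelianGroup = record
        { isGroup = record
          { isMonoid = record
            { isSemigroup = record
              { isMagma = record { isEquivalence = ≡.isEquivalence ; ∙-cong = cong₂ _+K_ }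
              ; assoc = λ { ⟨ a , b , c , d ⟩ ⟨ a' , b' , c' , d' ⟩ ⟨ a'' , b'' , c'' , d'' ⟩ →
                  cong₄ ⟨_,_,_,_⟩ (ℚ.+-assoc a a' a'') (ℚ.+-assoc b b' b'') (ℚ.+-assoc c c' c'') (ℚ.+-assoc d d' d'') } }
            ; identity = +K-identityˡ , λ x → trans (+K-comm x 0K) (+K-identityˡ x) }
          ; inverse = +K-inverseˡ , λ x → trans (+K-comm x (negK x)) (+K-inverseˡ x)
          ; ⁻¹-cong = cong negK }
        ; comm = +K-comm }
      ; *-cong = cong₂ _*K_
      ; *-assoc = *K-assoc
      ; *-identity = *K-identityˡ , λ x → trans (*K-comm x 1K) (*K-identityˡ x)
      ; distrib = *K-distribˡ , λ x y z → trans (*K-comm (y +K z) x) (trans (*K-distribˡ x y z) (cong₂ _+K_ (*K-comm x y) (*K-comm x z))) }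
    ; *-comm = *K-comm }

  K-ring : Ring≡
  K-ring = record { isCommutativeRing = K-isCommutativeRing ; _-_ = _-K_ ; sub≡ = λ _ _ → refl }

  infix 4 _≟K_
  _≟K_ : (x y : K f) → Dec (x ≡ y)
  ⟨ a , b , c , d ⟩ ≟K ⟨ a' , b' , c' , d' ⟩ with a ℚ.≟ a' | b ℚ.≟ b' | c ℚ.≟ c' | d ℚ.≟ d'
  ... | yes refl | yes refl | yes refl | yes refl = yes refl
  ... | no ¬p | _ | _ | _ = no λ e → ¬p (cong K.a₀ e)
  ... | _ | no ¬p | _ | _ = no λ e → ¬p (cong K.a₁ e)
  ... | _ | _ | no ¬p | _ = no λ e → ¬p (cong K.a₂ e)
  ... | _ | _ | _ | no ¬p = no λ e → ¬p (cong K.a₃ e)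

  normK : K f → ℚ
  normK ⟨ a , b , c , d ⟩ = ℚLaws.N.normQ c₀ c₁ c₂ c₃ (quad a b c d)

  Anisotropic : Set
  Anisotropic = ∀ x → normK x ≡ 0ℚ → x ≡ 0K

  embed-* : ∀ q r → embed q *K embed r ≡ embed (q ℚ.* r)
  embed-* q r = cong₄ ⟨_,_,_,_⟩ (ℚLaws.embed₀ c₀ c₁ c₂ c₃ q r) (ℚLaws.embed₁ c₀ c₁ c₂ c₃ q r)
    (ℚLaws.embed₂ c₀ c₁ c₂ c₃ q r) (ℚLaws.embed₃ c₀ c₁ c₂ c₃ q r)

  cofactorK : K f → K f
  cofactorK ⟨ a , b , c , d ⟩ = let quad a' b' c' d' = ℚLaws.N.cofactor c₀ c₁ c₂ c₃ (quad a b c d) in ⟨ a' , b' , c' , d' ⟩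

  cofactorK-* : ∀ x → cofactorK x *K x ≡ embed (normK x)
  cofactorK-* ⟨ a , b , c , d ⟩ = cong₄ ⟨_,_,_,_⟩
    (ℚLaws.cofactor₀ c₀ c₁ c₂ c₃ a b c d) (ℚLaws.cofactor₁ c₀ c₁ c₂ c₃ a b c d)
    (ℚLaws.cofactor₂ c₀ c₁ c₂ c₃ a b c d) (ℚLaws.cofactor₃ c₀ c₁ c₂ c₃ a b c d)

  module _ (anisotropic : Anisotropic) where
    inverseK : ∀ x → ¬ x ≡ 0K → Σ (K f) λ y → y *K x ≡ 1K
    inverseK x x≢0 = embed (ℚ.1/ n) *K cofactorK x , (begin
      embed (ℚ.1/ n) *K cofactorK x *K x   ≡⟨ *K-assoc (embed (ℚ.1/ n)) (cofactorK x) x ⟩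
      embed (ℚ.1/ n) *K (cofactorK x *K x) ≡⟨ cong (embed (ℚ.1/ n) *K_) (cofactorK-* x) ⟩
      embed (ℚ.1/ n) *K embed n            ≡⟨ embed-* (ℚ.1/ n) n ⟩
      embed (ℚ.1/ n ℚ.* n)                 ≡⟨ cong embed (ℚ.*-inverseˡ n) ⟩
      1K ∎)
      where
      open ≡-Reasoning
      n = normK x
      instance
        n≢0 : ℚ.NonZero n
        n≢0 = ℚ.≢-nonZero (λ e → x≢0 (anisotropic x e))

    K-field : Field≡
    K-field = record { ring = K-ring ; _≟_ = _≟K_ ; inverse = inverseK ; 2≢0 = λ e → contradiction (cong K.a₀ e) λ () }

    noZeroDivisorsK : ∀ x y → x *K y ≡ 0K → x ≡ 0K ⊎ y ≡ 0K
    noZeroDivisorsK x y = FieldLemmas.noZeroDivisors K-field {x} {y}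

module FactorLaws (R : Ring≡) where
  open Ring≡ R renaming (Carrier to A)
  open RingSolver R
  open ModQuarticLaws R using (module M; module E)

  linear₀ : ∀ a b c d → let open M (a * d) (d + a * c) (c + a * b) (a + b) in Quad.q₀ (quad a 1# 0# 0# ⊛ quad d c b 1#) ≡ 0#
  linear₀ = solve 4 (λ a b c d → let open E (a :* d) (d :+ a :* c) (c :+ a :* b) (a :+ b) in Quad.q₀ (quad a :1 :0 :0 ⊛ quad d c b :1) := :0) refl

  linear₁ : ∀ a b c d → let open M (a * d) (d + a * c) (c + a * b) (a + b) in Quad.q₁ (quad a 1# 0# 0# ⊛ quad d c b 1#) ≡ 0#
  linear₁ = solve 4 (λ a b c d → let open E (a :* d) (d :+ a :* c) (c :+ a :* b) (a :+ b) in Quad.q₁ (quad a :1 :0 :0 ⊛ quad d c b :1) := :0) refl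

  linear₂ : ∀ a b c d → let open M (a * d) (d + a * c) (c + a * b) (a + b) in Quad.q₂ (quad a 1# 0# 0# ⊛ quad d c b 1#) ≡ 0#
  linear₂ = solve 4 (λ a b c d → let open E (a :* d) (d :+ a :* c) (c :+ a :* b) (a :+ b) in Quad.q₂ (quad a :1 :0 :0 ⊛ quad d c b :1) := :0) refl

  linear₃ : ∀ a b c d → let open M (a * d) (d + a * c) (c + a * b) (a + b) in Quad.q₃ (quad a 1# 0# 0# ⊛ quad d c b 1#) ≡ 0#
  linear₃ = solve 4 (λ a b c d → let open E (a :* d) (d :+ a :* c) (c :+ a :* b) (a :+ b) in Quad.q₃ (quad a :1 :0 :0 ⊛ quad d c b :1) := :0) refl

  quadratic₀ : ∀ a b c d → let open M (b * d) (a * d + b * c) (b + d + a * c) (a + c) in Quad.q₀ (quad b a 1# 0# ⊛ quad d c 1# 0#) ≡ 0#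
  quadratic₀ = solve 4 (λ a b c d → let open E (b :* d) (a :* d :+ b :* c) (b :+ d :+ a :* c) (a :+ c) in Quad.q₀ (quad b a :1 :0 ⊛ quad d c :1 :0) := :0) refl

  quadratic₁ : ∀ a b c d → let open M (b * d) (a * d + b * c) (b + d + a * c) (a + c) in Quad.q₁ (quad b a 1# 0# ⊛ quad d c 1# 0#) ≡ 0#
  quadratic₁ = solve 4 (λ a b c d → let open E (b :* d) (a :* d :+ b :* c) (b :+ d :+ a :* c) (a :+ c) in Quad.q₁ (quad b a :1 :0 ⊛ quad d c :1 :0) := :0) refl

  quadratic₂ : ∀ a b c d → let open M (b * d) (a * d + b * c) (b + d + a * c) (a + c) in Quad.q₂ (quad b a 1# 0# ⊛ quad d c 1# 0#) ≡ 0#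
  quadratic₂ = solve 4 (λ a b c d → let open E (b :* d) (a :* d :+ b :* c) (b :+ d :+ a :* c) (a :+ c) in Quad.q₂ (quad b a :1 :0 ⊛ quad d c :1 :0) := :0) refl

  quadratic₃ : ∀ a b c d → let open M (b * d) (a * d + b * c) (b + d + a * c) (a + c) in Quad.q₃ (quad b a 1# 0# ⊛ quad d c 1# 0#) ≡ 0#
  quadratic₃ = solve 4 (λ a b c d → let open E (b :* d) (a :* d :+ b :* c) (b :+ d :+ a :* c) (a :+ c) in Quad.q₃ (quad b a :1 :0 ⊛ quad d c :1 :0) := :0) refl

private module ℚFactor = FactorLaws ℚ-ring

-- A factorisation f = gh gives g(θ)h(θ) = 0. Neither factor is zero, because each has a coordinate
-- 1 at its leading power of θ.
irreducible : ∀ f → KRing.Anisotropic f → Irreducible f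
irreducible (quartic _ _ _ _) an (inj₁ (a , b , c , d , refl , refl , refl , refl)) =
  [ (λ e → contradiction (cong K.a₁ e) λ ()) , (λ e → contradiction (cong K.a₃ e) λ ()) ]′
  (KRing.noZeroDivisorsK (quartic (a ℚ.* d) (d ℚ.+ a ℚ.* c) (c ℚ.+ a ℚ.* b) (a ℚ.+ b)) an ⟨ a , 1ℚ , 0ℚ , 0ℚ ⟩ ⟨ d , c , b , 1ℚ ⟩
    (cong₄ ⟨_,_,_,_⟩ (ℚFactor.linear₀ a b c d) (ℚFactor.linear₁ a b c d) (ℚFactor.linear₂ a b c d) (ℚFactor.linear₃ a b c d)))
irreducible (quartic _ _ _ _) an (inj₂ (a , b , c , d , refl , refl , refl , refl)) =
  [ (λ e → contradiction (cong K.a₂ e) λ ()) , (λ e → contradiction (cong K.a₂ e) λ ()) ]′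
  (KRing.noZeroDivisorsK (quartic (b ℚ.* d) (a ℚ.* d ℚ.+ b ℚ.* c) (b ℚ.+ d ℚ.+ a ℚ.* c) (a ℚ.+ c)) an ⟨ b , a , 1ℚ , 0ℚ ⟩ ⟨ d , c , 1ℚ , 0ℚ ⟩
    (cong₄ ⟨_,_,_,_⟩ (ℚFactor.quadratic₀ a b c d) (ℚFactor.quadratic₁ a b c d) (ℚFactor.quadratic₂ a b c d) (ℚFactor.quadratic₃ a b c d)))

-- Integral models of the norm form, and descent.

ℤ-ring : Ring≡
ℤ-ring = record { isCommutativeRing = ℤ.+-*-isCommutativeRing ; _-_ = ℤ._-_ ; sub≡ = λ _ _ → refl }

module ℤ-Solver = RingSolver ℤ-ring
module ℚ-Solver = RingSolver ℚ-ring

fromℤ-+ : ∀ a b → fromℤ (a ℤ.+ b) ≡ fromℤ a ℚ.+ fromℤ b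
fromℤ-+ a b = ℚ.toℚᵘ-injective (ℚᵘ.≃-trans (ℚᵘ.*≡* (ℤ-Solver.solve 2 (λ a b → (a :+ b) :* :1 := (a :* :1 :+ b :* :1) :* :1) refl a b)) (ℚᵘ.≃-sym (ℚ.toℚᵘ-homo-+ (fromℤ a) (fromℤ b))))

fromℤ-* : ∀ a b → fromℤ (a ℤ.* b) ≡ fromℤ a ℚ.* fromℤ b
fromℤ-* a b = ℚ.toℚᵘ-injective (ℚᵘ.≃-trans (ℚᵘ.*≡* refl) (ℚᵘ.≃-sym (ℚ.toℚᵘ-homo-* (fromℤ a) (fromℤ b))))

fromℤ-neg : ∀ a → fromℤ (ℤ.- a) ≡ ℚ.- fromℤ a
fromℤ-neg (+ zero) = refl
fromℤ-neg (+ suc n) = refl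
fromℤ-neg -[1+ n ] = refl

fromℤ-sub : ∀ a b → fromℤ (a ℤ.- b) ≡ fromℤ a ℚ.- fromℤ b
fromℤ-sub a b = trans (fromℤ-+ a (ℤ.- b)) (cong (fromℤ a ℚ.+_) (fromℤ-neg b))

fromℤ-injective : ∀ {a b} → fromℤ a ≡ fromℤ b → a ≡ b
fromℤ-injective e = cong ↥_ e

*-denominator : ∀ q → fromℤ (↧ q) ℚ.* q ≡ fromℤ (↥ q)
*-denominator q@record{} = ℚ.toℚᵘ-injective (ℚᵘ.≃-trans (ℚ.toℚᵘ-homo-* (fromℤ (↧ q)) q)
  (ℚᵘ.*≡* (trans (ℤ-Solver.solve 2 (λ n d → d :* n :* :1 := n :* d) refl (↥ q) (↧ q)) (cong (λ t → ↥ q ℤ.* + suc t) (sym (ℕ.+-identityʳ (ℚ.denominator-1 q)))))))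

⟦⟧ℤ-fromℤ : ∀ z → ℚ-Solver.⟦ z ⟧ℤ ≡ fromℤ z
⟦⟧ℤ-fromℤ z = trans (ℚ-Solver.⟦⟧ℤ≡ z) (lemma z)
  where
  open Multiples (Ring≡.+-isAbelianGroup ℚ-ring) using (_·_)
  lemmaℕ : ∀ n → + n · 1ℚ ≡ fromℤ (+ n)
  lemmaℕ zero = refl
  lemmaℕ (suc n) = trans (cong (1ℚ ℚ.+_) (lemmaℕ n)) (sym (fromℤ-+ (+ 1) (+ n)))
  lemma : ∀ z → z · 1ℚ ≡ fromℤ z
  lemma (+ n) = lemmaℕ n
  lemma -[1+ n ] = trans (cong ℚ.-_ (lemmaℕ (suc n))) (sym (fromℤ-neg (+ suc n)))

⟦⟧ℤ-id : ∀ z → ℤ-Solver.⟦ z ⟧ℤ ≡ z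
⟦⟧ℤ-id z = fromℤ-injective (trans (cong fromℤ (ℤ-Solver.⟦⟧ℤ≡ z)) (trans (lemma z) (trans (sym (ℚ-Solver.⟦⟧ℤ≡ z)) (⟦⟧ℤ-fromℤ z))))
  where
  open Multiples (Ring≡.+-isAbelianGroup ℤ-ring) using (_·_)
  open Multiples (Ring≡.+-isAbelianGroup ℚ-ring) using () renaming (_·_ to _·ℚ_)
  lemmaℕ : ∀ n → fromℤ (+ n · + 1) ≡ + n ·ℚ 1ℚ
  lemmaℕ zero = refl
  lemmaℕ (suc n) = trans (fromℤ-+ (+ 1) (+ n · + 1)) (cong (1ℚ ℚ.+_) (lemmaℕ n))
  lemma : ∀ z → fromℤ (z · + 1) ≡ z ·ℚ 1ℚ
  lemma (+ n) = lemmaℕ n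
  lemma -[1+ n ] = trans (fromℤ-neg (+ suc n · + 1)) (cong ℚ.-_ (lemmaℕ (suc n)))

-- With the norm and the product reflected as expressions, one induction shows that both commute
-- with `fromℤ`.
fromℤ-⟦⟧ : ∀ {n} (e : Expr n) ρ → fromℤ (ℤ-Solver.⟦ e ⟧ ρ) ≡ ℚ-Solver.⟦ e ⟧ (Vec.map fromℤ ρ)
fromℤ-⟦⟧ (con z) ρ = trans (cong fromℤ (⟦⟧ℤ-id z)) (sym (⟦⟧ℤ-fromℤ z))
fromℤ-⟦⟧ (var i) ρ = sym (lookup-map i fromℤ ρ)
fromℤ-⟦⟧ (e :+ d) ρ = trans (fromℤ-+ (ℤ-Solver.⟦ e ⟧ ρ) (ℤ-Solver.⟦ d ⟧ ρ)) (cong₂ ℚ._+_ (fromℤ-⟦⟧ e ρ) (fromℤ-⟦⟧ d ρ))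
fromℤ-⟦⟧ (e :- d) ρ = trans (fromℤ-sub (ℤ-Solver.⟦ e ⟧ ρ) (ℤ-Solver.⟦ d ⟧ ρ)) (cong₂ ℚ._-_ (fromℤ-⟦⟧ e ρ) (fromℤ-⟦⟧ d ρ))
fromℤ-⟦⟧ (e :* d) ρ = trans (fromℤ-* (ℤ-Solver.⟦ e ⟧ ρ) (ℤ-Solver.⟦ d ⟧ ρ)) (cong₂ ℚ._*_ (fromℤ-⟦⟧ e ρ) (fromℤ-⟦⟧ d ρ))

allVec? : ∀ {m} n {P : Vec (Fin m) n → Set} → (∀ v → Dec (P v)) → Dec (∀ v → P v)
allVec? zero    P? = map′ (λ { p [] → p }) (λ p → p []) (P? [])
allVec? (suc n) P? = map′ (λ { p (i ∷ v) → p i v }) (λ p i v → p (i ∷ v)) (Fin.all? (λ i → allVec? n (λ v → P? (i ∷ v))))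

-- A form that has no nontrivial zero modulo ℓ has none over ℤ, by infinite descent. The first k
-- variables of e stand for fixed coefficients c.
module Descent (ℓ : ℕ) (1<ℓ : 1 < ℓ) where
  private instance
    ℓ≢0 : ℕ.NonZero ℓ
    ℓ≢0 = ℕ.>-nonZero (ℕ.<-trans (s≤s z≤n) 1<ℓ)

  fromFin : Fin ℓ → ℤ
  fromFin i = + toℕ i

  0F : Fin ℓ
  0F = fromℕ< (ℕ.<-trans (s≤s z≤n) 1<ℓ)

  Good : ∀ {k n} → Expr (k ℕ.+ n) → Vec ℤ k → Vec (Fin ℓ) n → Set
  Good e c r = r ≡ replicate _ 0F ⊎ ¬ + ℓ ∣ ℤ-Solver.⟦ e ⟧ (c ++ Vec.map fromFin r)

  good? : ∀ {k n} (e : Expr (k ℕ.+ n)) c r → Dec (Good {k} e c r)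
  good? e c r = ≡-dec Fin._≟_ r (replicate _ 0F) ⊎-dec ¬? (+ ℓ ℤ∣.∣? ℤ-Solver.⟦ e ⟧ (c ++ Vec.map fromFin r))

  quot : ℤ → ℤ
  quot z = z /ℕ ℓ

  rem : ℤ → Fin ℓ
  rem z = fromℕ< (n%ℕd<d z ℓ)

  rem-quot : ∀ z → z ≡ fromFin (rem z) ℤ.+ quot z ℤ.* + ℓ
  rem-quot z = trans (a≡a%ℕn+[a/ℕn]*n z ℓ) (cong (λ r → + r ℤ.+ quot z ℤ.* + ℓ) (sym (Fin.toℕ-fromℕ< (n%ℕd<d z ℓ))))

  congruence : ∀ {n} (e : Expr n) (ρ ρ' : Vec ℤ n) → (∀ i → + ℓ ∣ lookup ρ i ℤ.- lookup ρ' i) →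
               + ℓ ∣ ℤ-Solver.⟦ e ⟧ ρ ℤ.- ℤ-Solver.⟦ e ⟧ ρ'
  congruence (con z) ρ ρ' h = divides (+ 0) (ℤ.+-inverseʳ ℤ-Solver.⟦ z ⟧ℤ)
  congruence (var i) ρ ρ' h = h i
  congruence (e :+ d) ρ ρ' h with congruence e ρ ρ' h | congruence d ρ ρ' h
  ... | divides q p | divides q' p' = divides (q ℤ.+ q') (trans
    (ℤ-Solver.solve 4 (λ a b a' b' → a :+ b :- (a' :+ b') := (a :- a') :+ (b :- b')) refl (ℤ-Solver.⟦ e ⟧ ρ) (ℤ-Solver.⟦ d ⟧ ρ) (ℤ-Solver.⟦ e ⟧ ρ') (ℤ-Solver.⟦ d ⟧ ρ'))
    (trans (cong₂ ℤ._+_ p p') (sym (ℤ.*-distribʳ-+ (+ ℓ) q q'))))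
  congruence (e :- d) ρ ρ' h with congruence e ρ ρ' h | congruence d ρ ρ' h
  ... | divides q p | divides q' p' = divides (q ℤ.- q') (trans
    (ℤ-Solver.solve 4 (λ a b a' b' → a :- b :- (a' :- b') := (a :- a') :- (b :- b')) refl (ℤ-Solver.⟦ e ⟧ ρ) (ℤ-Solver.⟦ d ⟧ ρ) (ℤ-Solver.⟦ e ⟧ ρ') (ℤ-Solver.⟦ d ⟧ ρ'))
    (trans (cong₂ ℤ._-_ p p') (ℤ-Solver.solve 3 (λ q q' l → q :* l :- q' :* l := (q :- q') :* l) refl q q' (+ ℓ))))
  congruence (e :* d) ρ ρ' h with congruence e ρ ρ' h | congruence d ρ ρ' h
  ... | divides q p | divides q' p' = divides (q ℤ.* y ℤ.+ x' ℤ.* q') (trans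
    (ℤ-Solver.solve 4 (λ a b a' b' → a :* b :- a' :* b' := (a :- a') :* b :+ a' :* (b :- b')) refl (ℤ-Solver.⟦ e ⟧ ρ) y x' (ℤ-Solver.⟦ d ⟧ ρ'))
    (trans (cong₂ (λ s t → s ℤ.* y ℤ.+ x' ℤ.* t) p p') (ℤ-Solver.solve 5 (λ q q' l y x → q :* l :* y :+ x :* (q' :* l) := (q :* y :+ x :* q') :* l) refl q q' (+ ℓ) y x')))
    where
    y = ℤ-Solver.⟦ d ⟧ ρ
    x' = ℤ-Solver.⟦ e ⟧ ρ'

  size : ∀ {n} → Vec ℤ n → ℕ
  size []      = 0
  size (z ∷ v) = ∣ z ∣ ℕ.+ size v

  module _ {k n} (e : Expr (k ℕ.+ n)) (c : Vec ℤ k)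
    (homogeneous : ∀ v → ℤ-Solver.⟦ e ⟧ (c ++ Vec.map (ℤ._* + ℓ) v) ≡ + 0 → ℤ-Solver.⟦ e ⟧ (c ++ v) ≡ + 0)
    (good : ∀ r → Good {k} e c r) where

    private
      close : ∀ {j} (c : Vec ℤ j) {m} (v : Vec ℤ m) i → + ℓ ∣ lookup (c ++ Vec.map fromFin (Vec.map rem v)) i ℤ.- lookup (c ++ v) i
      close (z ∷ c) v zero    = divides (+ 0) (ℤ.+-inverseʳ z)
      close (z ∷ c) v (suc i) = close c v i
      close [] (z ∷ v) zero = divides (+ 0 ℤ.- quot z) (trans (cong (λ t → fromFin (rem z) ℤ.- t) (rem-quot z))
        (ℤ-Solver.solve 3 (λ r q l → r :- (r :+ q :* l) := (:0 :- q) :* l) refl (fromFin (rem z)) (quot z) (+ ℓ)))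
      close [] (z ∷ v) (suc i) = close [] v i

      toℕ-0F : toℕ 0F ≡ 0
      toℕ-0F = Fin.toℕ-fromℕ< _

      exact : ∀ {m} (v : Vec ℤ m) → Vec.map rem v ≡ replicate _ 0F → v ≡ Vec.map (ℤ._* + ℓ) (Vec.map quot v)
      exact [] _ = refl
      exact (z ∷ v) eq = cong₂ _∷_ (trans (rem-quot z) (trans (cong (λ r → + toℕ r ℤ.+ quot z ℤ.* + ℓ) (cong Vec.head eq)) (trans (cong (λ r → + r ℤ.+ quot z ℤ.* + ℓ) toℕ-0F) (ℤ.+-identityˡ _)))) (exact v (cong Vec.tail eq))

      size-* : ∀ {m} (v : Vec ℤ m) → size (Vec.map (ℤ._* + ℓ) v) ≡ size v ℕ.* ℓ
      size-* [] = refl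
      size-* (z ∷ v) = trans (cong₂ ℕ._+_ (ℤ.abs-* z (+ ℓ)) (size-* v)) (sym (ℕ.*-distribʳ-+ ℓ ∣ z ∣ (size v)))

      size≡0 : ∀ {m} (v : Vec ℤ m) → size v ≡ 0 → v ≡ replicate _ (+ 0)
      size≡0 [] _ = refl
      size≡0 (z ∷ v) eq = cong₂ _∷_ (ℤ.∣i∣≡0⇒i≡0 (ℕ.m+n≡0⇒m≡0 ∣ z ∣ eq)) (size≡0 v (ℕ.m+n≡0⇒n≡0 ∣ z ∣ eq))

      -- Since ℓ ≥ 2, dividing by ℓ strictly lowers a positive size.
      shrink : ∀ s N → s ℕ.* ℓ ≤ suc N → s ≤ N
      shrink zero    N _ = z≤n
      shrink (suc s) N h = ℕ.≤-pred (ℕ.≤-trans (ℕ.≤-trans (s≤s (s≤s (ℕ.m≤m+n s _))) (ℕ.≤-reflexive (cong suc (sym (ℕ.+-suc s s))))) (ℕ.≤-trans (ℕ.≤-trans (ℕ.≤-reflexive (sym (trans (ℕ.*-comm (suc s) 2) (cong (λ t → suc s ℕ.+ t) (ℕ.+-identityʳ (suc s)))))) (ℕ.*-monoʳ-≤ (suc s) 1<ℓ)) h))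

      map-0 : ∀ m → Vec.map (ℤ._* + ℓ) (replicate m (+ 0)) ≡ replicate m (+ 0)
      map-0 zero = refl
      map-0 (suc m) = cong (+ 0 ∷_) (map-0 m)

      -- A zero must vanish modulo ℓ, so it is ℓ times a vector which is again a zero and has
      -- smaller size; N bounds the size and drives the induction.
      descend : ∀ N v → size v ≤ N → ℤ-Solver.⟦ e ⟧ (c ++ v) ≡ + 0 → v ≡ replicate _ (+ 0)
      descend zero v h _ = size≡0 v (ℕ.n≤0⇒n≡0 h)
      descend (suc N) v h e≡0 with good (Vec.map rem v)
      ... | inj₂ ¬d = contradiction (subst (+ ℓ ∣_) (trans (cong (λ t → ℤ-Solver.⟦ e ⟧ (c ++ Vec.map fromFin (Vec.map rem v)) ℤ.- t) e≡0) (ℤ.+-identityʳ _)) (congruence e _ _ (close c v))) ¬d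
      ... | inj₁ r≡0 = trans v≡ (trans (cong (Vec.map (ℤ._* + ℓ)) w≡0) (map-0 _))
        where
        w = Vec.map quot v
        v≡ : v ≡ Vec.map (ℤ._* + ℓ) w
        v≡ = exact v r≡0
        w≡0 : w ≡ replicate _ (+ 0)
        w≡0 = descend N w (shrink (size w) N (subst (_≤ suc N) (trans (cong size v≡) (size-* w)) h)) (homogeneous w (trans (cong (λ t → ℤ-Solver.⟦ e ⟧ (c ++ t)) (sym v≡)) e≡0))

    anisotropic : ∀ v → ℤ-Solver.⟦ e ⟧ (c ++ v) ≡ + 0 → v ≡ replicate _ (+ 0)
    anisotropic v = descend (size v) v ℕ.≤-refl

module ℤLaws = ModQuarticLaws ℤ-ring

normℤ : ℤ → ℤ → ℤ → ℤ → Quad ℤ → ℤ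
normℤ = ℤLaws.N.normQ

norm-expr : Expr 8
norm-expr = QuarticNorm.normQ _:+_ _:-_ _:*_ :0 (var (# 0)) (var (# 1)) (var (# 2)) (var (# 3)) (quad (var (# 4)) (var (# 5)) (var (# 6)) (var (# 7)))

integralQuartic : ℤ → ℤ → ℤ → ℤ → Quartic
integralQuartic c₀ c₁ c₂ c₃ = quartic (fromℤ c₀) (fromℤ c₁) (fromℤ c₂) (fromℤ c₃)

*≡0ˡ : ∀ i j → ¬ j ≡ + 0 → i ℤ.* j ≡ + 0 → i ≡ + 0
*≡0ˡ i j j≢0 e = [ (λ i≡0 → i≡0) , (λ j≡0 → contradiction j≡0 j≢0) ]′ (ℤ.i*j≡0⇒i≡0∨j≡0 i e)

*≡0ʳ : ∀ i j → ¬ i ≡ + 0 → i ℤ.* j ≡ + 0 → j ≡ + 0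
*≡0ʳ i j i≢0 e = *≡0ˡ j i i≢0 (trans (ℤ.*-comm j i) e)

ℤ-*≢0 : ∀ {i j} → ¬ i ≡ + 0 → ¬ j ≡ + 0 → ¬ i ℤ.* j ≡ + 0
ℤ-*≢0 {i} {j} i≢0 j≢0 e = i≢0 (*≡0ˡ i j j≢0 e)

module _ (c₀ c₁ c₂ c₃ : ℤ) where
  private f = integralQuartic c₀ c₁ c₂ c₃

  fromℤ-norm : ∀ a b c d → fromℤ (normℤ c₀ c₁ c₂ c₃ (quad a b c d)) ≡ KRing.normK f ⟨ fromℤ a , fromℤ b , fromℤ c , fromℤ d ⟩
  fromℤ-norm a b c d = fromℤ-⟦⟧ norm-expr (c₀ ∷ c₁ ∷ c₂ ∷ c₃ ∷ a ∷ b ∷ c ∷ d ∷ [])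

  -- The norm is a form of degree 4: scaling by the product D of the four denominators makes the
  -- coordinates integral and multiplies the norm by D⁴. The factor `a'` is the product of the other
  -- three denominators.
  clear-denominators : (∀ a b c d → normℤ c₀ c₁ c₂ c₃ (quad a b c d) ≡ + 0 → a ≡ + 0 × b ≡ + 0 × c ≡ + 0 × d ≡ + 0) → KRing.Anisotropic f
  clear-denominators h ⟨ a , b , c , d ⟩ e =
    let a≡ , b≡ , c≡ , d≡ = h (↥ a ℤ.* a') (↥ b ℤ.* b') (↥ c ℤ.* c') (↥ d ℤ.* d') (fromℤ-injective (begin
          fromℤ (normℤ c₀ c₁ c₂ c₃ (quad (↥ a ℤ.* a') (↥ b ℤ.* b') (↥ c ℤ.* c') (↥ d ℤ.* d'))) ≡⟨ fromℤ-norm (↥ a ℤ.* a') (↥ b ℤ.* b') (↥ c ℤ.* c') (↥ d ℤ.* d') ⟩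
          N (quad (fromℤ (↥ a ℤ.* a')) (fromℤ (↥ b ℤ.* b')) (fromℤ (↥ c ℤ.* c')) (fromℤ (↥ d ℤ.* d')))
            ≡⟨ cong N (cong₄ quad (clear a a' D refl) (clear b b' D (ℤ-Solver.solve 4 (λ a b c d → a :* (b :* (c :* d)) := b :* (a :* (c :* d))) refl (↧ a) (↧ b) (↧ c) (↧ d)))
               (clear c c' D (ℤ-Solver.solve 4 (λ a b c d → a :* (b :* (c :* d)) := c :* (a :* (b :* d))) refl (↧ a) (↧ b) (↧ c) (↧ d)))
               (clear d d' D (ℤ-Solver.solve 4 (λ a b c d → a :* (b :* (c :* d)) := d :* (a :* (b :* c))) refl (↧ a) (↧ b) (↧ c) (↧ d)))) ⟩
          N (quad (a ℚ.* fromℤ D) (b ℚ.* fromℤ D) (c ℚ.* fromℤ D) (d ℚ.* fromℤ D)) ≡⟨ ℚLaws.normQ-scale (fromℤ c₀) (fromℤ c₁) (fromℤ c₂) (fromℤ c₃) (fromℤ D) a b c d ⟩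
          fromℤ D ℚ.* fromℤ D ℚ.* fromℤ D ℚ.* fromℤ D ℚ.* N (quad a b c d) ≡⟨ cong (λ t → fromℤ D ℚ.* fromℤ D ℚ.* fromℤ D ℚ.* fromℤ D ℚ.* t) e ⟩
          fromℤ D ℚ.* fromℤ D ℚ.* fromℤ D ℚ.* fromℤ D ℚ.* 0ℚ ≡⟨ ℚ.*-zeroʳ (fromℤ D ℚ.* fromℤ D ℚ.* fromℤ D ℚ.* fromℤ D) ⟩
          0ℚ ∎))
    in cong₄ ⟨_,_,_,_⟩ (vanish a a' (ℤ-*≢0 (↧≢0 b) (ℤ-*≢0 (↧≢0 c) (↧≢0 d))) a≡) (vanish b b' (ℤ-*≢0 (↧≢0 a) (ℤ-*≢0 (↧≢0 c) (↧≢0 d))) b≡)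
             (vanish c c' (ℤ-*≢0 (↧≢0 a) (ℤ-*≢0 (↧≢0 b) (↧≢0 d))) c≡) (vanish d d' (ℤ-*≢0 (↧≢0 a) (ℤ-*≢0 (↧≢0 b) (↧≢0 c))) d≡)
    where
    open ≡-Reasoning
    N = ℚLaws.N.normQ (fromℤ c₀) (fromℤ c₁) (fromℤ c₂) (fromℤ c₃)
    a' = ↧ b ℤ.* (↧ c ℤ.* ↧ d)
    b' = ↧ a ℤ.* (↧ c ℤ.* ↧ d)
    c' = ↧ a ℤ.* (↧ b ℤ.* ↧ d)
    d' = ↧ a ℤ.* (↧ b ℤ.* ↧ c)
    D = ↧ a ℤ.* a'
    ↧≢0 : ∀ q → ¬ ↧ q ≡ + 0
    ↧≢0 q ()
    clear : ∀ q m D → D ≡ ↧ q ℤ.* m → fromℤ (↥ q ℤ.* m) ≡ q ℚ.* fromℤ D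
    clear q m D refl = begin
      fromℤ (↥ q ℤ.* m)                  ≡⟨ fromℤ-* (↥ q) m ⟩
      fromℤ (↥ q) ℚ.* fromℤ m            ≡⟨ cong (ℚ._* fromℤ m) (sym (*-denominator q)) ⟩
      fromℤ (↧ q) ℚ.* q ℚ.* fromℤ m      ≡⟨ cong (ℚ._* fromℤ m) (ℚ.*-comm (fromℤ (↧ q)) q) ⟩
      q ℚ.* fromℤ (↧ q) ℚ.* fromℤ m      ≡⟨ ℚ.*-assoc q (fromℤ (↧ q)) (fromℤ m) ⟩
      q ℚ.* (fromℤ (↧ q) ℚ.* fromℤ m)    ≡⟨ cong (q ℚ.*_) (sym (fromℤ-* (↧ q) m)) ⟩
      q ℚ.* fromℤ (↧ q ℤ.* m) ∎
    vanish : ∀ q m → ¬ m ≡ + 0 → ↥ q ℤ.* m ≡ + 0 → q ≡ 0ℚ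
    vanish q m m≢0 e = ℚ.↥p≡0⇒p≡0 q (*≡0ˡ (↥ q) m m≢0 e)

  open Descent 3 (s≤s (s≤s z≤n)) using (good?; anisotropic)

  -- The evidence is a search through the 81 residue vectors modulo 3. It succeeds exactly when f
  -- remains irreducible modulo 3.
  inert₃ : True (allVec? 4 (good? {4} norm-expr (c₀ ∷ c₁ ∷ c₂ ∷ c₃ ∷ []))) → KRing.Anisotropic f
  inert₃ t = clear-denominators λ a b c d e → split (anisotropic {4} {4} norm-expr (c₀ ∷ c₁ ∷ c₂ ∷ c₃ ∷ []) homogeneous (toWitness t) (a ∷ b ∷ c ∷ d ∷ []) e)
    where
    split : ∀ {a b c d : ℤ} → a ∷ b ∷ c ∷ d ∷ [] ≡ replicate 4 (+ 0) → a ≡ + 0 × b ≡ + 0 × c ≡ + 0 × d ≡ + 0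
    split refl = refl , refl , refl , refl
    homogeneous : ∀ v → ℤ-Solver.⟦ norm-expr ⟧ (c₀ ∷ c₁ ∷ c₂ ∷ c₃ ∷ Vec.map (ℤ._* + 3) v) ≡ + 0 → ℤ-Solver.⟦ norm-expr ⟧ (c₀ ∷ c₁ ∷ c₂ ∷ c₃ ∷ v) ≡ + 0
    homogeneous (a ∷ b ∷ c ∷ d ∷ []) e = *≡0ʳ (+ 3 ℤ.* + 3 ℤ.* + 3 ℤ.* + 3) (normℤ c₀ c₁ c₂ c₃ (quad a b c d)) (λ ()) (trans (sym (ℤLaws.normQ-scale c₀ c₁ c₂ c₃ (+ 3) a b c d)) e)

square : ∀ z → z ℤ.* z ≡ + (∣ z ∣ ℕ.* ∣ z ∣)
square (+ n)    = sym (ℤ.pos-* n n)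
square -[1+ n ] = refl

positive-definite : ∀ {k₁ k₂ k₃ k₄ w x y z} →
  + suc k₁ ℤ.* (w ℤ.* w) ℤ.+ + suc k₂ ℤ.* (x ℤ.* x) ℤ.+ + suc k₃ ℤ.* (y ℤ.* y) ℤ.+ + suc k₄ ℤ.* (z ℤ.* z) ≡ + 0 →
  w ≡ + 0 × x ≡ + 0 × y ≡ + 0 × z ≡ + 0
positive-definite {k₁} {k₂} {k₃} {k₄} {w} {x} {y} {z} e =
  zero-term k₁ w (ℕ.m+n≡0⇒m≡0 _ (ℕ.m+n≡0⇒m≡0 _ (ℕ.m+n≡0⇒m≡0 _ e'))) ,
  zero-term k₂ x (ℕ.m+n≡0⇒n≡0 (term k₁ w) (ℕ.m+n≡0⇒m≡0 _ (ℕ.m+n≡0⇒m≡0 _ e'))) ,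
  zero-term k₃ y (ℕ.m+n≡0⇒n≡0 (term k₁ w ℕ.+ term k₂ x) (ℕ.m+n≡0⇒m≡0 _ e')) ,
  zero-term k₄ z (ℕ.m+n≡0⇒n≡0 (term k₁ w ℕ.+ term k₂ x ℕ.+ term k₃ y) e')
  where
  term : ℕ → ℤ → ℕ
  term k z = suc k ℕ.* (∣ z ∣ ℕ.* ∣ z ∣)
  term≡ : ∀ k z → + suc k ℤ.* (z ℤ.* z) ≡ + term k z
  term≡ k z = trans (cong (+ suc k ℤ.*_) (square z)) (sym (ℤ.pos-* (suc k) _))
  e' : term k₁ w ℕ.+ term k₂ x ℕ.+ term k₃ y ℕ.+ term k₄ z ≡ 0
  e' = ℤ.+-injective (trans (sym (cong₂ ℤ._+_ (cong₂ ℤ._+_ (cong₂ ℤ._+_ (term≡ k₁ w) (term≡ k₂ x)) (term≡ k₃ y)) (term≡ k₄ z))) e)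
  zero-term : ∀ k z → term k z ≡ 0 → z ≡ + 0
  zero-term k z e with ℕ.m*n≡0⇒m≡0∨n≡0 (suc k) e
  ... | inj₂ e' = ℤ.∣i∣≡0⇒i≡0 ([ (λ p → p) , (λ p → p) ]′ (ℕ.m*n≡0⇒m≡0∨n≡0 ∣ z ∣ e'))

binary-expr : Expr 3
binary-expr = var (# 1) :* var (# 1) :- var (# 0) :* (var (# 2) :* var (# 2))

-- For f = x⁴ + c₂x² + c₀ put s = θ², a root of s² + c₂s + c₀, whose discriminant is D. The
-- norm of u + θv to ℚ(s) is u² − sv². Since s is totally negative its trace is a positive
-- definite form, and the norm itself can only vanish if D is a square.
module Biquadratic (k₀ k₂ k : ℕ) (D≡ : suc k₂ ℕ.* suc k₂ ≡ suc k ℕ.+ 4 ℕ.* suc k₀) (ℓ : ℕ) (1<ℓ : 1 < ℓ) where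
  open Descent ℓ 1<ℓ
  private
    c₀ = + suc k₀
    c₂ = + suc k₂
    D = + suc k

    D≡c : c₂ ℤ.* c₂ ℤ.- + 4 ℤ.* c₀ ≡ D
    D≡c = trans (cong₂ (λ s t → s ℤ.- t) (trans (sym (ℤ.pos-* (suc k₂) (suc k₂))) (trans (cong +_ D≡) (ℤ.pos-+ (suc k) (4 ℕ.* suc k₀)))) (sym (ℤ.pos-* 4 (suc k₀))))
      (ℤ-Solver.solve 2 (λ x y → x :+ y :- y := x) refl D (+ (4 ℕ.* suc k₀)))

  biquadratic : True (allVec? 2 (good? {1} binary-expr (D ∷ []))) → KRing.Anisotropic (integralQuartic c₀ (+ 0) c₂ (+ 0))
  biquadratic t = clear-denominators c₀ (+ 0) c₂ (+ 0) λ a b c d e →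
    -- p + qθ² is the relative norm and x its trace to ℚ. A vanishing norm means x² - Dq² = 0, and
    -- the test modulo ℓ then forces x = 0.
    let p = a ℤ.* a ℤ.- c₀ ℤ.* c ℤ.* c ℤ.+ c₀ ℤ.* (+ 2 ℤ.* b ℤ.* d ℤ.- c₂ ℤ.* d ℤ.* d)
        q = + 2 ℤ.* a ℤ.* c ℤ.- c₂ ℤ.* c ℤ.* c ℤ.- (b ℤ.* b ℤ.- c₀ ℤ.* d ℤ.* d) ℤ.+ c₂ ℤ.* (+ 2 ℤ.* b ℤ.* d ℤ.- c₂ ℤ.* d ℤ.* d)
        x = + 2 ℤ.* p ℤ.- c₂ ℤ.* q
        x≡0 = cong Vec.head (anisotropic {1} {2} binary-expr (D ∷ []) homogeneous (toWitness t) (x ∷ q ∷ [])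
                (trans (cong (λ D → x ℤ.* x ℤ.- D ℤ.* (q ℤ.* q)) (sym D≡c))
                (trans (ℤLaws.normQ-biquadratic c₀ c₂ a b c d) (cong (λ n → + 4 ℤ.* n) e))))
        -- Diagonalising 2c₂x yields the coefficients c₂, c₂D, 2 and 2c₀D; the implicit numbers are
        -- their predecessors.
        w≡0 , c≡0 , y≡0 , d≡0 = positive-definite {k₂} {k ℕ.+ k₂ ℕ.* suc k} {1} {k ℕ.+ (k₀ ℕ.+ suc k₀) ℕ.* suc k}
              {+ 2 ℤ.* a ℤ.- c₂ ℤ.* c} {c} {c₂ ℤ.* b ℤ.- (c₂ ℤ.* c₂ ℤ.- + 2 ℤ.* c₀) ℤ.* d} {d}
                (trans (trans (cong₂ (λ s t → c₂ ℤ.* ((+ 2 ℤ.* a ℤ.- c₂ ℤ.* c) ℤ.* (+ 2 ℤ.* a ℤ.- c₂ ℤ.* c)) ℤ.+ s ℤ.* (c ℤ.* c) ℤ.+ + 2 ℤ.* ((c₂ ℤ.* b ℤ.- (c₂ ℤ.* c₂ ℤ.- + 2 ℤ.* c₀) ℤ.* d) ℤ.* (c₂ ℤ.* b ℤ.- (c₂ ℤ.* c₂ ℤ.- + 2 ℤ.* c₀) ℤ.* d)) ℤ.+ t ℤ.* (d ℤ.* d))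
                      (trans (ℤ.pos-* (suc k₂) (suc k)) (cong (c₂ ℤ.*_) (sym D≡c)))
                      (trans (ℤ.pos-* (suc k₀ ℕ.+ suc k₀) (suc k)) (cong₂ ℤ._*_ (ℤ.pos-+ (suc k₀) (suc k₀)) (sym D≡c))))
                  (trace c₀ c₂ a b c d)) (trans (cong (λ x → + 2 ℤ.* c₂ ℤ.* x) x≡0) (ℤ.*-zeroʳ (+ 2 ℤ.* c₂))))
    in *≡0ʳ (+ 2) a (λ ()) (trans (trans (ℤ-Solver.solve 3 (λ a c₂ c → con (+ 2) :* a := con (+ 2) :* a :- c₂ :* c :+ c₂ :* c) refl a c₂ c) (cong₂ (λ w c → w ℤ.+ c₂ ℤ.* c) w≡0 c≡0)) (trans (ℤ.+-identityˡ _) (ℤ.*-zeroʳ c₂))) ,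
       *≡0ʳ c₂ b (λ ()) (trans (trans (ℤ-Solver.solve 4 (λ b c₂ m d → c₂ :* b := c₂ :* b :- m :* d :+ m :* d) refl b c₂ (c₂ ℤ.* c₂ ℤ.- + 2 ℤ.* c₀) d) (cong₂ (λ y d → y ℤ.+ (c₂ ℤ.* c₂ ℤ.- + 2 ℤ.* c₀) ℤ.* d) y≡0 d≡0)) (trans (ℤ.+-identityˡ _) (ℤ.*-zeroʳ (c₂ ℤ.* c₂ ℤ.- + 2 ℤ.* c₀)))) ,
       c≡0 , d≡0
    where
    homogeneous : ∀ v → ℤ-Solver.⟦ binary-expr ⟧ (D ∷ Vec.map (ℤ._* + ℓ) v) ≡ + 0 → ℤ-Solver.⟦ binary-expr ⟧ (D ∷ v) ≡ + 0
    homogeneous (x ∷ y ∷ []) e = *≡0ʳ (+ ℓ ℤ.* + ℓ) _ (ℤ-*≢0 ℓ≢0' ℓ≢0') (trans (ℤ-Solver.solve 4 (λ l D x y → l :* l :* (x :* x :- D :* (y :* y)) := (x :* l) :* (x :* l) :- D :* ((y :* l) :* (y :* l))) refl (+ ℓ) D x y) e)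
      where
      ℓ≢0' : ¬ + ℓ ≡ + 0
      ℓ≢0' e = ℕ.<-irrefl (sym (ℤ.+-injective e)) (ℕ.<-trans (s≤s z≤n) 1<ℓ)
    trace : ∀ c₀ c₂ a b c d → _ ≡ _
    trace = ℤ-Solver.solve 6 (λ c₀ c₂ a b c d →
      let 2# = con (+ 2)
          D = c₂ :* c₂ :- con (+ 4) :* c₀
          p = a :* a :- c₀ :* c :* c :+ c₀ :* (2# :* b :* d :- c₂ :* d :* d)
          q = 2# :* a :* c :- c₂ :* c :* c :- (b :* b :- c₀ :* d :* d) :+ c₂ :* (2# :* b :* d :- c₂ :* d :* d)
          w = 2# :* a :- c₂ :* c
          y = c₂ :* b :- (c₂ :* c₂ :- 2# :* c₀) :* d
      in c₂ :* (w :* w) :+ c₂ :* D :* (c :* c) :+ 2# :* (y :* y) :+ (c₀ :+ c₀) :* D :* (d :* d) := 2# :* c₂ :* (2# :* p :- c₂ :* q)) refl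

-- Finitely generated subgroups of abelian groups

Bézout-mod : ∀ p a → Prime p → ¬ + p ∣ℤ a → Σ ℤ λ u → Σ ℤ λ v → u ℤ.* a ≡ + 1 ℤ.+ v ℤ.* + p
Bézout-mod p a pr p∤a = signed a (unsigned (coprime-Bézout coprime))
  where
  coprime : Coprime ∣ a ∣ p
  coprime {d} (d∣a , d∣p) with prime⇒irreducible pr d∣p
  ... | inj₁ d≡1  = d≡1
  ... | inj₂ refl = contradiction d∣a p∤a
  unsigned : Bézout.Identity.Identity 1 ∣ a ∣ p → Σ ℤ λ u → Σ ℤ λ v → u ℤ.* + ∣ a ∣ ≡ + 1 ℤ.+ v ℤ.* + p
  unsigned (Bézout.Identity.+- x y e) = + x , + y , (begin
    + x ℤ.* + ∣ a ∣       ≡⟨ sym (ℤ.pos-* x ∣ a ∣) ⟩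
    + (x ℕ.* ∣ a ∣)       ≡⟨ cong +_ (sym e) ⟩
    + 1 ℤ.+ + (y ℕ.* p)   ≡⟨ cong (λ t → + 1 ℤ.+ t) (ℤ.pos-* y p) ⟩
    + 1 ℤ.+ + y ℤ.* + p   ∎)
    where open ≡-Reasoning
  unsigned (Bézout.Identity.-+ x y e) = + 0 ℤ.- + x , + 0 ℤ.- + y , (begin
    (+ 0 ℤ.- + x) ℤ.* + ∣ a ∣           ≡⟨ ℤ-Solver.solve 2 (λ x a → (:0 :- x) :* a := :1 :- (:1 :+ x :* a)) refl (+ x) (+ ∣ a ∣) ⟩
    + 1 ℤ.- (+ 1 ℤ.+ + x ℤ.* + ∣ a ∣)   ≡⟨ cong (λ t → + 1 ℤ.- t) (trans (cong (λ t → + 1 ℤ.+ t) (sym (ℤ.pos-* x ∣ a ∣))) (trans (cong +_ e) (ℤ.pos-* y p))) ⟩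
    + 1 ℤ.- + y ℤ.* + p                 ≡⟨ ℤ-Solver.solve 2 (λ y p → :1 :- y :* p := :1 :+ (:0 :- y) :* p) refl (+ y) (+ p) ⟩
    + 1 ℤ.+ (+ 0 ℤ.- + y) ℤ.* + p       ∎)
    where open ≡-Reasoning
  signed : ∀ a → (Σ ℤ λ u → Σ ℤ λ v → u ℤ.* + ∣ a ∣ ≡ + 1 ℤ.+ v ℤ.* + p) → Σ ℤ λ u → Σ ℤ λ v → u ℤ.* a ≡ + 1 ℤ.+ v ℤ.* + p
  signed (+ n)    w           = w
  signed -[1+ n ] (u , v , e) = ℤ.- u , v , trans (trans (sym (ℤ.neg-distribˡ-* u -[1+ n ])) (ℤ.neg-distribʳ-* u -[1+ n ])) e

module Subgroups {A : Set} {_∙_ : A → A → A} {ε : A} {_⁻¹ : A → A} (G : IsAbelianGroup _≡_ _∙_ ε _⁻¹) where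
  open IsAbelianGroup G using (assoc; comm; identityˡ; identityʳ; inverseʳ)
  open Multiples G public
  open Algebra.Properties.AbelianGroup abelianGroup public using (inverseˡ-unique)
  open Algebra.Properties.AbelianGroup abelianGroup using (⁻¹-involutive; ∙-cancelʳ)
  open ≡-Reasoning

  ·-identityˡ : ∀ x → + 1 · x ≡ x
  ·-identityˡ x = identityʳ x

  ·-sum : ∀ {m n x y z w} → m · x ≡ y → n · x ≡ z → y ∙ z ≡ w → (m ℤ.+ n) · x ≡ w
  ·-sum {m} {n} {x} refl refl e = trans (·-homo-+ m n x) e

  ·-comm : ∀ m n x → m · (n · x) ≡ n · (m · x)
  ·-comm m n x = trans (sym (·-assoc m n x)) (trans (cong (_· x) (ℤ.*-comm m n)) (·-assoc n m x))

  multiple-ε : ∀ m n x → n · x ≡ ε → (m ℤ.* n) · x ≡ ε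
  multiple-ε m n x e = trans (·-assoc m n x) (trans (cong (m ·_) e) (·-zeroʳ m))

  ∣⇒ε : ∀ n m x → + n · x ≡ ε → + n ∣ℤ m → m · x ≡ ε
  ∣⇒ε n m x e n∣m with ℤ∣.∣ᵤ⇒∣ {+ n} {m} n∣m
  ... | ℤ∣.divides q refl = multiple-ε q (+ n) x e

  reduce-mod : ∀ N .{{_ : ℕ.NonZero N}} m x → + N · x ≡ ε → m · x ≡ + (m %ℕ N) · x
  reduce-mod N m x e = begin
    m · x                                          ≡⟨ cong (_· x) (a≡a%ℕn+[a/ℕn]*n m N) ⟩
    (+ (m %ℕ N) ℤ.+ (m /ℕ N) ℤ.* + N) · x          ≡⟨ ·-homo-+ (+ (m %ℕ N)) ((m /ℕ N) ℤ.* + N) x ⟩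
    (+ (m %ℕ N) · x) ∙ (((m /ℕ N) ℤ.* + N) · x)    ≡⟨ cong₂ _∙_ refl (multiple-ε (m /ℕ N) (+ N) x e) ⟩
    (+ (m %ℕ N) · x) ∙ ε                           ≡⟨ identityʳ _ ⟩
    + (m %ℕ N) · x                                 ∎

  divide : ∀ p a → Prime p → ¬ + p ∣ℤ a → ∀ x → + p · x ≡ ε → Σ ℤ λ u → u · (a · x) ≡ x
  divide p a pr p∤a x e with Bézout-mod p a pr p∤a
  ... | u , v , ua≡ = u , (begin
    u · (a · x)                         ≡⟨ sym (·-assoc u a x) ⟩
    (u ℤ.* a) · x                       ≡⟨ cong (_· x) ua≡ ⟩
    (+ 1 ℤ.+ v ℤ.* + p) · x             ≡⟨ ·-homo-+ (+ 1) (v ℤ.* + p) x ⟩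
    (+ 1 · x) ∙ ((v ℤ.* + p) · x)       ≡⟨ cong₂ _∙_ (·-identityˡ x) (multiple-ε v (+ p) x e) ⟩
    x ∙ ε                               ≡⟨ identityʳ x ⟩
    x ∎)

  order-prime : ∀ {p} → Prime p → ∀ x → + p · x ≡ ε → ¬ x ≡ ε → ∀ a → a · x ≡ ε → + p ∣ℤ a
  order-prime {p} pr x e x≢ε a ax≡ε with p ℕ.∣? ∣ a ∣
  ... | yes p∣a = p∣a
  ... | no p∤a  = let u , ux≡ = divide p a pr p∤a x e in contradiction (trans (sym ux≡) (trans (cong (u ·_) ax≡ε) (·-zeroʳ u))) x≢ε

  -- If p did not divide a, then a would be invertible modulo p and x a multiple of y. With p
  -- dividing a, the relation concerns y alone.
  independent : ∀ {p} → Prime p → ∀ x y → + p · x ≡ ε → + p · y ≡ ε → ¬ y ≡ ε → (∀ k → k < p → ¬ x ≡ + k · y) →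
                ∀ a b → (a · x) ∙ (b · y) ≡ ε → + p ∣ℤ a × + p ∣ℤ b
  independent {p} pr x y px≡ε py≡ε y≢ε x∉⟨y⟩ a b e with p ℕ.∣? ∣ a ∣
  ... | yes p∣a = p∣a , order-prime pr y py≡ε y≢ε b (trans (sym (identityˡ _)) (trans (cong (_∙ (b · y)) (sym (∣⇒ε p a x px≡ε p∣a))) e))
  ... | no p∤a = contradiction x≡ (x∉⟨y⟩ _ (n%ℕd<d (u ℤ.* (ℤ.- b)) p))
    where
    instance _ = prime⇒nonZero pr
    u = proj₁ (divide p a pr p∤a x px≡ε)
    x≡ : x ≡ + ((u ℤ.* (ℤ.- b)) %ℕ p) · y
    x≡ = begin
      x                        ≡⟨ sym (proj₂ (divide p a pr p∤a x px≡ε)) ⟩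
      u · (a · x)              ≡⟨ cong (u ·_) (inverseˡ-unique (a · x) (b · y) e) ⟩
      u · ((b · y) ⁻¹)         ≡⟨ cong (u ·_) (sym (·-homo-neg b y)) ⟩
      u · ((ℤ.- b) · y)        ≡⟨ sym (·-assoc u (ℤ.- b) y) ⟩
      (u ℤ.* (ℤ.- b)) · y      ≡⟨ reduce-mod p (u ℤ.* (ℤ.- b)) y py≡ε ⟩
      + ((u ℤ.* (ℤ.- b)) %ℕ p) · y ∎

  quotient : ∀ {p a} → + p ∣ℤ a → Σ ℤ λ q → a ≡ q ℤ.* + p
  quotient {p} {a} p∣a with ℤ∣.∣ᵤ⇒∣ {+ p} {a} p∣a
  ... | ℤ∣.divides q e = q , e

  *-∣ : ∀ {p n} q {a} → a ≡ q ℤ.* + p → + n ∣ℤ q → + (p ℕ.* n) ∣ℤ a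
  *-∣ {p} {n} q refl n∣q = subst (p ℕ.* n ℕ.∣_) (trans (ℕ.*-comm p ∣ q ∣) (sym (ℤ.abs-* q (+ p)))) (ℕ.*-monoʳ-∣ p n∣q)

  scale-relation : ∀ p a b x y → (a · x) ∙ (b · y) ≡ ε → (a · (p · x)) ∙ (b · (p · y)) ≡ ε
  scale-relation p a b x y e = begin
    (a · (p · x)) ∙ (b · (p · y))  ≡⟨ cong₂ _∙_ (·-comm a p x) (·-comm b p y) ⟩
    (p · (a · x)) ∙ (p · (b · y))  ≡⟨ sym (·-distrib-∙ p (a · x) (b · y)) ⟩
    p · ((a · x) ∙ (b · y))        ≡⟨ cong (p ·_) e ⟩
    p · ε                          ≡⟨ ·-zeroʳ p ⟩
    ε ∎

  -- Multiplying by p kills x and shows that p divides b. The relation then becomes one between x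
  -- and p · y, both of order p.
  independent-p-p² : ∀ {p} → Prime p → ∀ x y → + p · x ≡ ε → + p · (+ p · y) ≡ ε → ¬ + p · y ≡ ε → (∀ k → k < p → ¬ x ≡ + k · (+ p · y)) →
                     ∀ a b → (a · x) ∙ (b · y) ≡ ε → + p ∣ℤ a × + (p ℕ.* p) ∣ℤ b
  independent-p-p² {p} pr x y px≡ε ppy≡ε py≢ε x∉ a b e =
    let p∣b = order-prime pr (+ p · y) ppy≡ε py≢ε b (begin
          b · (+ p · y)                     ≡⟨ sym (identityˡ _) ⟩
          ε ∙ (b · (+ p · y))               ≡⟨ cong (_∙ (b · (+ p · y))) (sym (trans (cong (a ·_) px≡ε) (·-zeroʳ a))) ⟩
          (a · (+ p · x)) ∙ (b · (+ p · y)) ≡⟨ scale-relation (+ p) a b x y e ⟩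
          ε ∎)
        q , b≡ = quotient {p} {b} p∣b
        p∣a , p∣q = independent pr x (+ p · y) px≡ε ppy≡ε py≢ε x∉ a q (trans (cong₂ _∙_ refl (trans (sym (·-assoc q (+ p) y)) (cong (_· y) (sym b≡)))) e)
    in p∣a , *-∣ {p} {p} q b≡ p∣q

  -- The previous lemma applies to p · x and p · y twice: to the relation multiplied by p, and,
  -- after a factor p has been taken out of a and b, to the relation itself.
  independent-p²-p³ : ∀ {p} → Prime p → ∀ x y → + p · (+ p · x) ≡ ε → + p · (+ p · (+ p · y)) ≡ ε → ¬ + p · (+ p · y) ≡ ε →
                      (∀ k → k < p → ¬ + p · x ≡ + k · (+ p · (+ p · y))) →
                      ∀ a b → (a · x) ∙ (b · y) ≡ ε → + (p ℕ.* p) ∣ℤ a × + (p ℕ.* (p ℕ.* p)) ∣ℤ b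
  independent-p²-p³ {p} pr x y ppx≡ε pppy≡ε ppy≢ε px∉ a b e =
    let p∣a , pp∣b = socle a b (scale-relation (+ p) a b x y e)
        q , a≡ = quotient {p} {a} p∣a
        r , b≡ = quotient {p} {b} (ℕ.∣-trans (ℕ.m∣m*n p) pp∣b)
        p∣q , pp∣r = socle q r (trans (cong₂ _∙_ (shift x q a≡) (shift y r b≡)) e)
    in *-∣ {p} {p} q a≡ p∣q , *-∣ {p} {p ℕ.* p} r b≡ pp∣r
    where
    socle = independent-p-p² pr (+ p · x) (+ p · y) ppx≡ε pppy≡ε ppy≢ε px∉
    shift : ∀ z q {c} → c ≡ q ℤ.* + p → q · (+ p · z) ≡ c · z
    shift z q refl = sym (·-assoc q (+ p) z)

  -- q · x has order p and p · x has order q, so a is divisible by both primes.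
  order-product : ∀ {p q} → Prime p → Prime q → ¬ q ℕ.∣ p → ∀ x → + (q ℕ.* p) · x ≡ ε → ¬ + q · x ≡ ε → ¬ + p · x ≡ ε →
                  ∀ a → a · x ≡ ε → + (q ℕ.* p) ∣ℤ a
  order-product {p} {q} pr-p pr-q q∤p x pqx≡ε qx≢ε px≢ε a ax≡ε with p∣a | q∣a
    where
    killed : ∀ m → a · (m · x) ≡ ε
    killed m = trans (·-comm a m x) (trans (cong (m ·_) ax≡ε) (·-zeroʳ m))
    p∣a : + p ∣ℤ a
    p∣a = order-prime pr-p (+ q · x) (trans (sym (·-assoc (+ p) (+ q) x)) (trans (cong (_· x) (trans (sym (ℤ.pos-* p q)) (cong +_ (ℕ.*-comm p q)))) pqx≡ε)) qx≢ε a (killed (+ q))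
    q∣a : + q ∣ℤ a
    q∣a = order-prime pr-q (+ p · x) (trans (sym (·-assoc (+ q) (+ p) x)) (trans (cong (_· x) (sym (ℤ.pos-* q p))) pqx≡ε)) px≢ε a (killed (+ p))
  ... | ℕ.divides k e | q∣a with euclidsLemma k p pr-q (subst (q ℕ.∣_) e q∣a)
  ...   | inj₁ q∣k = subst (q ℕ.* p ℕ.∣_) (sym e) (ℕ.*-monoˡ-∣ p q∣k)
  ...   | inj₂ q∣p = contradiction q∣p q∤p

  InfiniteOrder : A → Set
  InfiniteOrder x = ∀ n → n · x ≡ ε → n ≡ + 0

  -- If x had finite order N > 0, two of the first N + 1 elements 2ᵏx would coincide.
  separated⇒infinite : (Near : ℕ → A → Set) → (∀ r y → Near r y → Near (suc r) (y ∙ y)) →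
                       (∀ r s y → r < s → Near r y → ¬ Near s y) → ∀ r x → Near r x → InfiniteOrder x
  separated⇒infinite Near double distinct r x near = λ { (+ zero) _ → refl ; (+ suc n) e → ⊥-elim (finite n e) ; -[1+ n ] e → ⊥-elim (finite n (trans (sym (⁻¹-involutive _)) (trans (cong _⁻¹ e) (trans (sym (identityˡ _)) (inverseʳ ε))))) }
    where
    near-2^ : ∀ k → Near (k ℕ.+ r) (+ (2 ^ k) · x)
    near-2^ zero    = subst (Near r) (sym (·-identityˡ x)) near
    near-2^ (suc k) = subst (Near (suc k ℕ.+ r)) (sym (trans (cong (λ m → + m · x) (cong (2 ^ k ℕ.+_) (ℕ.+-identityʳ (2 ^ k)))) (·-homo-+ (+ (2 ^ k)) (+ (2 ^ k)) x))) (double _ _ (near-2^ k))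

    finite : ∀ n → + suc n · x ≡ ε → ⊥
    finite n e with Fin.pigeonhole (ℕ.n<1+n (suc n)) (λ k → fromℕ< (ℕ.m%n<n (2 ^ toℕ k) (suc n)))
    ... | i , j , i<j , fi≡fj = distinct (toℕ i ℕ.+ r) (toℕ j ℕ.+ r) (+ (2 ^ toℕ j) · x) (ℕ.+-monoˡ-< r i<j) (subst (Near _) same (near-2^ (toℕ i))) (near-2^ (toℕ j))
      where
      residues : (2 ^ toℕ i) ℕ.% suc n ≡ (2 ^ toℕ j) ℕ.% suc n
      residues = trans (sym (Fin.toℕ-fromℕ< _)) (trans (cong toℕ fi≡fj) (Fin.toℕ-fromℕ< _))
      same : + (2 ^ toℕ i) · x ≡ + (2 ^ toℕ j) · x
      same = trans (reduce-mod (suc n) (+ (2 ^ toℕ i)) x e) (trans (cong (λ m → + m · x) residues) (sym (reduce-mod (suc n) (+ (2 ^ toℕ j)) x e)))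

  combination : ∀ {k} → Vec A k → Elt k → A
  combination []     []       = ε
  combination (x ∷ xs) (n ∷ ns) = (n · x) ∙ combination xs ns

  combination-homo : ∀ {k} (xs : Vec A k) g h → combination xs (g ⊕ h) ≡ combination xs g ∙ combination xs h
  combination-homo []       []      []      = sym (identityˡ ε)
  combination-homo (x ∷ xs) (m ∷ g) (n ∷ h) = trans (cong₂ _∙_ (·-homo-+ m n x) (combination-homo xs g h)) (interchange (m · x) (n · x) (combination xs g) (combination xs h))

  Killed : ∀ {k} → Vec ℕ k → Vec A k → Set
  Killed []       []       = ⊤
  Killed (m ∷ ms) (x ∷ xs) = + m · x ≡ ε × Killed ms xs

  Divides : ∀ {k} → Vec ℕ k → Elt k → Set
  Divides []       []      = ⊤
  Divides (m ∷ ms) (n ∷ g) = + m ∣ℤ n × Divides ms g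

  sub : ∀ {k} → Elt k → Elt k → Elt k
  sub = Vec.zipWith ℤ._-_

  combination-sub : ∀ {k} (xs : Vec A k) g h → combination xs g ≡ combination xs (sub g h) ∙ combination xs h
  combination-sub xs g h = trans (cong (combination xs) (sub-⊕ g h)) (combination-homo xs (sub g h) h)
    where
    sub-⊕ : ∀ {k} (g h : Elt k) → g ≡ sub g h ⊕ h
    sub-⊕ []      []      = refl
    sub-⊕ (m ∷ g) (n ∷ h) = cong₂ _∷_ (ℤ-Solver.solve 2 (λ m n → m := m :- n :+ n) refl m n) (sub-⊕ g h)

  Divides⇒Congruent : ∀ {k} (ms : Vec ℕ k) g h → Divides ms (sub g h) → Congruent ms g h
  Divides⇒Congruent []       []      []      _       = tt
  Divides⇒Congruent (m ∷ ms) (a ∷ g) (b ∷ h) (d , ds) = d , Divides⇒Congruent ms g h ds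

  Congruent⇒Divides : ∀ {k} (ms : Vec ℕ k) g h → Congruent ms g h → Divides ms (sub g h)
  Congruent⇒Divides []       []      []      _        = tt
  Congruent⇒Divides (m ∷ ms) (a ∷ g) (b ∷ h) (d , ds) = d , Congruent⇒Divides ms g h ds

  Killed⇒ε : ∀ {k} (ms : Vec ℕ k) xs → Killed ms xs → ∀ g → Divides ms g → combination xs g ≡ ε
  Killed⇒ε []       []       _        []      _        = refl
  Killed⇒ε (m ∷ ms) (x ∷ xs) (k , ks) (n ∷ g) (d , ds) = trans (cong₂ _∙_ (∣⇒ε m n x k d) (Killed⇒ε ms xs ks g ds)) (identityˡ ε)

  -- A modulus 0 marks an infinite cyclic summand: its condition in `Killed` is trivial, while
  -- `Divides` makes the coefficient vanish.
  Free : ∀ {k} → Vec ℕ k → Vec A k → Set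
  Free ms xs = ∀ g → combination xs g ≡ ε → Divides ms g

  fibres⇒ : ∀ {k} {ms : Vec ℕ k} {xs} → Free ms xs → ∀ g h → combination xs g ≡ combination xs h → Congruent ms g h
  fibres⇒ {ms = ms} {xs} free g h e = Divides⇒Congruent ms g h (free (sub g h) (∙-cancelʳ (combination xs h) _ _ (trans (sym (combination-sub xs g h)) (trans e (sym (identityˡ _))))))

  fibres⇐ : ∀ {k} {ms : Vec ℕ k} {xs} → Killed ms xs → ∀ g h → Congruent ms g h → combination xs g ≡ combination xs h
  fibres⇐ {ms = ms} {xs} killed g h c = trans (combination-sub xs g h) (trans (cong (_∙ combination xs h) (Killed⇒ε ms xs killed (sub g h) (Congruent⇒Divides ms g h c))) (identityˡ _))

  -- Multiplication by N removes t and leaves (N n) · x = ε.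
  torsion-part : ∀ N t n x → ¬ + N ≡ + 0 → + N · t ≡ ε → InfiniteOrder x → t ∙ (n · x) ≡ ε → n ≡ + 0 × t ≡ ε
  torsion-part N t n x N≢0 Nt≡ε inf e = n≡0 , trans (sym (identityʳ t)) (trans (cong (λ m → t ∙ (m · x)) (sym n≡0)) e)
    where
    Nn≡0 : + N ℤ.* n ≡ + 0
    Nn≡0 = inf (+ N ℤ.* n) (begin
      (+ N ℤ.* n) · x            ≡⟨ ·-assoc (+ N) n x ⟩
      + N · (n · x)              ≡⟨ sym (identityˡ _) ⟩
      ε ∙ (+ N · (n · x))        ≡⟨ cong (_∙ (+ N · (n · x))) (sym Nt≡ε) ⟩
      (+ N · t) ∙ (+ N · (n · x)) ≡⟨ sym (·-distrib-∙ (+ N) t (n · x)) ⟩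
      + N · (t ∙ (n · x))        ≡⟨ cong (+ N ·_) e ⟩
      + N · ε                    ≡⟨ ·-zeroʳ (+ N) ⟩
      ε ∎)
    n≡0 : n ≡ + 0
    n≡0 with ℤ.i*j≡0⇒i≡0∨j≡0 (+ N) Nn≡0
    ... | inj₁ N≡0 = contradiction N≡0 N≢0
    ... | inj₂ n≡0 = n≡0

  free₂ : ∀ {m} t x → ¬ + m ≡ + 0 → + m · t ≡ ε → InfiniteOrder x → (∀ a → a · t ≡ ε → + m ∣ℤ a) → Free (m ∷ 0 ∷ []) (t ∷ x ∷ [])
  free₂ {m} t x m≢0 mt≡ε inf order (a ∷ n ∷ []) e
    with torsion-part m (a · t) n x m≢0 (trans (·-comm (+ m) a t) (trans (cong (a ·_) mt≡ε) (·-zeroʳ a))) inf (trans (cong₂ _∙_ refl (sym (identityʳ (n · x)))) e)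
  ... | refl , at≡ε = order a at≡ε , ℕ.∣-refl , tt

  free₃ : ∀ {m n} s t x → ¬ + n ≡ + 0 → + n · s ≡ ε → + n · t ≡ ε → InfiniteOrder x →
          (∀ a b → (a · s) ∙ (b · t) ≡ ε → + m ∣ℤ a × + n ∣ℤ b) → Free (m ∷ n ∷ 0 ∷ []) (s ∷ t ∷ x ∷ [])
  free₃ {m} {n} s t x n≢0 ns≡ε nt≡ε inf indep (a ∷ b ∷ c ∷ []) e
    with torsion-part n ((a · s) ∙ (b · t)) c x n≢0
      (trans (·-distrib-∙ (+ n) (a · s) (b · t)) (trans (cong₂ _∙_ (trans (·-comm (+ n) a s) (trans (cong (a ·_) ns≡ε) (·-zeroʳ a))) (trans (·-comm (+ n) b t) (trans (cong (b ·_) nt≡ε) (·-zeroʳ b)))) (identityˡ ε)))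
      inf (trans (trans (assoc (a · s) (b · t) (c · x)) (cong (λ w → (a · s) ∙ ((b · t) ∙ w)) (sym (identityʳ (c · x))))) e)
  ... | refl , st≡ε = let m∣a , n∣b = indep a b st≡ε in m∣a , n∣b , ℕ.∣-refl , tt

-- Duplication near the origin

-- The operations are parameters, and the literals and bᵢ enter through equations, so the
-- discriminant can be supplied in the form in which it is defined, each equation being `refl`.
module DiscriminantZero {A : Set} (_+_ _-_ _*_ : A → A → A) (neg : A → A) (0# 1# : A)
  (isCommutativeRing : IsCommutativeRing _≡_ _+_ _*_ neg 0# 1#) (sub≡ : ∀ x y → x - y ≡ x + neg y) where
  private
    ring : Ring≡
    ring = record { isCommutativeRing = isCommutativeRing ; sub≡ = sub≡ }
    open Ring≡ ring using (zeroʳ; +-identityʳ)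
    open RingSolver ring
    2# = 1# + 1#
    3# = (1# + 1#) + 1#
    4# = 2# + 2#
    9# = (4# + 4#) + 1#

  -- The discriminant is a combination of the cubic and its derivative.
  Δ-zero : ∀ a₂ a₄ a₆ x {n₂ n₄ n₈ n₉ n₂₇ b₂ b₄ b₆ b₈} →
    n₂ ≡ 2# → n₄ ≡ 4# → n₈ ≡ 4# + 4# → n₉ ≡ 9# → n₂₇ ≡ (9# + 9#) + 9# →
    b₂ ≡ (0# * 0#) + (n₄ * a₂) → b₄ ≡ (n₂ * a₄) + (0# * 0#) → b₆ ≡ (0# * 0#) + (n₄ * a₆) →
    b₈ ≡ (((((0# * 0#) * a₆) + ((n₄ * a₂) * a₆)) - ((0# * 0#) * a₄)) + ((a₂ * 0#) * 0#)) - (a₄ * a₄) →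
    Cubic.F _+_ _*_ 2# 3# a₂ a₄ a₆ x ≡ 0# → Cubic.G _+_ _*_ 2# 3# a₂ a₄ a₆ x ≡ 0# →
    (((0# - ((b₂ * b₂) * b₈)) - (((n₈ * b₄) * b₄) * b₄)) - ((n₂₇ * b₆) * b₆)) + (((n₉ * b₂) * b₄) * b₆) ≡ 0#
  Δ-zero a₂ a₄ a₆ x refl refl refl refl refl refl refl refl refl f g = trans
    (solve 4 (λ a b c x →
      let :4 = :2 :+ :2; :9 = :4 :+ :4 :+ :1
          b₂ = :0 :* :0 :+ :4 :* a
          b₄ = :2 :* b :+ :0 :* :0
          b₆ = :0 :* :0 :+ :4 :* c
          b₈ = :0 :* :0 :* c :+ :4 :* a :* c :- :0 :* :0 :* b :+ a :* :0 :* :0 :- b :* b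
          n : ℕ → Expr 4
          n k = con (+ k)
      in :0 :- b₂ :* b₂ :* b₈ :- (:4 :+ :4) :* b₄ :* b₄ :* b₄ :- (:9 :+ :9 :+ :9) :* b₆ :* b₆ :+ :9 :* b₂ :* b₄ :* b₆
         := (:0 :- n 16) :* ((n 6 :* a :* a :- n 18 :* b) :* x :+ (n 4 :* a :* a :* a :- n 15 :* a :* b :+ n 27 :* c)) :* :F a b c x
         :+ (:0 :- n 16) :* ((n 6 :* b :- n 2 :* a :* a) :* x :* x :+ (n 7 :* a :* b :- n 2 :* a :* a :* a :- n 9 :* c) :* x :+ (n 4 :* b :* b :- a :* a :* b :- n 3 :* a :* c)) :* :G a b c x) refl a₂ a₄ a₆ x)
    (trans (cong₂ _+_ (trans (cong₂ _*_ refl f) (zeroʳ _)) (trans (cong₂ _*_ refl g) (zeroʳ _))) (+-identityʳ 0#))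

-- The definitions use long Weierstrass form. Here a₁ = a₃ = 0, and the terms containing them have
-- to be absorbed.
module DefiningEquations (𝔽 : Field≡) (a₂ a₄ a₆ : Field≡.Carrier 𝔽) where
  open Field≡ 𝔽 renaming (Carrier to A)
  open FieldLemmas 𝔽
  open EllipticCurve 𝔽 a₂ a₄ a₆

  OnLong : A → A → Set
  OnLong x y = y * y + 0# * x * y + 0# * y ≡ F x

  long : ∀ x y → y * y + 0# * x * y + 0# * y ≡ y * y
  long = solve 2 (λ x y → y :* y :+ :0 :* x :* y :+ :0 :* y := y :* y) refl

  On⇒OnLong : ∀ {x y} → On x y → OnLong x y
  On⇒OnLong {x} {y} o = trans (long x y) o

  opposite-long : ∀ {x y y'} → y' ≡ 0# - y → y' ≡ 0# - y - 0# * x - 0#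
  opposite-long {x} {y} e = trans e (solve 2 (λ x y → :0 :- y := :0 :- y :- :0 :* x :- :0) refl x y)

  module _ {x₁ y₁ x₂ y₂ x₃ y₃} (C : Chord x₁ y₁ x₂ y₂ x₃ y₃) where
    open Chord C
    secant-slope : l * (x₂ - x₁) ≡ y₂ - y₁
    secant-slope = combine₂ p₁ p₂ (solve 6 (λ l n x₁ y₁ x₂ y₂ → l :* (x₂ :- x₁) :- (y₂ :- y₁)
      := :1 :* (y₁ :- (l :* x₁ :+ n)) :+ (:0 :- :1) :* (y₂ :- (l :* x₂ :+ n))) refl l n x₁ y₁ x₂ y₂)

    third-x : x₃ ≡ l * l + 0# * l - a₂ - x₁ - x₂
    third-x = combine₁ e₁ (solve 5 (λ a₂ l x₁ x₂ x₃ → x₃ :- (l :* l :+ :0 :* l :- a₂ :- x₁ :- x₂)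
      := :1 :* (x₁ :+ x₂ :+ x₃ :- (l :* l :- a₂))) refl a₂ l x₁ x₂ x₃)

    third-y : 0# - y₃ ≡ 0# - (l + 0#) * x₃ - (y₁ - l * x₁) - 0#
    third-y = combine₂ p₁ p₃ (solve 6 (λ l n x₁ y₁ x₃ y₃ → :0 :- y₃ :- (:0 :- (l :+ :0) :* x₃ :- (y₁ :- l :* x₁) :- :0)
      := :1 :* (y₁ :- (l :* x₁ :+ n)) :+ (:0 :- :1) :* (y₃ :- (l :* x₃ :+ n))) refl l n x₁ y₁ x₃ y₃)

  2y-long : ∀ {t} → t ≡ 2# → ∀ x y → t * y + 0# * x + 0# ≡ 2# * y
  2y-long refl = solve 2 (λ x y → :2 :* y :+ :0 :* x :+ :0 := :2 :* y) refl

  tangent-slope : ∀ {s t} → s ≡ 2# → t ≡ 3# → ∀ {x y x₃ y₃} (C : Chord x y x y x₃ y₃) →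
                  Chord.l C * (s * y + 0# * x + 0#) ≡ t * x * x + s * a₂ * x + a₄ - 0# * y
  tangent-slope refl refl {x} {y} C = trans (cong (Chord.l C *_) (2y-long refl x y)) (trans (Chord-tangent C) (solve 2 (λ g y → g := g :- :0 :* y) refl (G x) y))

  secant-sum : ∀ {x₁ y₁ x₂ y₂ x₃ y₃} l → ¬ x₁ ≡ x₂ → l * (x₂ - x₁) ≡ y₂ - y₁ →
                     x₃ ≡ l * l - a₂ - x₁ - x₂ → y₃ ≡ l * (x₁ - x₃) - y₁ →
                     ∀ o₁ o₂ o₃ → Add (affine x₁ y₁ o₁) (affine x₂ y₂ o₂) (affine x₃ y₃ o₃)
  secant-sum {x₁} {y₁} {x₂} {y₂} l x₁≢x₂ s refl refl o₁ o₂ o₃ =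
    subst (Add _ _) (affine-≡ {o = On-neg (Chord-On₃ C o₁)} refl (third l x₁ y₁ (l * l - a₂ - x₁ - x₂))) (addChord (λ o → x₁≢x₂ (proj₁ o)) C)
    where
    C = secant l x₁≢x₂ o₁ o₂ s
    third : ∀ l x₁ y₁ x₃ → 0# - (l * x₃ + (y₁ - l * x₁)) ≡ l * (x₁ - x₃) - y₁
    third = solve 4 (λ l x₁ y₁ x₃ → :0 :- (l :* x₃ :+ (y₁ :- l :* x₁)) := l :* (x₁ :- x₃) :- y₁) refl

  tangent-sum : ∀ {x y x₃ y₃} l → ¬ y ≡ 0# → l * (2# * y) ≡ G x →
                      x₃ ≡ l * l - a₂ - x - x → y₃ ≡ l * (x - x₃) - y →
                      ∀ o o₃ → Add (affine x y o) (affine x y o) (affine x₃ y₃ o₃)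
  tangent-sum {x} {y} l y≢0 s refl refl o o₃ =
    subst (Add _ _) (affine-≡ {o = On-neg (Chord-On₃ C o)} refl (third l x y (l * l - a₂ - x - x))) (addChord ¬o C)
    where
    C = tangentLine l s
    third : ∀ l x₁ y₁ x₃ → 0# - (l * x₃ + (y₁ - l * x₁)) ≡ l * (x₁ - x₃) - y₁
    third = solve 4 (λ l x₁ y₁ x₃ → :0 :- (l :* x₃ :+ (y₁ :- l :* x₁)) := l :* (x₁ :- x₃) :- y₁) refl
    ¬o : ¬ Opposite x y x y
    ¬o (_ , e) = y≢0 (cancel 2≢0 (combine₁ e (solve 1 (λ y → :2 :* y :- :2 :* :0 := :1 :* (y :- (:0 :- y))) refl y)))

  -- A certificate for a doubling: for explicit points and an explicit slope, the equations are
  -- closed and hold by `refl`, with no inverse to compute.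
  Tangent : Point → Point → A → Set
  Tangent (affine x y _) (affine x₃ y₃ _) l = ¬ y ≡ 0# × l * (2# * y) ≡ G x × x₃ ≡ l * l - a₂ - x - x × y₃ ≡ l * (x - x₃) - y
  Tangent _ _ _ = ⊥

  doubling : ∀ P R l → Tangent P R l → P ⊹ P ≡ R
  doubling (affine x y o) (affine x₃ y₃ o₃) l (y≢0 , s , ex , ey) = Add⇒≡ (tangent-sum l y≢0 s ex ey o o₃)

  Secant : Point → Point → Point → A → Set
  Secant (affine x₁ y₁ _) (affine x₂ y₂ _) (affine x₃ y₃ _) l =
    ¬ x₁ ≡ x₂ × l * (x₂ - x₁) ≡ y₂ - y₁ × x₃ ≡ l * l - a₂ - x₁ - x₂ × y₃ ≡ l * (x₁ - x₃) - y₁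
  Secant _ _ _ _ = ⊥

  addition : ∀ P Q R l → Secant P Q R l → P ⊹ Q ≡ R
  addition (affine x₁ y₁ o₁) (affine x₂ y₂ o₂) (affine x₃ y₃ o₃) l (x₁≢x₂ , s , ex , ey) = Add⇒≡ (secant-sum l x₁≢x₂ s ex ey o₁ o₂ o₃)

  Opposed : Point → Point → Set
  Opposed (affine x y _) (affine x' y' _) = x ≡ x' × y' ≡ 0# - y
  Opposed _ _ = ⊥

  opposed : ∀ P Q → Opposed P Q → P ⊹ Q ≡ O
  opposed (affine x y o) (affine _ y' o') (refl , e) = Add⇒≡ (addOpposite e)

  -- The value at O is irrelevant.
  abscissa : Point → A
  abscissa O              = 0#
  abscissa (affine x _ _) = x

  4# : A
  4# = 2# + 2#

  -- A place over 2: B is a ring of elements integral there, and U consists of elements of B that are units there.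
  record Dyadic : Set₁ where
    field
      B U : A → Set
      B-0 : B 0#
      B-1 : B 1#
      B-+ : ∀ {x y} → B x → B y → B (x + y)
      B-- : ∀ {x y} → B x → B y → B (x - y)
      B-* : ∀ {x y} → B x → B y → B (x * y)
      U⊆B : ∀ {x} → U x → B x
      U-* : ∀ {x y} → U x → U y → U (x * y)
      U+4B : ∀ {x y} → U x → B y → U (x + 4# * y)
      ¬U4B : ∀ {x} → B x → ¬ U (4# * x)

  module NearOrigin (dyadic : Dyadic) (B-a₂ : Dyadic.B dyadic a₂) (B-a₄ : Dyadic.B dyadic a₄) (B-a₆ : Dyadic.B dyadic a₆) where
    open Dyadic dyadic

    4^ : ℕ → A
    4^ zero    = 1#
    4^ (suc r) = 4# * 4^ r

    B-2 : B 2#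
    B-2 = B-+ B-1 B-1

    B-4 : B 4#
    B-4 = B-+ B-2 B-2

    B-4^ : ∀ r → B (4^ r)
    B-4^ zero    = B-1
    B-4^ (suc r) = B-* B-4 (B-4^ r)

    -- 4^(r + 1) is the exact denominator of the x-coordinate.
    data Near (r : ℕ) : Point → Set where
      near : ∀ {x y o} n d → U n → U d → x * d * 4^ (suc r) ≡ n → Near r (affine x y o)

    ¬U0 : ¬ U 0#
    ¬U0 u = ¬U4B B-0 (subst U (sym (zeroʳ 4#)) u)

    -- Here x₃ = l² - a₂ - 2x with l = G/(2y), cleared of its denominator by 4y² = 4F.
    duplication : ∀ {x y x₃ y₃} → On x y → Chord x y x y x₃ y₃ → 4# * F x * x₃ ≡ G x * G x - 4# * F x * (a₂ + x + x)
    duplication {x} {y} {x₃} o C = combine₃ o (Chord.e₁ C) (Chord-tangent C)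
      (solve 7 (λ a₂ x y x₃ l F G → let :4 = :2 :+ :2 in
        :4 :* F :* x₃ :- (G :* G :- :4 :* F :* (a₂ :+ x :+ x))
        := (:0 :- :4 :* (x₃ :+ a₂ :+ x :+ x)) :* (y :* y :- F) :+ :4 :* y :* y :* (x :+ x :+ x₃ :- (l :* l :- a₂))
        :+ (l :* (:2 :* y) :+ G) :* (l :* (:2 :* y) :- G)) refl a₂ x y x₃ (Chord.l C) (F x) (G x))

    -- Substituting x = n/(dq) with q = 4p, and clearing denominators, turns F into n³ plus
    -- corrections and the numerator of the duplication formula into n⁴ plus corrections. Every
    -- correction contains q, hence a factor 4, so both remain units.
    module Step (x d p : A) (B-p : B p) (U-n : U (x * d * (4# * p))) (U-d : U d) where
      private
        q = 4# * p
        n = x * d * q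
        B-q = B-* B-4 B-p
        B-d = U⊆B U-d
        B-n = U⊆B U-n

      den num : A
      den = n * n * n + 4# * (p * (a₂ * n * n * d + a₄ * n * d * d * q + a₆ * d * d * d * q * q))
      num = n * n * n * n + 4# * (d * d * p * q * ((a₄ * a₄ - 4# * a₂ * a₆) * d * d * q * q - 2# * a₄ * n * n - 4# * 2# * a₆ * n * d * q))

      U-den : U den
      U-den = U+4B (U-* (U-* U-n U-n) U-n) (B-* B-p (B-+ (B-+ (B-* (B-* (B-* B-a₂ B-n) B-n) B-d) (B-* (B-* (B-* (B-* B-a₄ B-n) B-d) B-d) B-q))
        (B-* (B-* (B-* (B-* (B-* B-a₆ B-d) B-d) B-d) B-q) B-q)))

      U-num : U num
      U-num = U+4B (U-* (U-* (U-* U-n U-n) U-n) U-n) (B-* (B-* (B-* (B-* B-d B-d) B-p) B-q)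
        (B-- (B-- (B-* (B-* (B-* (B-* (B-- (B-* B-a₄ B-a₄) (B-* (B-* B-4 B-a₂) B-a₆)) B-d) B-d) B-q) B-q) (B-* (B-* (B-* B-2 B-a₄) B-n) B-n))
          (B-* (B-* (B-* (B-* (B-* B-4 B-2) B-a₆) B-n) B-d) B-q)))

      den≡ : den ≡ d * d * d * q * q * q * F x
      den≡ = solve 6 (λ a b c x d p → let :4 = :2 :+ :2; q = :4 :* p; n = x :* d :* q in
        n :* n :* n :+ :4 :* (p :* (a :* n :* n :* d :+ b :* n :* d :* d :* q :+ c :* d :* d :* d :* q :* q))
        := d :* d :* d :* q :* q :* q :* :F a b c x) refl a₂ a₄ a₆ x d p

      step : ∀ {x₃} → 4# * F x * x₃ ≡ G x * G x - 4# * F x * (a₂ + x + x) → x₃ * (den * d) * (4# * q) ≡ num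
      step {x₃} e = combine₁ e (solve 7 (λ a b c x d p x₃ →
        let :4 = :2 :+ :2; q = :4 :* p; n = x :* d :* q; F = :F a b c x; G = :G a b c x
            den = n :* n :* n :+ :4 :* (p :* (a :* n :* n :* d :+ b :* n :* d :* d :* q :+ c :* d :* d :* d :* q :* q))
            num = n :* n :* n :* n :+ :4 :* (d :* d :* p :* q :* ((b :* b :- :4 :* a :* c) :* d :* d :* q :* q :- :2 :* b :* n :* n :- :4 :* :2 :* c :* n :* d :* q))
        in x₃ :* (den :* d) :* (:4 :* q) :- num
           := d :* d :* d :* d :* q :* q :* q :* q :* (:4 :* F :* x₃ :- (G :* G :- :4 :* F :* (a :+ x :+ x)))) refl a₂ a₄ a₆ x d p x₃)

    Near-double : ∀ {r P R} → Near r P → Add P P R → Near (suc r) R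
    -- The point is not 2-torsion: F x would be zero, whereas its multiple `den` is a unit.
    Near-double {r} (near {x} {y} {o} _ d U-n U-d refl) (addOpposite e) = contradiction (subst U (trans den≡ (trans (cong₂ _*_ refl F≡0) (zeroʳ _))) U-den) ¬U0
      where
      open Step x d (4^ r) (B-4^ r) U-n U-d
      y≡0 : y ≡ 0#
      y≡0 = cancel 2≢0 (combine₁ e (solve 1 (λ y → :2 :* y :- :2 :* :0 := :1 :* (y :- (:0 :- y))) refl y))
      F≡0 : F x ≡ 0#
      F≡0 = trans (sym o) (trans (cong (λ y → y * y) y≡0) (zeroˡ 0#))
    Near-double {r} (near {x} {y} {o} _ d U-n U-d refl) (addChord _ C) = near num (den * d) U-num (U-* U-den U-d) (step (duplication o C))
      where open Step x d (4^ r) (B-4^ r) U-n U-d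

    4^-+ : ∀ r k → 4^ (suc (r ℕ.+ k)) ≡ 4^ r * (4# * 4^ k)
    4^-+ zero    k = sym (*-identityˡ _)
    4^-+ (suc r) k = trans (cong (4# *_) (4^-+ r k)) (sym (*-assoc 4# (4^ r) _))

    -- Cross-multiplying the two expressions for x equates the unit n'd with 4 times an integral
    -- element.
    Near-distinct : ∀ {r s P} → r < s → Near r P → ¬ Near s P
    Near-distinct {r} {s} r<s (near {x} _ d U-n U-d refl) (near _ d' U-n' U-d' refl) with ℕ.m≤n⇒∃[o]m+o≡n r<s
    ... | k , refl = ¬U4B (B-* (B-* (U⊆B U-n) (U⊆B U-d')) (B-4^ k)) (subst U eq (U-* U-n' U-d))
      where
      eq : x * d' * 4^ (suc (suc (r ℕ.+ k))) * d ≡ 4# * (x * d * 4^ (suc r) * d' * 4^ k)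
      eq = trans (cong (λ t → x * d' * t * d) (4^-+ (suc r) k)) (solve 5 (λ x d d' q t → let :4 = :2 :+ :2 in x :* d' :* (q :* (:4 :* t)) :* d := :4 :* (x :* d :* q :* d' :* t)) refl x d d' (4^ (suc r)) (4^ k))

-- Parity and residue maps at places over 2.

Even Odd : ℤ → Set
Even z = Σ ℤ λ k → z ≡ + 2 ℤ.* k
Odd z = Σ ℤ λ k → z ≡ + 1 ℤ.+ + 2 ℤ.* k

¬Even∧Odd : ∀ {z} → Even z → ¬ Odd z
¬Even∧Odd (k , refl) (m , e) = lemma (k ℤ.- m) (trans (ℤ-Solver.solve 2 (λ k m → con (+ 2) :* (k :- m) := con (+ 2) :* k :- con (+ 2) :* m) refl k m)
    (trans (cong (ℤ._- + 2 ℤ.* m) e) (ℤ-Solver.solve 1 (λ m → :1 :+ con (+ 2) :* m :- con (+ 2) :* m := :1) refl m)))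
  where
  lemma : ∀ k → ¬ + 2 ℤ.* k ≡ + 1
  lemma (+ zero) ()
  lemma (+ suc zero) ()
  lemma (+ suc (suc n)) ()
  lemma -[1+ n ] ()

Odd-* : ∀ {x y} → Odd x → Odd y → Odd (x ℤ.* y)
Odd-* (k , refl) (m , refl) = k ℤ.+ m ℤ.+ + 2 ℤ.* k ℤ.* m , ℤ-Solver.solve 2 (λ k m → (:1 :+ con (+ 2) :* k) :* (:1 :+ con (+ 2) :* m) := :1 :+ con (+ 2) :* (k :+ m :+ con (+ 2) :* k :* m)) refl k m

Odd-+Even : ∀ {x y} → Odd x → Even y → Odd (x ℤ.+ y)
Odd-+Even (k , refl) (m , refl) = k ℤ.+ m , ℤ-Solver.solve 2 (λ k m → :1 :+ con (+ 2) :* k :+ con (+ 2) :* m := :1 :+ con (+ 2) :* (k :+ m)) refl k m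

Even-+ : ∀ {x y} → Even x → Even y → Even (x ℤ.+ y)
Even-+ (k , refl) (m , refl) = k ℤ.+ m , sym (ℤ.*-distribˡ-+ (+ 2) k m)

-- A ring of elements of K integral at a place over 2 with residue field 𝔽₂; ρ is the residue map.
record Residue (f : Quartic) : Set₁ where
  open Field f
  infixl 6 _⊞_ _⊟_
  infixl 7 _⊠_
  field
    Z : Set
    _⊞_ _⊟_ _⊠_ : Z → Z → Z
    𝟘 𝟙 : Z
    ι : Z → K f
    ι-𝟘 : ι 𝟘 ≡ 0K
    ι-𝟙 : ι 𝟙 ≡ 1K
    ι-⊞ : ∀ z w → ι (z ⊞ w) ≡ ι z +K ι w
    ι-⊟ : ∀ z w → ι (z ⊟ w) ≡ ι z -K ι w
    ι-⊠ : ∀ z w → ι (z ⊠ w) ≡ ι z *K ι w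
    ρ : Z → ℤ
    ρ-⊞ : ∀ z w → ρ (z ⊞ w) ≡ ρ z ℤ.+ ρ w
    ρ-⊠ : ∀ z w → Σ ℤ λ k → ρ (z ⊠ w) ≡ ρ z ℤ.* ρ w ℤ.+ + 2 ℤ.* k
    ι-injective : ∀ z w → ι z ≡ ι w → Odd (ρ z) → Odd (ρ w)

-- Transfer to the points and sums of the definitions.

module OverK (f : Quartic) (an : KRing.Anisotropic f) (a₂ a₄ a₆ : K f) where
  open KRing f
  private 𝔽 = K-field an
  open EllipticCurve 𝔽 a₂ a₄ a₆ public
  open DefiningEquations 𝔽 a₂ a₄ a₆ public

  E : Weierstrass f
  E = weierstrass 0K a₂ 0K a₄ a₆

  private module C = Curve E

  long-On : ∀ {x y} → On x y → C.OnCurve x y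
  long-On {x} {y} = On⇒OnLong {x} {y}

  point : Point → C.Point
  point O              = C.O
  point (affine x y o) = C.affine x y (long-On {x} {y} o)

  private
    x-coordinate y-coordinate : C.Point → K f
    x-coordinate C.O            = 0K
    x-coordinate (C.affine x y _) = x
    y-coordinate C.O            = 0K
    y-coordinate (C.affine x y _) = y

  point-injective : ∀ P Q → point P ≡ point Q → P ≡ Q
  point-injective O O e = refl
  point-injective (affine x y o) (affine x' y' o') e = affine-≡ {x} {x'} {y} {y'} {o} {o'} (cong x-coordinate e) (cong y-coordinate e)

  -- `Chord` treats secants and tangents alike; `Sum` separates them by whether the abscissae agree.
  Add⇒Sum : ∀ {P Q R} → Add P Q R → C.Sum (point P) (point Q) (point R)
  Add⇒Sum (addOˡ {P}) = C.O-left (point P)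
  Add⇒Sum (addOʳ {P}) = C.O-right (point P)
  Add⇒Sum (addOpposite {x} {y} {o} {y'} {o'} e) = C.inverse x y (long-On {x} {y} o) y' (long-On {x} {y'} o') (opposite-long {x} {y} {y'} e)
  Add⇒Sum (addChord {x₁} {y₁} {o₁} {x₂} {y₂} {o₂} {x₃} {y₃} {o₃} ¬o C) = by-cases (x₁ ≟K x₂)
    where
    by-cases : Dec (x₁ ≡ x₂) → C.Sum (point (affine x₁ y₁ o₁)) (point (affine x₂ y₂ o₂)) (point (affine x₃ (0K -K y₃) o₃))
    by-cases (no x₁≢x₂) = C.chord x₁ y₁ (long-On {x₁} {y₁} o₁) x₂ y₂ (long-On {x₂} {y₂} o₂) x₃ (0K -K y₃) (long-On {x₃} {0K -K y₃} o₃) (Chord.l C) x₁≢x₂ (secant-slope C) (third-x C) (third-y C)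
    by-cases (yes refl) = doubled (trans (Chord.p₁ C) (sym (Chord.p₂ C)))
      where
      doubled : y₁ ≡ y₂ → C.Sum (point (affine x₁ y₁ o₁)) (point (affine x₁ y₂ o₂)) (point (affine x₃ (0K -K y₃) o₃))
      doubled refl = C.tangent x₁ y₁ (long-On {x₁} {y₁} o₁) (long-On {x₁} {y₁} o₂) x₃ (0K -K y₃) (long-On {x₃} {0K -K y₃} o₃) (Chord.l C)
        (λ e → 2y≢0 {x₁} {y₁} ¬o (trans (sym (2y-long {nK 2} refl x₁ y₁)) e)) (tangent-slope {nK 2} {nK 3} refl refl C) (third-x C) (third-y C)

  nonsingular : ¬ C.Δ ≡ 0K → ∀ x → F x ≡ 0K → ¬ G x ≡ 0K
  nonsingular Δ≢0 x f g = Δ≢0 (DiscriminantZero.Δ-zero _+K_ _-K_ _*K_ negK 0K 1K K-isCommutativeRing (λ _ _ → refl) a₂ a₄ a₆ x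
    {nK 2} {nK 4} {nK 8} {nK 9} {nK 27} {C.b₂} {C.b₄} {C.b₆} {C.b₈} refl refl refl refl refl refl refl refl refl f g)

  module MordellWeil (Δ≢0 : ¬ C.Δ ≡ 0K) where
    open Group (nonsingular Δ≢0) public
    open Subgroups isAbelianGroup public

    realise : ∀ {k} {ms : Vec ℕ k} xs → Killed ms xs → Free ms xs → Realised ms
    realise {ms = ms} xs killed free = f , irreducible f an , E , Δ≢0 , (λ g → point (combination xs g)) ,
      (λ g h → subst (C.Sum _ _) (cong point (sym (combination-homo xs g h))) (Add⇒Sum (⊹-graph (combination xs g) (combination xs h)))) ,
      (λ g h e → fibres⇒ {ms = ms} {xs} free g h (point-injective _ _ e)) ,
      (λ g h c → cong point (fibres⇐ {ms = ms} {xs} killed g h c))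

    near⇒infinite : (dyadic : Dyadic) (b₂ : Dyadic.B dyadic a₂) (b₄ : Dyadic.B dyadic a₄) (b₆ : Dyadic.B dyadic a₆) →
                    ∀ r P → NearOrigin.Near dyadic b₂ b₄ b₆ r P → InfiniteOrder P
    near⇒infinite dyadic b₂ b₄ b₆ r P = separated⇒infinite Near (λ r Q n → Near-double n (⊹-graph Q Q)) (λ r s Q r<s → Near-distinct r<s) r P
      where open NearOrigin dyadic b₂ b₄ b₆

  -- Units are the elements with odd residue. Multiples of 4 have even residue, and `ι-injective`
  -- ensures that parity does not depend on the chosen preimage.
  residue⇒dyadic : Residue f → Dyadic
  residue⇒dyadic R = record
    { B = λ x → Σ Z λ z → x ≡ ι z
    ; U = λ x → Σ Z λ z → Odd (ρ z) × x ≡ ι z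
    ; B-0 = 𝟘 , sym ι-𝟘
    ; B-1 = 𝟙 , sym ι-𝟙
    ; B-+ = λ { (z , refl) (w , refl) → z ⊞ w , sym (ι-⊞ z w) }
    ; B-- = λ { (z , refl) (w , refl) → z ⊟ w , sym (ι-⊟ z w) }
    ; B-* = λ { (z , refl) (w , refl) → z ⊠ w , sym (ι-⊠ z w) }
    ; U⊆B = λ { (z , _ , e) → z , e }
    ; U-* = λ { (z , oz , refl) (w , ow , refl) → z ⊠ w , subst Odd (sym (proj₂ (ρ-⊠ z w))) (Odd-+Even (Odd-* oz ow) (proj₁ (ρ-⊠ z w) , refl)) , sym (ι-⊠ z w) }
    ; U+4B = λ { (z , oz , refl) (w , refl) → z ⊞ four ⊠ w , subst Odd (sym (ρ-⊞ z (four ⊠ w))) (Odd-+Even oz (Even-four w)) , sym (trans (ι-⊞ z (four ⊠ w)) (cong (ι z +K_) (ι-four⊠ w))) }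
    ; ¬U4B = λ { (w , refl) (z , oz , e) → ¬Even∧Odd (Even-four w) (ι-injective z (four ⊠ w) (sym (trans (ι-four⊠ w) e)) oz) } }
    where
    open Residue R
    two four : Z
    two = 𝟙 ⊞ 𝟙
    four = two ⊞ two
    ι-four : ι four ≡ 4#
    ι-four = trans (ι-⊞ two two) (cong (λ t → t +K t) (trans (ι-⊞ 𝟙 𝟙) (cong (λ t → t +K t) ι-𝟙)))
    ι-four⊠ : ∀ w → ι (four ⊠ w) ≡ 4# *K ι w
    ι-four⊠ w = trans (ι-⊠ four w) (cong (_*K ι w) ι-four)
    Even-four : ∀ w → Even (ρ (four ⊠ w))
    Even-four w = subst Even (sym (proj₂ (ρ-⊠ four w))) (Even-+ (ρ two ℤ.* ρ w ,
      trans (cong (ℤ._* ρ w) (ρ-⊞ two two)) (ℤ-Solver.solve 2 (λ t w → (t :+ t) :* w := con (+ 2) :* (t :* w)) refl (ρ two) (ρ w))) (proj₁ (ρ-⊠ four w) , refl))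

odd-or-even : ∀ z → Even z ⊎ Odd z
odd-or-even z = by-remainder (z ℤ.%ℕ 2) (n%ℕd<d z 2) (a≡a%ℕn+[a/ℕn]*n z 2)
  where
  q = z ℤ./ℕ 2
  by-remainder : ∀ r → r < 2 → z ≡ + r ℤ.+ q ℤ.* + 2 → Even z ⊎ Odd z
  by-remainder 0 _ e = inj₁ (q , trans e (trans (ℤ.+-identityˡ (q ℤ.* + 2)) (ℤ.*-comm q (+ 2))))
  by-remainder 1 _ e = inj₂ (q , trans e (cong (λ t → + 1 ℤ.+ t) (ℤ.*-comm q (+ 2))))
  by-remainder (suc (suc r)) (s≤s (s≤s ())) e

module Places (f : Quartic) where
  open KRing f
  open RingSolver K-ring using (solve)

  embedℤ : ℤ → K f
  embedℤ z = embed (fromℤ z)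

  embedℤ-+ : ∀ a b → embedℤ (a ℤ.+ b) ≡ embedℤ a +K embedℤ b
  embedℤ-+ a b = cong₄ ⟨_,_,_,_⟩ (fromℤ-+ a b) refl refl refl

  embedℤ-- : ∀ a b → embedℤ (a ℤ.- b) ≡ embedℤ a -K embedℤ b
  embedℤ-- a b = cong₄ ⟨_,_,_,_⟩ (fromℤ-sub a b) refl refl refl

  embedℤ-* : ∀ a b → embedℤ (a ℤ.* b) ≡ embedℤ a *K embedℤ b
  embedℤ-* a b = trans (cong embed (fromℤ-* a b)) (sym (embed-* (fromℤ a) (fromℤ b)))

  -- ℤ[w] with w² even, modulo the prime (2, w).
  module Quadratic (w : K f) (k : ℤ) (ww : w *K w ≡ embedℤ (+ 2 ℤ.* k)) where
    private
      ι : ℤ × ℤ → K f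
      ι (a , b) = embedℤ a +K embedℤ b *K w

      _⊞_ _⊟_ _⊠_ : ℤ × ℤ → ℤ × ℤ → ℤ × ℤ
      (a , b) ⊞ (c , d) = a ℤ.+ c , b ℤ.+ d
      (a , b) ⊟ (c , d) = a ℤ.- c , b ℤ.- d
      (a , b) ⊠ (c , d) = a ℤ.* c ℤ.+ + 2 ℤ.* k ℤ.* (b ℤ.* d) , a ℤ.* d ℤ.+ b ℤ.* c

      ι-⊞ : ∀ z z' → ι (z ⊞ z') ≡ ι z +K ι z'
      ι-⊞ (a , b) (c , d) = trans (cong₂ (λ s t → s +K t *K w) (embedℤ-+ a c) (embedℤ-+ b d))
        (solve 5 (λ a b c d w → (a :+ c) :+ (b :+ d) :* w := (a :+ b :* w) :+ (c :+ d :* w)) refl (embedℤ a) (embedℤ b) (embedℤ c) (embedℤ d) w)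

      ι-⊟ : ∀ z z' → ι (z ⊟ z') ≡ ι z -K ι z'
      ι-⊟ (a , b) (c , d) = trans (cong₂ (λ s t → s +K t *K w) (embedℤ-- a c) (embedℤ-- b d))
        (solve 5 (λ a b c d w → (a :- c) :+ (b :- d) :* w := (a :+ b :* w) :- (c :+ d :* w)) refl (embedℤ a) (embedℤ b) (embedℤ c) (embedℤ d) w)

      ι-⊠ : ∀ z z' → ι (z ⊠ z') ≡ ι z *K ι z'
      ι-⊠ (a , b) (c , d) = begin
        embedℤ (a ℤ.* c ℤ.+ + 2 ℤ.* k ℤ.* (b ℤ.* d)) +K embedℤ (a ℤ.* d ℤ.+ b ℤ.* c) *K w
          ≡⟨ cong₂ (λ s t → s +K t *K w)
               (trans (embedℤ-+ (a ℤ.* c) (+ 2 ℤ.* k ℤ.* (b ℤ.* d))) (cong₂ _+K_ (embedℤ-* a c) (trans (embedℤ-* (+ 2 ℤ.* k) (b ℤ.* d)) (cong₂ _*K_ (sym ww) (embedℤ-* b d)))))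
               (trans (embedℤ-+ (a ℤ.* d) (b ℤ.* c)) (cong₂ _+K_ (embedℤ-* a d) (embedℤ-* b c))) ⟩
        (embedℤ a *K embedℤ c +K w *K w *K (embedℤ b *K embedℤ d)) +K (embedℤ a *K embedℤ d +K embedℤ b *K embedℤ c) *K w
          ≡⟨ solve 5 (λ a b c d w → (a :* c :+ w :* w :* (b :* d)) :+ (a :* d :+ b :* c) :* w := (a :+ b :* w) :* (c :+ d :* w)) refl (embedℤ a) (embedℤ b) (embedℤ c) (embedℤ d) w ⟩
        (embedℤ a +K embedℤ b *K w) *K (embedℤ c +K embedℤ d *K w) ∎
        where open ≡-Reasoning

      -- If w is rational (w = 0 occurs below), a is not determined by a + bw. Its parity still is:
      -- a - c = (d - b)w, and w² is even.
      square-difference : ∀ a b c d → ι (a , b) ≡ ι (c , d) → (a ℤ.- c) ℤ.* (a ℤ.- c) ≡ + 2 ℤ.* (k ℤ.* ((d ℤ.- b) ℤ.* (d ℤ.- b)))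
      square-difference a b c d e = fromℤ-injective (cong K.a₀ (begin
        embedℤ ((a ℤ.- c) ℤ.* (a ℤ.- c))               ≡⟨ embedℤ-* (a ℤ.- c) (a ℤ.- c) ⟩
        embedℤ (a ℤ.- c) *K embedℤ (a ℤ.- c)           ≡⟨ cong (λ t → t *K t) difference ⟩
        (embedℤ (d ℤ.- b) *K w) *K (embedℤ (d ℤ.- b) *K w)
          ≡⟨ solve 2 (λ t w → (t :* w) :* (t :* w) := w :* w :* (t :* t)) refl (embedℤ (d ℤ.- b)) w ⟩
        w *K w *K (embedℤ (d ℤ.- b) *K embedℤ (d ℤ.- b)) ≡⟨ cong₂ _*K_ ww (sym (embedℤ-* (d ℤ.- b) (d ℤ.- b))) ⟩
        embedℤ (+ 2 ℤ.* k) *K embedℤ ((d ℤ.- b) ℤ.* (d ℤ.- b)) ≡⟨ sym (embedℤ-* (+ 2 ℤ.* k) ((d ℤ.- b) ℤ.* (d ℤ.- b))) ⟩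
        embedℤ (+ 2 ℤ.* k ℤ.* ((d ℤ.- b) ℤ.* (d ℤ.- b))) ≡⟨ cong embedℤ (ℤ.*-assoc (+ 2) k ((d ℤ.- b) ℤ.* (d ℤ.- b))) ⟩
        embedℤ (+ 2 ℤ.* (k ℤ.* ((d ℤ.- b) ℤ.* (d ℤ.- b)))) ∎))
        where
        open ≡-Reasoning
        difference : embedℤ (a ℤ.- c) ≡ embedℤ (d ℤ.- b) *K w
        difference = begin
          embedℤ (a ℤ.- c)                                   ≡⟨ embedℤ-- a c ⟩
          embedℤ a -K embedℤ c                               ≡⟨ solve 4 (λ a b c w → a :- c := a :+ b :* w :- c :- b :* w) refl (embedℤ a) (embedℤ b) (embedℤ c) w ⟩
          ι (a , b) -K embedℤ c -K embedℤ b *K w             ≡⟨ cong (λ t → t -K embedℤ c -K embedℤ b *K w) e ⟩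
          ι (c , d) -K embedℤ c -K embedℤ b *K w             ≡⟨ solve 4 (λ b c d w → c :+ d :* w :- c :- b :* w := (d :- b) :* w) refl (embedℤ b) (embedℤ c) (embedℤ d) w ⟩
          (embedℤ d -K embedℤ b) *K w                        ≡⟨ cong (_*K w) (sym (embedℤ-- d b)) ⟩
          embedℤ (d ℤ.- b) *K w ∎

      parity : ∀ a b c d → ι (a , b) ≡ ι (c , d) → Odd a → Odd c
      parity a b c d e oa = [ (λ ec → contradiction (Odd-* (odd ec) (odd ec)) (¬Even∧Odd (k ℤ.* ((d ℤ.- b) ℤ.* (d ℤ.- b)) , square-difference a b c d e))) , (λ oc → oc) ]′ (odd-or-even c)
        where
        odd : Even c → Odd (a ℤ.- c)
        odd (m , c≡) = Odd-+Even oa (ℤ.- m , trans (cong ℤ.-_ c≡) (ℤ.neg-distribʳ-* (+ 2) m))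

    residue : Residue f
    residue = record
      { Z = ℤ × ℤ ; _⊞_ = _⊞_ ; _⊟_ = _⊟_ ; _⊠_ = _⊠_ ; 𝟘 = + 0 , + 0 ; 𝟙 = + 1 , + 0 ; ι = ι
      ; ι-𝟘 = solve 1 (λ w → :0 :+ :0 :* w := :0) refl w
      ; ι-𝟙 = solve 1 (λ w → :1 :+ :0 :* w := :1) refl w
      ; ι-⊞ = ι-⊞ ; ι-⊟ = ι-⊟ ; ι-⊠ = ι-⊠
      ; ρ = proj₁
      ; ρ-⊞ = λ _ _ → refl
      ; ρ-⊠ = λ { (a , b) (c , d) → k ℤ.* (b ℤ.* d) , cong (λ t → a ℤ.* c ℤ.+ t) (ℤ.*-assoc (+ 2) k (b ℤ.* d)) }
      ; ι-injective = λ { (a , b) (c , d) → parity a b c d } }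

-- ℤ[θ] with f(0) even, modulo the prime (2, θ).
module θ-Place (c₀ c₁ c₂ c₃ k : ℤ) (c₀≡ : c₀ ≡ + 2 ℤ.* k) where
  private
    f = integralQuartic c₀ c₁ c₂ c₃
    open ModQuartic ℤ._+_ ℤ._-_ ℤ._*_ c₀ c₁ c₂ c₃
    open KRing f

    product : Quad (Expr 12)
    product = ModQuartic._⊛_ _:+_ _:-_ _:*_ (var (# 0)) (var (# 1)) (var (# 2)) (var (# 3))
      (quad (var (# 4)) (var (# 5)) (var (# 6)) (var (# 7))) (quad (var (# 8)) (var (# 9)) (var (# 10)) (var (# 11)))

    ι : Quad ℤ → K f
    ι (quad a b c d) = ⟨ fromℤ a , fromℤ b , fromℤ c , fromℤ d ⟩

    _⊟_ : Quad ℤ → Quad ℤ → Quad ℤ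
    quad a b c d ⊟ quad a' b' c' d' = quad (a ℤ.- a') (b ℤ.- b') (c ℤ.- c') (d ℤ.- d')

    ι-⊞ : ∀ z w → ι (z ⊞ w) ≡ ι z +K ι w
    ι-⊞ (quad a b c d) (quad a' b' c' d') = cong₄ ⟨_,_,_,_⟩ (fromℤ-+ a a') (fromℤ-+ b b') (fromℤ-+ c c') (fromℤ-+ d d')

    ι-⊟ : ∀ z w → ι (z ⊟ w) ≡ ι z -K ι w
    ι-⊟ (quad a b c d) (quad a' b' c' d') = cong₄ ⟨_,_,_,_⟩ (fromℤ-sub a a') (fromℤ-sub b b') (fromℤ-sub c c') (fromℤ-sub d d')

    ι-⊛ : ∀ z w → ι (z ⊛ w) ≡ ι z *K ι w
    ι-⊛ (quad a b c d) (quad a' b' c' d') = cong₄ ⟨_,_,_,_⟩ (fromℤ-⟦⟧ (q₀ product) ρ) (fromℤ-⟦⟧ (q₁ product) ρ) (fromℤ-⟦⟧ (q₂ product) ρ) (fromℤ-⟦⟧ (q₃ product) ρ)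
      where
      open Quad
      ρ = c₀ ∷ c₁ ∷ c₂ ∷ c₃ ∷ a ∷ b ∷ c ∷ d ∷ a' ∷ b' ∷ c' ∷ d' ∷ []

    -- The coefficient of θ⁴ in the product before the last reduction step.
    carry : Quad ℤ → Quad ℤ → ℤ
    carry (quad a b c d) (quad a' b' c' d') =
      b ℤ.* d' ℤ.+ c ℤ.* c' ℤ.+ d ℤ.* b' ℤ.- d ℤ.* d' ℤ.* c₂ ℤ.- (c ℤ.* d' ℤ.+ d ℤ.* c' ℤ.- d ℤ.* d' ℤ.* c₃) ℤ.* c₃

    -- Reduction changes the constant coordinate only by a multiple of c₀, which is even.
    ρ-⊛ : ∀ z w → Σ ℤ λ m → Quad.q₀ (z ⊛ w) ≡ Quad.q₀ z ℤ.* Quad.q₀ w ℤ.+ + 2 ℤ.* m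
    ρ-⊛ z w = + 0 ℤ.- carry z w ℤ.* k , trans (cong (λ t → Quad.q₀ z ℤ.* Quad.q₀ w ℤ.- carry z w ℤ.* t) c₀≡)
      (ℤ-Solver.solve 3 (λ p s k → p :- s :* (con (+ 2) :* k) := p :+ con (+ 2) :* (:0 :- s :* k)) refl (Quad.q₀ z ℤ.* Quad.q₀ w) (carry z w) k)

    ι-injective : ∀ z w → ι z ≡ ι w → Odd (Quad.q₀ z) → Odd (Quad.q₀ w)
    ι-injective z w e = subst Odd (fromℤ-injective (cong K.a₀ e))

  residue : Residue f
  residue = record
    { Z = Quad ℤ ; _⊞_ = _⊞_ ; _⊟_ = _⊟_ ; _⊠_ = _⊛_ ; 𝟘 = quad (+ 0) (+ 0) (+ 0) (+ 0) ; 𝟙 = quad (+ 1) (+ 0) (+ 0) (+ 0)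
    ; ι = ι ; ι-𝟘 = refl ; ι-𝟙 = refl ; ι-⊞ = ι-⊞ ; ι-⊟ = ι-⊟ ; ι-⊠ = ι-⊛
    ; ρ = Quad.q₀ ; ρ-⊞ = λ _ _ → refl ; ρ-⊠ = ρ-⊛ ; ι-injective = ι-injective }

-- The five curves

open import Data.Integer using (-_)

int : ∀ {f} → ℤ → ℤ → ℤ → ℤ → K f
int a b c d = ⟨ fromℤ a , fromℤ b , fromℤ c , fromℤ d ⟩

frac : ∀ {f} → ℤ → ℤ → ℤ → ℤ → (m : ℕ) .{{_ : ℕ.NonZero m}} → K f
frac a b c d m = ⟨ a / m , b / m , c / m , d / m ⟩

-- The fibre over x = 1 of Sutherland's model of X₁(17), which is quartic in y. The Tate normal form is
-- scaled to be integral and the square in y completed, so that its point (0 , 0) becomes T.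
module Z17 where
  f : Quartic
  f = integralQuartic (+ 2) (- + 3) (- + 1) (+ 3)

  anisotropic : KRing.Anisotropic f
  anisotropic = inert₃ (+ 2) (- + 3) (- + 1) (+ 3) tt

  a₂ a₄ a₆ : K f
  a₂ = int (- + 49) (+ 77) (- + 24) (- + 21)
  a₄ = int (+ 1376) (- + 2960) (+ 1392) (+ 896)
  a₆ = int (+ 3968) (- + 8896) (+ 4608) (+ 2752)

  open OverK f anisotropic a₂ a₄ a₆

  Δ≢0 : ¬ Curve.Δ E ≡ Field.0K f
  Δ≢0 e = contradiction (cong K.a₀ e) λ ()

  open MordellWeil Δ≢0

  T T₂ T₄ T₈ T₁₆ P : Point
  T   = affine (int (+ 0) (+ 0) (+ 0) (+ 0)) (int (- + 32) (+ 64) (- + 40) (- + 24)) refl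
  T₂  = affine (int (+ 144) (- + 312) (+ 152) (+ 96)) (int (+ 3040) (- + 6768) (+ 3392) (+ 2096)) refl
  T₄  = affine (int (+ 48) (- + 96) (+ 44) (+ 28)) (int (+ 376) (- + 836) (+ 420) (+ 256)) refl
  T₈  = affine (int (+ 24) (- + 44) (+ 16) (+ 12)) (int (+ 56) (- + 124) (+ 64) (+ 36)) refl
  T₁₆ = affine (int (+ 0) (+ 0) (+ 0) (+ 0)) (int (+ 32) (- + 64) (+ 40) (+ 24)) refl
  P   = affine (frac (+ 1315) (- + 427) (- + 1055) (- + 307) 256) (frac (+ 172271) (- + 380311) (+ 191269) (+ 122561) 4096) refl

  T+T : T ⊹ T ≡ T₂
  T+T = doubling T T₂ (int (- + 7) (+ 13) (- + 1) (- + 2)) ((λ ()) , refl , refl , refl)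

  T₂+T₂ : T₂ ⊹ T₂ ≡ T₄
  T₂+T₂ = doubling T₂ T₄ (int (+ 7) (- + 17) (+ 11) (+ 6)) ((λ ()) , refl , refl , refl)

  T₄+T₄ : T₄ ⊹ T₄ ≡ T₈
  T₄+T₄ = doubling T₄ T₈ (int (+ 5) (- + 9) (+ 3) (+ 2)) ((λ ()) , refl , refl , refl)

  T₈+T₈ : T₈ ⊹ T₈ ≡ T₁₆
  T₈+T₈ = doubling T₈ T₁₆ (int (- + 1) (- + 1) (+ 5) (+ 2)) ((λ ()) , refl , refl , refl)

  T₂≡ : + 2 · T ≡ T₂
  T₂≡ = ·-sum {+ 1} {+ 1} (·-identityˡ T) (·-identityˡ T) T+T

  T₄≡ : + 4 · T ≡ T₄
  T₄≡ = ·-sum {+ 2} {+ 2} T₂≡ T₂≡ T₂+T₂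

  T₈≡ : + 8 · T ≡ T₈
  T₈≡ = ·-sum {+ 4} {+ 4} T₄≡ T₄≡ T₄+T₄

  T₁₆≡ : + 16 · T ≡ T₁₆
  T₁₆≡ = ·-sum {+ 8} {+ 8} T₈≡ T₈≡ T₈+T₈

  17T≡O : + 17 · T ≡ O
  17T≡O = ·-sum {+ 16} {+ 1} T₁₆≡ (·-identityˡ T) (opposed T₁₆ T (refl , refl))

  P-infinite : InfiniteOrder P
  P-infinite = near⇒infinite (residue⇒dyadic (θ-Place.residue (+ 2) (- + 3) (- + 1) (+ 3) (+ 1) refl))
    (quad (- + 49) (+ 77) (- + 24) (- + 21) , refl)
    (quad (+ 1376) (- + 2960) (+ 1392) (+ 896) , refl)
    (quad (+ 3968) (- + 8896) (+ 4608) (+ 2752) , refl)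
    -- 256 = 4⁴, and `Near r` refers to 4^(r + 1). The residue map sends θ to 0, so the odd constant
    -- coordinate 1315 = 1 + 2 · 657 makes the numerator a unit.
    3 P (NearOrigin.near (int (+ 1315) (- + 427) (- + 1055) (- + 307)) (int (+ 1) (+ 0) (+ 0) (+ 0))
      (quad (+ 1315) (- + 427) (- + 1055) (- + 307) , ((+ 657) , refl) , refl)
      (quad (+ 1) (+ 0) (+ 0) (+ 0) , (+ 0 , refl) , refl) refl)

  realised : Realised (17 ∷ 0 ∷ [])
  realised = realise (T ∷ P ∷ []) (17T≡O , refl , tt)
    (free₂ T P (λ ()) 17T≡O P-infinite (order-prime (from-yes (prime? 17)) T 17T≡O λ ()))

-- The fibre over x = 2 of Sutherland's model of X₁(21), transformed in the same way and
-- rewritten with a smaller generator of the field.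
module Z21 where
  f : Quartic
  f = integralQuartic (- + 4) (- + 5) (- + 7) (- + 1)

  anisotropic : KRing.Anisotropic f
  anisotropic = inert₃ (- + 4) (- + 5) (- + 7) (- + 1) tt

  a₂ a₄ a₆ : K f
  a₂ = int (- + 95) (- + 184) (+ 120) (- + 16)
  a₄ = int (+ 8960) (+ 5824) (+ 616) (- + 840)
  a₆ = int (- + 78400) (- + 784) (+ 37632) (- + 8624)

  open OverK f anisotropic a₂ a₄ a₆

  Δ≢0 : ¬ Curve.Δ E ≡ Field.0K f
  Δ≢0 e = contradiction (cong K.a₀ e) λ ()

  open MordellWeil Δ≢0

  T T₂ T₄ T₈ T₁₆ T₂₀ P : Point
  T   = affine (int (+ 0) (+ 0) (+ 0) (+ 0)) (int (- + 224) (- + 504) (- + 140) (+ 84)) refl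
  T₂  = affine (int (- + 48) (+ 20) (- + 116) (+ 32)) (int (+ 176) (+ 204) (- + 1040) (+ 276)) refl
  T₄  = affine (int (+ 256) (+ 160) (+ 348) (- + 108)) (int (+ 13088) (+ 9384) (+ 18096) (- + 6008)) refl
  T₈  = affine (int (+ 224) (+ 504) (+ 140) (- + 84)) (int (- + 896) (+ 3360) (+ 3136) (- + 1120)) refl
  T₁₆ = affine (int (+ 184) (+ 224) (+ 20) (- + 28)) (int (- + 1352) (- + 952) (+ 200) (+ 56)) refl
  T₂₀ = affine (int (+ 0) (+ 0) (+ 0) (+ 0)) (int (+ 224) (+ 504) (+ 140) (- + 84)) refl
  P   = affine (frac (+ 12915845) (+ 6064311) (+ 22857185) (- + 7313037) 16384) (frac (+ 219909605671) (+ 151552598445) (+ 281507719003) (- + 97888445695) 2097152) refl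

  T+T : T ⊹ T ≡ T₂
  T+T = doubling T T₂ (int (+ 1) (+ 16) (+ 2) (- + 2)) ((λ ()) , refl , refl , refl)

  T₂+T₂ : T₂ ⊹ T₂ ≡ T₄
  T₂+T₂ = doubling T₂ T₄ (int (- + 7) (- + 18) (- + 10) (+ 4)) ((λ ()) , refl , refl , refl)

  T₄+T₄ : T₄ ⊹ T₄ ≡ T₈
  T₄+T₄ = doubling T₄ T₈ (int (- + 1) (- + 8) (+ 12) (- + 2)) ((λ ()) , refl , refl , refl)

  T₈+T₈ : T₈ ⊹ T₈ ≡ T₁₆
  T₈+T₈ = doubling T₈ T₁₆ (int (+ 31) (+ 29) (+ 8) (- + 5)) ((λ ()) , refl , refl , refl)

  T₁₆+T₄ : T₁₆ ⊹ T₄ ≡ T₂₀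
  T₁₆+T₄ = addition T₁₆ T₄ T₂₀ (int (+ 5) (+ 12) (+ 12) (- + 4)) ((λ ()) , refl , refl , refl)

  T₂≡ : + 2 · T ≡ T₂
  T₂≡ = ·-sum {+ 1} {+ 1} (·-identityˡ T) (·-identityˡ T) T+T

  T₄≡ : + 4 · T ≡ T₄
  T₄≡ = ·-sum {+ 2} {+ 2} T₂≡ T₂≡ T₂+T₂

  T₈≡ : + 8 · T ≡ T₈
  T₈≡ = ·-sum {+ 4} {+ 4} T₄≡ T₄≡ T₄+T₄

  T₁₆≡ : + 16 · T ≡ T₁₆
  T₁₆≡ = ·-sum {+ 8} {+ 8} T₈≡ T₈≡ T₈+T₈

  21T≡O : + 21 · T ≡ O
  21T≡O = ·-sum {+ 20} {+ 1} (·-sum {+ 16} {+ 4} T₁₆≡ T₄≡ T₁₆+T₄) (·-identityˡ T) (opposed T₂₀ T (refl , refl))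

  -- Otherwise 4T = T, but `T₄` and T have different abscissae.
  3T≢O : ¬ + 3 · T ≡ O
  3T≢O e = contradiction (cong abscissa (trans (sym T₄≡) (·-sum {+ 3} {+ 1} e (·-identityˡ T) (⊹-identityˡ T)))) λ ()

  7T≢O : ¬ + 7 · T ≡ O
  7T≢O e = contradiction (cong abscissa (trans (sym T₈≡) (·-sum {+ 7} {+ 1} e (·-identityˡ T) (⊹-identityˡ T)))) λ ()

  P-infinite : InfiniteOrder P
  P-infinite = near⇒infinite (residue⇒dyadic (θ-Place.residue (- + 4) (- + 5) (- + 7) (- + 1) (- + 2) refl))
    (quad (- + 95) (- + 184) (+ 120) (- + 16) , refl)
    (quad (+ 8960) (+ 5824) (+ 616) (- + 840) , refl)
    (quad (- + 78400) (- + 784) (+ 37632) (- + 8624) , refl)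
    -- 16384 = 4⁷.
    6 P (NearOrigin.near (int (+ 12915845) (+ 6064311) (+ 22857185) (- + 7313037)) (int (+ 1) (+ 0) (+ 0) (+ 0))
      (quad (+ 12915845) (+ 6064311) (+ 22857185) (- + 7313037) , ((+ 6457922) , refl) , refl)
      (quad (+ 1) (+ 0) (+ 0) (+ 0) , (+ 0 , refl) , refl) refl)

  realised : Realised (21 ∷ 0 ∷ [])
  realised = realise (T ∷ P ∷ []) (21T≡O , refl , tt)
    (free₂ T P (λ ()) 21T≡O P-infinite (order-product (from-yes (prime? 3)) (from-yes (prime? 7)) (from-no (7 ℕ.∣? 3)) T 21T≡O 7T≢O 3T≢O))

-- K = ℚ(√6 , √−3) with θ = √−2 + √−3. The Tate normal form with a point of order 9 and parameter t
-- has full 3-torsion when t³ − 6t² + 3t + 1 is a cube; here t = √6/3 and the cube is (t − 1)³.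
module Z3×Z9 where
  f : Quartic
  f = integralQuartic (+ 1) (+ 0) (+ 10) (+ 0)

  anisotropic : KRing.Anisotropic f
  -- Predecessors of c₀ = 1, c₂ = 10 and D = 10² - 4 = 96, which is congruent to 5 modulo 7, a
  -- nonsquare.
  anisotropic = Biquadratic.biquadratic 0 9 95 refl 7 (s≤s (s≤s z≤n)) tt

  a₂ a₄ a₆ : K f
  a₂ = int (+ 922) (+ 0) (+ 84) (+ 0)
  a₄ = int (+ 156672) (+ 0) (+ 15552) (+ 0)
  a₆ = int (+ 23016960) (+ 0) (+ 2322432) (+ 0)

  open OverK f anisotropic a₂ a₄ a₆

  Δ≢0 : ¬ Curve.Δ E ≡ Field.0K f
  Δ≢0 e = contradiction (cong K.a₀ e) λ ()

  open MordellWeil Δ≢0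

  S S₂ T T₂ T₃ T₄ T₈ P : Point
  S  = affine (int (- + 984) (+ 0) (- + 96) (+ 0)) (int (+ 0) (- + 43356) (+ 0) (- + 4380)) refl
  S₂ = affine (int (- + 984) (+ 0) (- + 96) (+ 0)) (int (+ 0) (+ 43356) (+ 0) (+ 4380)) refl
  T  = affine (int (+ 0) (+ 0) (+ 0) (+ 0)) (int (- + 4824) (+ 0) (- + 504) (+ 0)) refl
  T₂ = affine (int (- + 656) (+ 0) (- + 64) (+ 0)) (int (- + 5840) (+ 0) (- + 592) (+ 0)) refl
  T₃ = affine (int (- + 264) (+ 0) (- + 24) (+ 0)) (int (+ 5232) (+ 0) (+ 528) (+ 0)) refl
  T₄ = affine (int (+ 804) (+ 0) (+ 84) (+ 0)) (int (+ 35400) (+ 0) (+ 3576) (+ 0)) refl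
  T₈ = affine (int (+ 0) (+ 0) (+ 0) (+ 0)) (int (+ 4824) (+ 0) (+ 504) (+ 0)) refl
  P  = affine (frac (+ 27736) (+ 0) (+ 2813) (+ 0) 4) (frac (+ 9797629) (+ 0) (+ 989759) (+ 0) 16) refl

  S+S : S ⊹ S ≡ S₂
  S+S = doubling S S₂ (frac (+ 0) (+ 285) (+ 0) (+ 29) 2) ((λ ()) , refl , refl , refl)

  T+T : T ⊹ T ≡ T₂
  T+T = doubling T T₂ (frac (- + 33) (+ 0) (- + 5) (+ 0) 2) ((λ ()) , refl , refl , refl)

  T₂+T₂ : T₂ ⊹ T₂ ≡ T₄
  T₂+T₂ = doubling T₂ T₄ (frac (- + 41) (+ 0) (- + 5) (+ 0) 2) ((λ ()) , refl , refl , refl)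

  T₄+T₄ : T₄ ⊹ T₄ ≡ T₈
  T₄+T₄ = doubling T₄ T₈ (frac (+ 101) (+ 0) (+ 9) (+ 0) 2) ((λ ()) , refl , refl , refl)

  T₂+T : T₂ ⊹ T ≡ T₃
  T₂+T = addition T₂ T T₃ (frac (+ 3) (+ 0) (- + 1) (+ 0) 2) ((λ ()) , refl , refl , refl)

  T₂≡ : + 2 · T ≡ T₂
  T₂≡ = ·-sum {+ 1} {+ 1} (·-identityˡ T) (·-identityˡ T) T+T

  T₄≡ : + 4 · T ≡ T₄
  T₄≡ = ·-sum {+ 2} {+ 2} T₂≡ T₂≡ T₂+T₂

  T₈≡ : + 8 · T ≡ T₈
  T₈≡ = ·-sum {+ 4} {+ 4} T₄≡ T₄≡ T₄+T₄

  T₃≡ : + 3 · T ≡ T₃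
  T₃≡ = ·-sum {+ 2} {+ 1} T₂≡ (·-identityˡ T) T₂+T

  3S≡O : + 3 · S ≡ O
  3S≡O = ·-sum {+ 2} {+ 1} (·-sum {+ 1} {+ 1} (·-identityˡ S) (·-identityˡ S) S+S) (·-identityˡ S) (opposed S₂ S (refl , refl))

  9T≡O : + 9 · T ≡ O
  9T≡O = ·-sum {+ 8} {+ 1} T₈≡ (·-identityˡ T) (opposed T₈ T (refl , refl))

  3·3T≡O : + 3 · (+ 3 · T) ≡ O
  3·3T≡O = trans (sym (·-assoc (+ 3) (+ 3) T)) 9T≡O

  2·T₃≡ : + 2 · T₃ ≡ negate T₃
  2·T₃≡ = inverseˡ-unique (+ 2 · T₃) T₃ (trans (sym (·-sum {+ 2} {+ 1} refl (·-identityˡ T₃) refl)) (trans (cong (+ 3 ·_) (sym T₃≡)) 3·3T≡O))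

  -- The multiples of 3T are O and ±`T₃`, and S has a different abscissa from `T₃`.
  S∉⟨3T⟩ : ∀ k → k < 3 → ¬ S ≡ + k · (+ 3 · T)
  S∉⟨3T⟩ k k<3 e = by-cases k k<3 (trans e (cong (+ k ·_) T₃≡))
    where
    by-cases : ∀ k → k < 3 → ¬ S ≡ + k · T₃
    by-cases 0 _ ()
    by-cases 1 _ e = contradiction (cong abscissa (trans e (·-identityˡ T₃))) λ ()
    by-cases 2 _ e = contradiction (cong abscissa (trans e 2·T₃≡)) λ ()
    by-cases (suc (suc (suc _))) (s≤s (s≤s (s≤s ())))

  P-infinite : InfiniteOrder P
  -- Here w = (-5 - θ²)/2 is a square root of 6, so 2 ramifies in ℤ[w]. The pairs below rewrite the
  -- coefficients and the numerator of x(P) by θ² = -5 - 2w.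
  P-infinite = near⇒infinite (residue⇒dyadic (Places.Quadratic.residue f (frac (- + 5) (+ 0) (- + 1) (+ 0) 2) (+ 3) refl))
    ((+ 502 , - + 168) , refl) ((+ 78912 , - + 31104) , refl) ((+ 11404800 , - + 4644864) , refl)
    0 P (NearOrigin.near (int (+ 27736) (+ 0) (+ 2813) (+ 0)) (int (+ 1) (+ 0) (+ 0) (+ 0)) ((+ 13671 , - + 5626) , ((+ 6835) , refl) , refl) ((+ 1 , + 0) , ((+ 0) , refl) , refl) refl)

  realised : Realised (3 ∷ 9 ∷ 0 ∷ [])
  realised = realise (S ∷ T ∷ P ∷ []) (3S≡O , 9T≡O , refl , tt)
    (free₃ S T P (λ ()) (multiple-ε (+ 3) (+ 3) S 3S≡O) 9T≡O P-infinite
      (independent-p-p² (from-yes (prime? 3)) S T 3S≡O 3·3T≡O (λ e → contradiction (trans (sym T₃≡) e) λ ()) S∉⟨3T⟩))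

-- K = ℚ(i , √7) with θ = i + √−7 and y² = x(x + 3⁴)(x + 4⁴). As 3² + 4² is a square there is a rational
-- point of order 8, and over K all differences of the roots are squares.
module Z4×Z8 where
  f : Quartic
  f = integralQuartic (+ 36) (+ 0) (+ 16) (+ 0)

  anisotropic : KRing.Anisotropic f
  -- Predecessors of c₀ = 36, c₂ = 16 and D = 16² - 4 · 36 = 112, which is congruent to 2 modulo 5,
  -- a nonsquare.
  anisotropic = Biquadratic.biquadratic 35 15 111 refl 5 (s≤s (s≤s z≤n)) tt

  a₂ a₄ a₆ : K f
  a₂ = int (+ 337) (+ 0) (+ 0) (+ 0)
  a₄ = int (+ 20736) (+ 0) (+ 0) (+ 0)
  a₆ = int (+ 0) (+ 0) (+ 0) (+ 0)

  open OverK f anisotropic a₂ a₄ a₆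

  Δ≢0 : ¬ Curve.Δ E ≡ Field.0K f
  Δ≢0 e = contradiction (cong K.a₀ e) λ ()

  open MordellWeil Δ≢0

  S S₂ T T₂ T₄ P : Point
  -- A half of the 2-torsion point at -81, whose differences to the other roots are (9i)² and
  -- (5√7)². Since θ³ + 22θ = 12√-7, the abscissa is -81 + 45√-7.
  S  = affine (frac (- + 324) (+ 330) (+ 0) (+ 15) 4) (frac (+ 6480) (- + 5250) (+ 810) (- + 525) 4) refl
  S₂ = affine (int (- + 81) (+ 0) (+ 0) (+ 0)) (int (+ 0) (+ 0) (+ 0) (+ 0)) refl
  T  = affine (int (+ 24) (+ 0) (+ 0) (+ 0)) (int (+ 840) (+ 0) (+ 0) (+ 0)) refl
  T₂ = affine (int (+ 144) (+ 0) (+ 0) (+ 0)) (int (- + 3600) (+ 0) (+ 0) (+ 0)) refl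
  T₄ = affine (int (+ 0) (+ 0) (+ 0) (+ 0)) (int (+ 0) (+ 0) (+ 0) (+ 0)) refl
  -- The ordinate is a rational multiple of θ³ + 22θ = 12√-7, so P comes from a rational point of
  -- the quadratic twist by -7.
  P  = affine (frac (- + 845306847) (+ 0) (+ 0) (+ 0) 28472896) (frac (+ 0) (+ 247259999399094) (+ 0) (+ 11239090881777) 607725492224) refl

  S+S : S ⊹ S ≡ S₂
  S+S = doubling S S₂ (frac (- + 80) (- + 30) (- + 10) (- + 3) 4) ((λ ()) , refl , refl , refl)

  T+T : T ⊹ T ≡ T₂
  T+T = doubling T T₂ (int (+ 23) (+ 0) (+ 0) (+ 0)) ((λ ()) , refl , refl , refl)

  T₂+T₂ : T₂ ⊹ T₂ ≡ T₄
  T₂+T₂ = doubling T₂ T₄ (int (- + 25) (+ 0) (+ 0) (+ 0)) ((λ ()) , refl , refl , refl)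

  S₂≡ : + 2 · S ≡ S₂
  S₂≡ = ·-sum {+ 1} {+ 1} (·-identityˡ S) (·-identityˡ S) S+S

  T₂≡ : + 2 · T ≡ T₂
  T₂≡ = ·-sum {+ 1} {+ 1} (·-identityˡ T) (·-identityˡ T) T+T

  T₄≡ : + 4 · T ≡ T₄
  T₄≡ = ·-sum {+ 2} {+ 2} T₂≡ T₂≡ T₂+T₂

  4S≡O : + 4 · S ≡ O
  4S≡O = ·-sum {+ 2} {+ 2} S₂≡ S₂≡ (opposed S₂ S₂ (refl , refl))

  8T≡O : + 8 · T ≡ O
  8T≡O = ·-sum {+ 4} {+ 4} T₄≡ T₄≡ (opposed T₄ T₄ (refl , refl))

  2·2T≡ : + 2 · (+ 2 · T) ≡ T₄
  2·2T≡ = trans (sym (·-assoc (+ 2) (+ 2) T)) T₄≡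

  2·2·2T≡O : + 2 · (+ 2 · (+ 2 · T)) ≡ O
  2·2·2T≡O = trans (cong (+ 2 ·_) (sym (·-assoc (+ 2) (+ 2) T))) (trans (sym (·-assoc (+ 2) (+ 4) T)) 8T≡O)

  2S∉⟨4T⟩ : ∀ k → k < 2 → ¬ + 2 · S ≡ + k · (+ 2 · (+ 2 · T))
  2S∉⟨4T⟩ k k<2 e = by-cases k k<2 (trans (sym S₂≡) (trans e (cong (+ k ·_) 2·2T≡)))
    where
    by-cases : ∀ k → k < 2 → ¬ S₂ ≡ + k · T₄
    by-cases 0 _ ()
    by-cases 1 _ e = contradiction (cong abscissa (trans e (·-identityˡ T₄))) λ ()
    by-cases (suc (suc _)) (s≤s (s≤s ()))

  P-infinite : InfiniteOrder P
  -- With w = 0 the integral elements are those of ℤ, which is enough because the coefficients and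
  -- x(P) are rational.
  P-infinite = near⇒infinite (residue⇒dyadic (Places.Quadratic.residue f (int (+ 0) (+ 0) (+ 0) (+ 0)) (+ 0) refl))
    ((+ 337 , + 0) , refl) ((+ 20736 , + 0) , refl) ((+ 0 , + 0) , refl)
    -- The denominator of x(P) is 4³ · 444889, with 444889 = 667² odd.
    2 P (NearOrigin.near (int (- + 845306847) (+ 0) (+ 0) (+ 0)) (int (+ 444889) (+ 0) (+ 0) (+ 0)) ((- + 845306847 , + 0) , ((- + 422653424) , refl) , refl) ((+ 444889 , + 0) , ((+ 222444) , refl) , refl) refl)

  realised : Realised (4 ∷ 8 ∷ 0 ∷ [])
  realised = realise (S ∷ T ∷ P ∷ []) (4S≡O , 8T≡O , refl , tt)
    (free₃ S T P (λ ()) (multiple-ε (+ 2) (+ 4) S 4S≡O) 8T≡O P-infinite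
      (independent-p²-p³ (from-yes (prime? 2)) S T (trans (sym (·-assoc (+ 2) (+ 2) S)) 4S≡O) 2·2·2T≡O
        (λ e → contradiction (trans (sym 2·2T≡) e) λ ()) 2S∉⟨4T⟩))

-- K = ℚ(ζ₅). The parameter 123/11 of the Tate normal form with a point of order 5 comes from
-- a rational point of the twist of X(5) classifying subgroups ℤ/5 × μ₅.
module Z5×Z5 where
  f : Quartic
  f = integralQuartic (+ 1) (+ 1) (+ 1) (+ 1)

  anisotropic : KRing.Anisotropic f
  anisotropic = inert₃ (+ 1) (+ 1) (+ 1) (+ 1) tt

  a₂ a₄ a₆ : K f
  a₂ = int (+ 7132) (+ 0) (+ 0) (+ 0)
  a₄ = int (+ 13335168) (+ 0) (+ 0) (+ 0)
  a₆ = int (+ 3544059024) (+ 0) (+ 0) (+ 0)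

  open OverK f anisotropic a₂ a₄ a₆

  Δ≢0 : ¬ Curve.Δ E ≡ Field.0K f
  Δ≢0 e = contradiction (cong K.a₀ e) λ ()

  open MordellWeil Δ≢0

  S S₂ S₄ T T₂ T₄ P : Point
  S  = affine (int (- + 7216) (+ 0) (- + 1804) (- + 1804)) (int (+ 88396) (+ 176792) (- + 86592) (+ 263384)) refl
  S₂ = affine (int (- + 5412) (+ 0) (+ 1804) (+ 1804)) (int (+ 174988) (+ 349976) (+ 263384) (+ 86592)) refl
  S₄ = affine (int (- + 7216) (+ 0) (- + 1804) (- + 1804)) (int (- + 88396) (- + 176792) (+ 86592) (- + 263384)) refl
  T  = affine (int (+ 0) (+ 0) (+ 0) (+ 0)) (int (- + 59532) (+ 0) (+ 0) (+ 0)) refl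
  T₂ = affine (int (+ 5412) (+ 0) (+ 0) (+ 0)) (int (+ 665676) (+ 0) (+ 0) (+ 0)) refl
  T₄ = affine (int (+ 0) (+ 0) (+ 0) (+ 0)) (int (+ 59532) (+ 0) (+ 0) (+ 0)) refl
  P  = affine (frac (+ 520905) (+ 0) (+ 0) (+ 0) 4) (frac (+ 386258499) (+ 0) (+ 0) (+ 0) 8) refl

  S+S : S ⊹ S ≡ S₂
  S+S = doubling S S₂ (int (+ 10) (+ 20) (+ 78) (- + 58)) ((λ ()) , refl , refl , refl)

  S₂+S₂ : S₂ ⊹ S₂ ≡ S₄
  S₂+S₂ = doubling S₂ S₄ (int (- + 68) (- + 136) (- + 58) (- + 78)) ((λ ()) , refl , refl , refl)

  T+T : T ⊹ T ≡ T₂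
  T+T = doubling T T₂ (int (- + 112) (+ 0) (+ 0) (+ 0)) ((λ ()) , refl , refl , refl)

  T₂+T₂ : T₂ ⊹ T₂ ≡ T₄
  T₂+T₂ = doubling T₂ T₄ (int (+ 134) (+ 0) (+ 0) (+ 0)) ((λ ()) , refl , refl , refl)

  S₂≡ : + 2 · S ≡ S₂
  S₂≡ = ·-sum {+ 1} {+ 1} (·-identityˡ S) (·-identityˡ S) S+S

  S₄≡ : + 4 · S ≡ S₄
  S₄≡ = ·-sum {+ 2} {+ 2} S₂≡ S₂≡ S₂+S₂

  T₂≡ : + 2 · T ≡ T₂
  T₂≡ = ·-sum {+ 1} {+ 1} (·-identityˡ T) (·-identityˡ T) T+T

  T₄≡ : + 4 · T ≡ T₄
  T₄≡ = ·-sum {+ 2} {+ 2} T₂≡ T₂≡ T₂+T₂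

  5S≡O : + 5 · S ≡ O
  5S≡O = ·-sum {+ 4} {+ 1} S₄≡ (·-identityˡ S) (opposed S₄ S (refl , refl))

  5T≡O : + 5 · T ≡ O
  5T≡O = ·-sum {+ 4} {+ 1} T₄≡ (·-identityˡ T) (opposed T₄ T (refl , refl))

  3T≡ : + 3 · T ≡ negate T₂
  3T≡ = inverseˡ-unique (+ 3 · T) T₂ (trans (sym (·-sum {+ 3} {+ 2} refl T₂≡ refl)) 5T≡O)

  -- The nonzero multiples of T have rational abscissae 0 and 5412, while that of S is irrational.
  S∉⟨T⟩ : ∀ k → k < 5 → ¬ S ≡ + k · T
  S∉⟨T⟩ 0 _ ()
  S∉⟨T⟩ 1 _ e = contradiction (cong abscissa (trans e (·-identityˡ T))) λ ()
  S∉⟨T⟩ 2 _ e = contradiction (cong abscissa (trans e T₂≡)) λ ()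
  S∉⟨T⟩ 3 _ e = contradiction (cong abscissa (trans e 3T≡)) λ ()
  S∉⟨T⟩ 4 _ e = contradiction (cong abscissa (trans e T₄≡)) λ ()
  S∉⟨T⟩ (suc (suc (suc (suc (suc _))))) (s≤s (s≤s (s≤s (s≤s (s≤s ())))))

  P-infinite : InfiniteOrder P
  P-infinite = near⇒infinite (residue⇒dyadic (Places.Quadratic.residue f (int (+ 0) (+ 0) (+ 0) (+ 0)) (+ 0) refl))
    ((+ 7132 , + 0) , refl) ((+ 13335168 , + 0) , refl) ((+ 3544059024 , + 0) , refl)
    0 P (NearOrigin.near (int (+ 520905) (+ 0) (+ 0) (+ 0)) (int (+ 1) (+ 0) (+ 0) (+ 0)) ((+ 520905 , + 0) , ((+ 260452) , refl) , refl) ((+ 1 , + 0) , ((+ 0) , refl) , refl) refl)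

  realised : Realised (5 ∷ 5 ∷ 0 ∷ [])
  realised = realise (S ∷ T ∷ P ∷ []) (5S≡O , 5T≡O , refl , tt)
    (free₃ S T P (λ ()) 5S≡O 5T≡O P-infinite (independent (from-yes (prime? 5)) S T 5S≡O 5T≡O (λ ()) S∉⟨T⟩))

theorem3p4 : Realised (17 ∷ 0 ∷ [])
    × Realised (21 ∷ 0 ∷ [])
    × Realised (3 ∷ 9 ∷ 0 ∷ [])
    × Realised (4 ∷ 8 ∷ 0 ∷ [])
    × Realised (5 ∷ 5 ∷ 0 ∷ [])
theorem3p4 = Z17.realised , Z21.realised , Z3×Z9.realised , Z4×Z8.realised , Z5×Z5.realised
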